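{- Let $p\ge 3$ and $p_1\ge 5$ be any primes. Then for all nonnegative integers $n$ and $\alpha$ the following hold. (1) If $n\neq k(3k+1)/2$ for all $k\in\mathbb{Z}$, then $$v_0(p^{2\alpha}(96n+4))\equiv 0\pmod{27}.$$ (2) For every $i\in\{1,2,3,\ldots,p_1-1\}$, $$v_0(p^{2\alpha}p_1(96p_1n+96i+4p_1))\equiv 0\pmod{27}.$$ (3) For every integer $j\ge 0$ such that $24j+1$ is a quadratic nonresidue modulo $p_1$, $$v_0(p^{2\alpha}(96p_1n+96j+4))\equiv 0\pmod{27}.$$
   Context: The integer sequence $v_0(n)$, $n\ge 0$, is defined by the generating function (formal power series in $q$) $$\sum_{n=0}^\infty v_0(n)q^n=\sum_{n=0}^\infty \frac{q^{n^2}(-q;q^2)_n}{(q;q^2)_n},$$ where $(a;q)_0=1$ and $(a;q)_n=\prod_{i=1}^n(1-aq^{i-1})$ for $n\ge1$, so that $(-q;q^2)_n=\prod_{i=1}^n(1+q^{2i-1})$ and $(q;q^2)_n=\prod_{i=1}^n(1-q^{2i-1})$. -}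

module Defs where

open import Data.Nat.Base as ℕ using (ℕ; zero; suc; z≤n; s≤s)
import Data.Nat.Properties as ℕ
open import Data.Integer.Base using (ℤ; +_; 0ℤ; 1ℤ; _+_; _-_; _*_; -_)
open import Data.Integer.Properties
  using (+-identityʳ; +-inverseˡ; *-identityˡ; *-identityʳ; *-zeroˡ)
open import Data.Integer.Divisibility.Signed using (_∣_)
open import Data.Product.Base using (∃-syntax)
open import Relation.Nullary.Negation.Core using (¬_)
open import Relation.Binary.PropositionalEquality
  using (_≡_; refl; sym; trans; cong; cong₂; module ≡-Reasoning)

infix  5 Σ<
infixl 6 _⊕_ _⊖_
infixl 7 _⊗_ _⊘_
infixr 8 _^^_
infix  9 ⊝_ _⁻¹

Σ< : ℕ → (ℕ → ℤ) → ℤ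
Σ< zero    f = 0ℤ
Σ< (suc n) f = f 0 + Σ< n (λ i → f (suc i))

syntax Σ< n (λ i → t) = Σ[ i < n ] t

-- Formal power series in q over ℤ: `f m` is the coefficient of q^m.
PowerSeries : Set
PowerSeries = ℕ → ℤ

𝟙 : PowerSeries
𝟙 zero    = 1ℤ
𝟙 (suc _) = 0ℤ

q : PowerSeries
q 1 = 1ℤ
q _ = 0ℤ

_⊕_ _⊖_ _⊗_ : PowerSeries → PowerSeries → PowerSeries
(f ⊕ g) m = f m + g m
(f ⊖ g) m = f m - g m
(f ⊗ g) m = Σ[ i < suc m ] f i * g (m ℕ.∸ i)

⊝_ : PowerSeries → PowerSeries
(⊝ f) m = - f m

_^^_ : PowerSeries → ℕ → PowerSeries
f ^^ zero    = 𝟙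
f ^^ (suc n) = f ⊗ (f ^^ n)

-- Coefficients of the inverse of a series f with f 0 ≡ 1, by the recursion
--   g 0 = 1,   g (n + 1) = - (f 1 * g n + f 2 * g (n - 1) + ⋯ + f (n + 1) * g 0).
-- `inverseTable f n i` is g (n - i) for i ≤ n; the second argument is there
-- only to make the course-of-values recursion structural.
inverseTable : PowerSeries → ℕ → ℕ → ℤ
inverseTable f zero    _       = 1ℤ
inverseTable f (suc n) zero    = - (Σ[ i < suc n ] f (suc i) * inverseTable f n i)
inverseTable f (suc n) (suc i) = inverseTable f n i

-- Only meaningful when f 0 ≡ 1; see `⊗-inverseʳ`.
_⁻¹ : PowerSeries → PowerSeries
(f ⁻¹) n = inverseTable f n 0

_⊘_ : PowerSeries → PowerSeries → PowerSeries
f ⊘ g = f ⊗ g ⁻¹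

-- (a ; b)ₙ = ∏_{i=1}^{n} (1 - a b^{i-1})
poch : PowerSeries → PowerSeries → ℕ → PowerSeries
poch a b zero    = 𝟙
poch a b (suc n) = poch a b n ⊗ (𝟙 ⊖ a ⊗ b ^^ n)

-- Σ_{n ≥ 0} F n for a family in which q^n divides F n, so that only
-- F 0, …, F m contribute to the coefficient of q^m.
Σ∞ : (ℕ → PowerSeries) → PowerSeries
Σ∞ F m = Σ[ n < suc m ] F n m

v₀-term : ℕ → PowerSeries
v₀-term n = (q ^^ (n ℕ.* n) ⊗ poch (⊝ q) (q ^^ 2) n) ⊘ poch q (q ^^ 2) n

v₀ : ℕ → ℤ
v₀ = Σ∞ v₀-term

-- For m prime this forces a to be coprime to m, since 0 is a square.
QuadraticNonresidue : ℤ → ℕ → Set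
QuadraticNonresidue a m = ¬ (∃[ x ] + m ∣ x * x - a)

-- The side conditions under which `_⁻¹` and `Σ∞` have their intended
-- meaning do hold in the definition of v₀.

Σ<-cong : ∀ n {f g : ℕ → ℤ} → (∀ i → i ℕ.< n → f i ≡ g i) → Σ< n f ≡ Σ< n g
Σ<-cong zero    eq = refl
Σ<-cong (suc n) eq = cong₂ _+_ (eq 0 (s≤s z≤n)) (Σ<-cong n (λ i i<n → eq (suc i) (s≤s i<n)))

Σ<-zero : ∀ n {f : ℕ → ℤ} → (∀ i → i ℕ.< n → f i ≡ 0ℤ) → Σ< n f ≡ 0ℤ
Σ<-zero zero    eq = refl
Σ<-zero (suc n) eq = cong₂ _+_ (eq 0 (s≤s z≤n)) (Σ<-zero n (λ i i<n → eq (suc i) (s≤s i<n)))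

inverseTable-spec : ∀ f n i → i ℕ.≤ n → inverseTable f n i ≡ (f ⁻¹) (n ℕ.∸ i)
inverseTable-spec f zero    zero    _         = refl
inverseTable-spec f (suc n) zero    _         = refl
inverseTable-spec f (suc n) (suc i) (s≤s i≤n) = inverseTable-spec f n i i≤n

⊗-inverseʳ : ∀ f → f 0 ≡ 1ℤ → ∀ m → (f ⊗ f ⁻¹) m ≡ 𝟙 m
⊗-inverseʳ f f0≡1 zero    = trans (+-identityʳ _) (trans (*-identityʳ _) f0≡1)
⊗-inverseʳ f f0≡1 (suc n) = begin
  f 0 * (- S) + (Σ[ i < suc n ] f (suc i) * (f ⁻¹) (n ℕ.∸ i))
    ≡⟨ cong₂ _+_ (trans (cong (_* - S) f0≡1) (*-identityˡ (- S)))
                 (Σ<-cong (suc n) λ { i (s≤s i≤n) →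
                   cong (f (suc i) *_) (sym (inverseTable-spec f n i i≤n)) }) ⟩
  - S + S
    ≡⟨ +-inverseˡ S ⟩
  0ℤ ∎
  where
  open ≡-Reasoning
  S : ℤ
  S = Σ[ i < suc n ] f (suc i) * inverseTable f n i

poch-constant : ∀ a b n → a 0 ≡ 0ℤ → poch a b n 0 ≡ 1ℤ
poch-constant a b zero    a0≡0 = refl
poch-constant a b (suc n) a0≡0
  rewrite poch-constant a b n a0≡0 | a0≡0 | *-zeroˡ ((b ^^ n) 0) = refl

-- f has no terms below q^k.
Order≥ : ℕ → PowerSeries → Set
Order≥ k f = ∀ m → m ℕ.< k → f m ≡ 0ℤ

Order≥-⊗ʳ : ∀ {k} f g → Order≥ k f → Order≥ k (f ⊗ g)
Order≥-⊗ʳ f g f≥k m m<k = Σ<-zero (suc m) λ { i (s≤s i≤m) →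
  trans (cong (_* g (m ℕ.∸ i)) (f≥k i (ℕ.≤-<-trans i≤m m<k))) (*-zeroˡ (g (m ℕ.∸ i))) }

Order≥-q⊗ : ∀ {k} f → Order≥ k f → Order≥ (suc k) (q ⊗ f)
Order≥-q⊗ f f≥k m m<1+k = Σ<-zero (suc m) (term m m<1+k)
  where
  term : ∀ m → m ℕ.< suc _ → ∀ i → i ℕ.< suc m → q i * f (m ℕ.∸ i) ≡ 0ℤ
  term m       _         zero          _ = *-zeroˡ (f m)
  term (suc m) (s≤s m<k) (suc zero)    _ = trans (*-identityˡ (f m)) (f≥k m m<k)
  term zero    _         (suc i) (s≤s ())
  term (suc m) _         (suc (suc i)) _ = *-zeroˡ (f (m ℕ.∸ suc i))

Order≥-q^^ : ∀ k → Order≥ k (q ^^ k)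
Order≥-q^^ zero    m ()
Order≥-q^^ (suc k) = Order≥-q⊗ (q ^^ k) (Order≥-q^^ k)

v₀-term-order : ∀ n → Order≥ (n ℕ.* n) (v₀-term n)
v₀-term-order n =
  Order≥-⊗ʳ (q ^^ (n ℕ.* n) ⊗ poch (⊝ q) (q ^^ 2) n) (poch q (q ^^ 2) n ⁻¹)
    (Order≥-⊗ʳ (q ^^ (n ℕ.* n)) (poch (⊝ q) (q ^^ 2) n) (Order≥-q^^ (n ℕ.* n)))

{-# OPTIONS --safe #-}
-- Write φ(q) = Σ_{n∈ℤ} q^{n²}, φ⁻(q) = φ(-q), ψ(q) = Σ_{n≥0} q^{n(n+1)/2}, and f_k for f(q^k).
--
-- For a = ±1 put t_n(c) = ∏_{i=1}^{n} Q^{i-1}(c - aQ^i)/(1 - cQ^{i-1}) and S(c) = Σ t_n(c) + Σ t_n(ac) - 1.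
-- A telescoping sum gives (1 - c)(1 - ac) S(c) = (1 - ac²) S(cQ), so S(c) is an infinite product times the
-- theta series S(0).  With V(q) = Σ v₀(n) q^n, the instance a = -1, Q = q², c = q computes V(q) + V(-q) - 1;
-- the instances with a = 1 are product formulas for φ and φ⁻.  Together, V(q) + V(-q) - 1 = φ_2² / φ⁻_4.
--
-- The identities φ φ⁻ = (φ⁻_2)², φ² = φ_2² + 4qψ_4², ψ² = φ ψ_2 and φ = φ_4 + 2qψ_8 then extract the
-- coefficients 4(8n+1):  v₀(4(8n+1)) = 3ψ(n) + 512 W(n), where W = q ψ⁹ / (φ⁻)⁸.
--
-- Let H = ∏(1 + q^n).  Since ψ = H³φ⁻, W = q φ⁻ H^27 ≡ q φ⁻ (H_3)^9 modulo 27.  Squares are 0 or 1 modulo 3,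
-- hence W(3n) ≡ 0.  At 9k + 1 only the part φ⁻_9 of φ⁻ survives and W(9k+1) is the coefficient of q^{3k} in
-- φ⁻_3 H⁹ ≡ ψ_3 (1 + 9Y), where Y = L - L_2 and L = Σ σ(n) q^n.  As σ(3n) ≡ σ(n) modulo 3 and Y is the
-- logarithmic derivative of ψ modulo 3, this is (1 + 9k) ψ(k) modulo 27.
--
-- So 27 divides v₀(4M) for every nonsquare M ≡ 1 (mod 24), and for every nonsquare M = 9m with m ≡ 1 (mod 8);
-- in all three statements M = p^{2α}(24n'+1) is of one of these two kinds.
module Submission where

open import Algebra.Bundles using (CommutativeRing)
import Algebra.Solver.Ring
open import Algebra.Solver.Ring.AlmostCommutativeRing
  using (fromCommutativeRing; _-Raw-AlmostCommutative⟶_)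
open import Data.Integer.Base as ℤ using (ℤ; +_; 0ℤ; 1ℤ; -1ℤ)
open import Data.Integer.Divisibility.Signed
  using (_∣_; divides; 0∣⇒≡0; ∣m∣n⇒∣m+n; ∣n⇒∣m*n; ∣m⇒∣m*n; ∣m⇒∣-m; ∣-trans; ∣ᵤ⇒∣; *-monoʳ-∣)
import Data.Integer.Properties as ℤ
open import Data.Integer.Tactic.RingSolver using (solve-∀)
open import Data.Maybe.Base using (Maybe; just; nothing)
open import Data.Nat.Base as ℕ using (ℕ; zero; suc; _<_; _≤_; z≤n; s≤s; _∸_; NonZero)
import Data.Nat.Divisibility as ℕ∣
open import Data.Nat.Primality using (Prime; euclidsLemma; prime?; prime⇒irreducible; prime⇒nonZero)
import Data.Nat.Properties as ℕ
import Data.Nat.Tactic.RingSolver as ℕ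
open import Data.Product.Base using (_×_; _,_; ∃-syntax)
open import Data.Sum.Base using (_⊎_; inj₁; inj₂; [_,_]′)
open import Function.Base using (case_of_; id)
open import Level using (0ℓ)
open import Relation.Binary.PropositionalEquality
open import Relation.Nullary using (yes; no; ¬_; contradiction)
open import Relation.Nullary.Decidable using (from-yes; _⊎-dec_; _→-dec_)
open import Defs hiding (q)
import Defs

-- No infinite product is ever formed: products are cut after `K` factors and compared modulo q^N
-- with `N ≤ K`. Every factor has constant term 1, so common factors cancel even modulo (k, q^N).
-- Jacobi's triple product is avoided as well: c is paired with ac in S because the inhomogeneous
-- parts of their two shift equations then cancel, and the theta products come out as instances of
-- the resulting homogeneous equation.
--
-- The constant 512 is 2^9. Multiplying φ²/φ⁻ by (φ⁻_8)^8 gives a form of degree 9 in φ_4 and b =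
-- 2qψ_8, and its part with exponents 1 modulo 8 is 3b(φ⁻_8)^8 + 2b^9; the first summand yields 3ψ
-- and the second 512 W.
--
-- The modulus 27 is reached because H^27 = (H³)^9: a congruence modulo 3 cubed twice holds modulo
-- 27. The term 3ψ(n) has to vanish outright, and this is where nonsquares enter. The second class
-- of indices is forced by p = 3: unlike p² for p ≥ 5, 9 is not 1 modulo 24, only 1 modulo 8.

-- Power series as a commutative ring, exactly and modulo (k, q^N)

module SeriesRing where
  private variable
    k : ℤ
    M N : ℕ

  infix 4 _≡[_]_
  -- Wrapped as a record so that unification recovers `a`, `k` and `b` from the type of a
  -- congruence; the divisibility of a computed difference would not determine them.
  record _≡[_]_ (a k b : ℤ) : Set where
    constructor mod
    field divisible : k ∣ a ℤ.- b
  open _≡[_]_ public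

  private variable
    a b c d : ℤ

  ≡⇒≡[] : a ≡ b → a ≡[ k ] b
  ≡⇒≡[] {a} refl = mod (divides 0ℤ (ℤ.+-inverseʳ a))

  []-sym : a ≡[ k ] b → b ≡[ k ] a
  []-sym {a} {k} {b} (mod p) = mod (subst (k ∣_) (eq a b) (∣m⇒∣-m p))
    where eq : ∀ a b → ℤ.- (a ℤ.- b) ≡ b ℤ.- a
          eq = solve-∀

  []-trans : a ≡[ k ] b → b ≡[ k ] c → a ≡[ k ] c
  []-trans {a} {k} {b} {c} (mod p) (mod r) = mod (subst (k ∣_) (eq a b c) (∣m∣n⇒∣m+n p r))
    where eq : ∀ a b c → (a ℤ.- b) ℤ.+ (b ℤ.- c) ≡ a ℤ.- c
          eq = solve-∀

  []-+ : a ≡[ k ] b → c ≡[ k ] d → a ℤ.+ c ≡[ k ] b ℤ.+ d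
  []-+ {a} {k} {b} {c} {d} (mod p) (mod r) = mod (subst (k ∣_) (eq a b c d) (∣m∣n⇒∣m+n p r))
    where eq : ∀ a b c d → (a ℤ.- b) ℤ.+ (c ℤ.- d) ≡ (a ℤ.+ c) ℤ.- (b ℤ.+ d)
          eq = solve-∀

  []-* : a ≡[ k ] b → c ≡[ k ] d → a ℤ.* c ≡[ k ] b ℤ.* d
  []-* {a} {k} {b} {c} {d} (mod p) (mod r) =
    mod (subst (k ∣_) (eq a b c d) (∣m∣n⇒∣m+n (∣m⇒∣m*n c p) (∣n⇒∣m*n b r)))
    where eq : ∀ a b c d → (a ℤ.- b) ℤ.* c ℤ.+ b ℤ.* (c ℤ.- d) ≡ (a ℤ.* c) ℤ.- (b ℤ.* d)
          eq = solve-∀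

  []-neg : a ≡[ k ] b → ℤ.- a ≡[ k ] ℤ.- b
  []-neg {a} {k} {b} (mod p) = mod (subst (k ∣_) (eq a b) (∣m⇒∣-m p))
    where eq : ∀ a b → ℤ.- (a ℤ.- b) ≡ (ℤ.- a) ℤ.- (ℤ.- b)
          eq = solve-∀

  ∣⇒≡[] : k ∣ a → a ≡[ k ] 0ℤ
  ∣⇒≡[] {k} {a} d = mod (subst (k ∣_) (sym (ℤ.+-identityʳ a)) d)

  ≡[]⇒∣ : a ≡[ k ] 0ℤ → k ∣ a
  ≡[]⇒∣ {a} {k} (mod d) = subst (k ∣_) (ℤ.+-identityʳ a) d

  Σ<-≡[] : ∀ n {F G : ℕ → ℤ} → (∀ i → i < n → F i ≡[ k ] G i) → Σ< n F ≡[ k ] Σ< n G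
  Σ<-≡[] zero    d = ≡⇒≡[] refl
  Σ<-≡[] (suc n) d = []-+ (d 0 (s≤s z≤n)) (Σ<-≡[] n λ i i<n → d (suc i) (s≤s i<n))

  Σ<-∣ : ∀ n {F : ℕ → ℤ} → (∀ i → i < n → k ∣ F i) → k ∣ Σ< n F
  Σ<-∣ zero    d = divides 0ℤ refl
  Σ<-∣ (suc n) d = ∣m∣n⇒∣m+n (d 0 (s≤s z≤n)) (Σ<-∣ n λ i i<n → d (suc i) (s≤s i<n))

  Σ<-+ : ∀ n (F G : ℕ → ℤ) → Σ< n (λ i → F i ℤ.+ G i) ≡ Σ< n F ℤ.+ Σ< n G
  Σ<-+ zero    F G = refl
  Σ<-+ (suc n) F G = trans (cong (λ s → F 0 ℤ.+ G 0 ℤ.+ s) (Σ<-+ n _ _)) (eq (F 0) (G 0) _ _)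
    where eq : ∀ a b c d → a ℤ.+ b ℤ.+ (c ℤ.+ d) ≡ a ℤ.+ c ℤ.+ (b ℤ.+ d)
          eq = solve-∀

  Σ<-* : ∀ n c (F : ℕ → ℤ) → Σ< n (λ i → c ℤ.* F i) ≡ c ℤ.* Σ< n F
  Σ<-* zero    c F = sym (ℤ.*-zeroʳ c)
  Σ<-* (suc n) c F = trans (cong (λ s → c ℤ.* F 0 ℤ.+ s) (Σ<-* n c _)) (sym (ℤ.*-distribˡ-+ c _ _))

  tail : PowerSeries → PowerSeries
  tail f m = f (suc m)

  ⊗-congʳ : ∀ f {g g′} → g ≗ g′ → f ⊗ g ≗ f ⊗ g′
  ⊗-congʳ f eq m = Σ<-cong (suc m) λ i _ → cong (f i ℤ.*_) (eq (m ∸ i))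

  ⊗-congˡ : ∀ g {f f′} → f ≗ f′ → f ⊗ g ≗ f′ ⊗ g
  ⊗-congˡ g eq m = Σ<-cong (suc m) λ i _ → cong (ℤ._* g (m ∸ i)) (eq i)

  ⊗-distribʳ : ∀ f g h → (f ⊕ g) ⊗ h ≗ (f ⊗ h) ⊕ (g ⊗ h)
  ⊗-distribʳ f g h m =
    trans (Σ<-cong (suc m) λ i _ → ℤ.*-distribʳ-+ (h (m ∸ i)) (f i) (g i))
          (Σ<-+ (suc m) (λ i → f i ℤ.* h (m ∸ i)) (λ i → g i ℤ.* h (m ∸ i)))

  ⊗-scaleˡ : ∀ c f g m → ((λ i → c ℤ.* f i) ⊗ g) m ≡ c ℤ.* (f ⊗ g) m
  ⊗-scaleˡ c f g m =
    trans (Σ<-cong (suc m) λ i _ → ℤ.*-assoc c (f i) (g (m ∸ i))) (Σ<-* (suc m) c (λ i → f i ℤ.* g (m ∸ i)))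

  -- The Cauchy product unfolds at its first summand; here the last one is split off. Commutativity
  -- is then an induction matching the first summand in one order with the last in the other.
  ⊗-suc : ∀ f g m → (f ⊗ g) (suc m) ≡ (f ⊗ tail g) m ℤ.+ f (suc m) ℤ.* g 0
  ⊗-suc f g zero = eq (f 0 ℤ.* g 1) (f 1 ℤ.* g 0)
    where eq : ∀ a b → a ℤ.+ (b ℤ.+ 0ℤ) ≡ a ℤ.+ 0ℤ ℤ.+ b
          eq = solve-∀
  ⊗-suc f g (suc m) =
    trans (cong (λ s → f 0 ℤ.* g (suc (suc m)) ℤ.+ s) (⊗-suc (tail f) g m)) (sym (ℤ.+-assoc (f 0 ℤ.* g (suc (suc m))) _ _))

  ⊗-comm : ∀ f g → f ⊗ g ≗ g ⊗ f
  ⊗-comm f g zero = cong (ℤ._+ 0ℤ) (ℤ.*-comm (f 0) (g 0))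
  ⊗-comm f g (suc m) = begin
    f 0 ℤ.* g (suc m) ℤ.+ (tail f ⊗ g) m  ≡⟨ cong₂ ℤ._+_ (ℤ.*-comm (f 0) (g (suc m))) (⊗-comm (tail f) g m) ⟩
    g (suc m) ℤ.* f 0 ℤ.+ (g ⊗ tail f) m  ≡⟨ ℤ.+-comm (g (suc m) ℤ.* f 0) _ ⟩
    (g ⊗ tail f) m ℤ.+ g (suc m) ℤ.* f 0  ≡⟨ ⊗-suc g f m ⟨
    (g ⊗ f) (suc m)                       ∎
    where open ≡-Reasoning

  ⊗-assoc : ∀ f g h → (f ⊗ g) ⊗ h ≗ f ⊗ (g ⊗ h)
  ⊗-assoc f g h zero = eq (f 0) (g 0) (h 0)
    where eq : ∀ a b c → (a ℤ.* b ℤ.+ 0ℤ) ℤ.* c ℤ.+ 0ℤ ≡ a ℤ.* (b ℤ.* c ℤ.+ 0ℤ) ℤ.+ 0ℤ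
          eq = solve-∀
  ⊗-assoc f g h (suc m) = begin
    (f 0 ℤ.* g 0 ℤ.+ 0ℤ) ℤ.* h (suc m) ℤ.+ (tail (f ⊗ g) ⊗ h) m
      ≡⟨ cong (λ s → (f 0 ℤ.* g 0 ℤ.+ 0ℤ) ℤ.* h (suc m) ℤ.+ s) (⊗-distribʳ (λ i → f 0 ℤ.* tail g i) (tail f ⊗ g) h m) ⟩
    (f 0 ℤ.* g 0 ℤ.+ 0ℤ) ℤ.* h (suc m) ℤ.+ (((λ i → f 0 ℤ.* tail g i) ⊗ h) m ℤ.+ ((tail f ⊗ g) ⊗ h) m)
      ≡⟨ cong (λ s → (f 0 ℤ.* g 0 ℤ.+ 0ℤ) ℤ.* h (suc m) ℤ.+ s)
           (cong₂ ℤ._+_ (⊗-scaleˡ (f 0) (tail g) h m) (⊗-assoc (tail f) g h m)) ⟩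
    (f 0 ℤ.* g 0 ℤ.+ 0ℤ) ℤ.* h (suc m) ℤ.+ (f 0 ℤ.* (tail g ⊗ h) m ℤ.+ (tail f ⊗ (g ⊗ h)) m)
      ≡⟨ eq (f 0) (g 0) (h (suc m)) ((tail g ⊗ h) m) _ ⟩
    f 0 ℤ.* (g 0 ℤ.* h (suc m) ℤ.+ (tail g ⊗ h) m) ℤ.+ (tail f ⊗ (g ⊗ h)) m ∎
    where
    open ≡-Reasoning
    eq : ∀ a b c d e → (a ℤ.* b ℤ.+ 0ℤ) ℤ.* c ℤ.+ (a ℤ.* d ℤ.+ e) ≡ a ℤ.* (b ℤ.* c ℤ.+ d) ℤ.+ e
    eq = solve-∀

  con⊗ : ∀ {f} → (∀ m → f (suc m) ≡ 0ℤ) → ∀ g m → (f ⊗ g) m ≡ f 0 ℤ.* g m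
  con⊗ f>0 g zero    = ℤ.+-identityʳ _
  con⊗ {f} f>0 g (suc m) =
    trans (cong (λ s → f 0 ℤ.* g (suc m) ℤ.+ s)
            (Σ<-zero (suc m) λ i _ → trans (cong (ℤ._* g (m ∸ i)) (f>0 i)) (ℤ.*-zeroˡ (g (m ∸ i)))))
          (ℤ.+-identityʳ _)

  -- A wrapper without η, so that the conversion checker never unfolds a Cauchy product.
  record Series : Set where
    no-eta-equality
    constructor series
    field at : PowerSeries
  open Series public

  infixl 6 _+_ _-_
  infixl 7 _*_
  infixr 8 _^_
  infix  9 -_

  con : ℤ → Series
  con c .at zero    = c
  con c .at (suc _) = 0ℤ

  -_ : Series → Series
  (- f) .at = ⊝ at f

  _+_ _*_ _-_ : Series → Series → Series
  (f + g) .at = at f ⊕ at g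
  (f * g) .at = at f ⊗ at g
  f - g = f + (- g)

  _^_ : Series → ℕ → Series
  f ^ zero  = con 1ℤ
  f ^ suc n = f * f ^ n

  private variable
    f f′ g g′ : Series

  con-* : ∀ c f m → at (con c * f) m ≡ c ℤ.* at f m
  con-* c f = con⊗ {f = at (con c)} (λ _ → refl) (at f)

  0ˢ 1ˢ : Series
  0ˢ = con 0ℤ
  1ˢ = con 1ℤ

  infix 4 _≐_
  record _≐_ (f g : Series) : Set where
    constructor pointwise
    field coeff= : ∀ m → at f m ≡ at g m
  open _≐_ public

  exact-ring : CommutativeRing 0ℓ 0ℓ
  exact-ring = record
    { Carrier = Series
    ; _≈_ = _≐_
    ; _+_ = _+_ ; _*_ = _*_ ; -_ = -_ ; 0# = 0ˢ ; 1# = 1ˢ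
    ; isCommutativeRing = record
      { isRing = record
        { +-isAbelianGroup = record
          { isGroup = record
            { isMonoid = record
              { isSemigroup = record
                { isMagma = record
                  { isEquivalence = record
                    { refl  = pointwise λ _ → refl
                    ; sym   = λ p → pointwise λ m → sym (coeff= p m)
                    ; trans = λ p r → pointwise λ m → trans (coeff= p m) (coeff= r m) }
                  ; ∙-cong = λ p r → pointwise λ m → cong₂ ℤ._+_ (coeff= p m) (coeff= r m) }
                ; assoc = λ f g h → pointwise λ m → ℤ.+-assoc (at f m) (at g m) (at h m) }
              ; identity = (λ f → pointwise λ { zero → ℤ.+-identityˡ _ ; (suc m) → ℤ.+-identityˡ _ })
                         , (λ f → pointwise λ { zero → ℤ.+-identityʳ _ ; (suc m) → ℤ.+-identityʳ _ }) }
            ; inverse = (λ f → pointwise λ { zero → ℤ.+-inverseˡ (at f 0) ; (suc m) → ℤ.+-inverseˡ (at f (suc m)) })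
                      , (λ f → pointwise λ { zero → ℤ.+-inverseʳ (at f 0) ; (suc m) → ℤ.+-inverseʳ (at f (suc m)) })
            ; ⁻¹-cong = λ p → pointwise λ m → cong ℤ.-_ (coeff= p m) }
          ; comm = λ f g → pointwise λ m → ℤ.+-comm (at f m) (at g m) }
        ; *-cong = λ {f} {f′} {g} {g′} p r →
            pointwise λ m → trans (⊗-congʳ (at f) (coeff= r) m) (⊗-congˡ (at g′) (coeff= p) m)
        ; *-assoc = λ f g h → pointwise (⊗-assoc (at f) (at g) (at h))
        ; *-identity = (λ f → pointwise (one* f))
                     , (λ f → pointwise λ m → trans (⊗-comm (at f) (at 1ˢ) m) (one* f m))
        ; distrib = (λ f g h → pointwise λ m → trans (⊗-comm (at f) (at g ⊕ at h) m)
                       (trans (⊗-distribʳ (at g) (at h) (at f) m)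
                         (cong₂ ℤ._+_ (⊗-comm (at g) (at f) m) (⊗-comm (at h) (at f) m))))
                  , (λ f g h → pointwise (⊗-distribʳ (at g) (at h) (at f))) }
      ; *-comm = λ f g → pointwise (⊗-comm (at f) (at g)) } }
    where
    one* : ∀ f m → at (1ˢ * f) m ≡ at f m
    one* f m = trans (con-* 1ℤ f m) (ℤ.*-identityˡ (at f m))

  -- With integer coefficients the ring solver computes with numerals such as 4 and 512 instead of
  -- treating them as atoms.
  con-homomorphism : ℤ.+-*-rawRing -Raw-AlmostCommutative⟶ fromCommutativeRing exact-ring
  con-homomorphism = record
    { ⟦_⟧    = con
    ; +-homo = λ a b → pointwise λ { zero → refl ; (suc m) → refl }
    ; *-homo = λ a b → pointwise λ { zero → sym (ℤ.+-identityʳ (a ℤ.* b))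
                                   ; (suc m) → sym (trans (con-* a (con b) (suc m)) (ℤ.*-zeroʳ a)) }
    ; -‿homo = λ a → pointwise λ { zero → refl ; (suc m) → refl }
    ; 0-homo = pointwise λ _ → refl
    ; 1-homo = pointwise λ _ → refl }

  con-≟ : (a b : ℤ) → Maybe (con a ≐ con b)
  con-≟ a b with a ℤ.≟ b
  ... | yes refl = just (pointwise λ _ → refl)
  ... | no _     = nothing

  open Algebra.Solver.Ring ℤ.+-*-rawRing (fromCommutativeRing exact-ring) con-homomorphism con-≟
    public using (Polynomial; solve; _:=_; _:+_; _:*_; _:-_; :-_; _:^_) renaming (con to :con)

  :0 :1 : ∀ {n} → Polynomial n
  :0 = :con 0ℤ
  :1 = :con 1ℤ

  -- Equality in the quotient of ℤ[[q]] by the ideal (k , q^N); k = 0 gives equality up to q^N.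
  infix 4 _≈[_,_]_
  record _≈[_,_]_ (f : Series) (k : ℤ) (N : ℕ) (g : Series) : Set where
    constructor mk
    field coeff : ∀ m → m < N → at f m ≡[ k ] at g m
  open _≈[_,_]_ public

  ≐⇒≈ : f ≐ g → f ≈[ k , N ] g
  ≐⇒≈ eq = mk λ m _ → ≡⇒≡[] (coeff= eq m)

  ≈⇒≡ : f ≈[ 0ℤ , N ] g → ∀ m → m < N → at f m ≡ at g m
  ≈⇒≡ {f} {N} {g} p m m<N = ℤ.i-j≡0⇒i≡j (at f m) (at g m) (0∣⇒≡0 (divisible (coeff p m m<N)))

  ≈⇒≐ : (∀ N → f ≈[ 0ℤ , N ] g) → f ≐ g
  ≈⇒≐ p = pointwise λ m → ≈⇒≡ (p (suc m)) m ℕ.≤-refl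

  ≈-weaken : M ≤ N → f ≈[ k , N ] g → f ≈[ k , M ] g
  ≈-weaken M≤N p = mk λ m m<M → coeff p m (ℕ.<-≤-trans m<M M≤N)

  ≈-reduce : f ≈[ 0ℤ , N ] g → f ≈[ k , N ] g
  ≈-reduce p = mk λ m m<N → ≡⇒≡[] (≈⇒≡ p m m<N)

  private module E = CommutativeRing exact-ring

  series-ring : (k : ℤ) (N : ℕ) → CommutativeRing 0ℓ 0ℓ
  series-ring k N = record
    { Carrier = Series
    ; _≈_ = λ f g → f ≈[ k , N ] g
    ; _+_ = _+_ ; _*_ = _*_ ; -_ = -_ ; 0# = 0ˢ ; 1# = 1ˢ
    ; isCommutativeRing = record
      { isRing = record
        { +-isAbelianGroup = record
          { isGroup = record
            { isMonoid = record
              { isSemigroup = record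
                { isMagma = record
                  { isEquivalence = record
                    { refl  = mk λ m _ → ≡⇒≡[] refl
                    ; sym   = λ p → mk λ m m<N → []-sym (coeff p m m<N)
                    ; trans = λ p r → mk λ m m<N → []-trans (coeff p m m<N) (coeff r m m<N) }
                  ; ∙-cong = λ p r → mk λ m m<N → []-+ (coeff p m m<N) (coeff r m m<N) }
                ; assoc = λ f g h → ≐⇒≈ (E.+-assoc f g h) }
              ; identity = (λ f → ≐⇒≈ (E.+-identityˡ f)) , (λ f → ≐⇒≈ (E.+-identityʳ f)) }
            ; inverse = (λ f → ≐⇒≈ (E.-‿inverseˡ f)) , (λ f → ≐⇒≈ (E.-‿inverseʳ f))
            ; ⁻¹-cong = λ p → mk λ m m<N → []-neg (coeff p m m<N) }
          ; comm = λ f g → ≐⇒≈ (E.+-comm f g) }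
        -- Coefficient `m` of a product involves only coefficients of index at most `m`, so
        -- truncation respects multiplication.
        ; *-cong = λ p r → mk λ m m<N → Σ<-≡[] (suc m) λ { i (s≤s i≤m) →
            []-* (coeff p i (ℕ.≤-<-trans i≤m m<N)) (coeff r (m ∸ i) (ℕ.≤-<-trans (ℕ.m∸n≤m m i) m<N)) }
        ; *-assoc = λ f g h → ≐⇒≈ (E.*-assoc f g h)
        ; *-identity = (λ f → ≐⇒≈ (E.*-identityˡ f)) , (λ f → ≐⇒≈ (E.*-identityʳ f))
        ; distrib = (λ f g h → ≐⇒≈ (E.distribˡ f g h)) , (λ f g h → ≐⇒≈ (E.distribʳ f g h)) }
      ; *-comm = λ f g → ≐⇒≈ (E.*-comm f g) } }

  module _ {k : ℤ} {N : ℕ} where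
    open CommutativeRing (series-ring k N) public
      using (+-cong; *-cong; -‿cong; +-congˡ; +-congʳ; *-congˡ; *-congʳ)
      renaming (refl to ≈-refl; sym to ≈-sym; trans to ≈-trans)

  open CommutativeRing exact-ring public
    using () renaming (refl to ≐-refl; sym to ≐-sym; trans to ≐-trans;
      +-cong to +-cong-≐; *-cong to *-cong-≐; -‿cong to -‿cong-≐; *-assoc to *-assoc-≐;
      *-comm to *-comm-≐; *-identityˡ to *-identityˡ-≐; *-identityʳ to *-identityʳ-≐;
      +-identityˡ to +-identityˡ-≐; +-identityʳ to +-identityʳ-≐; zeroˡ to zeroˡ-≐; zeroʳ to zeroʳ-≐)

  module ≈-Reasoning {k : ℤ} {N : ℕ} where
    open import Relation.Binary.Reasoning.Setoid (CommutativeRing.setoid (series-ring k N)) public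

  *-congˡ-≐ : f ≐ g → f′ * f ≐ f′ * g
  *-congˡ-≐ = *-cong-≐ ≐-refl

  +-congˡ-≐ : f ≐ g → f′ + f ≐ f′ + g
  +-congˡ-≐ = +-cong-≐ ≐-refl

  module ≐-Reasoning where
    open import Relation.Binary.Reasoning.Setoid (CommutativeRing.setoid exact-ring) public

  infixl 6 _-cong_
  _-cong_ : f ≈[ k , N ] f′ → g ≈[ k , N ] g′ → f - g ≈[ k , N ] f′ - g′
  p -cong r = +-cong p (-‿cong r)

  ^-cong : ∀ n → f ≈[ k , N ] g → f ^ n ≈[ k , N ] g ^ n
  ^-cong zero    p = ≈-refl
  ^-cong (suc n) p = *-cong p (^-cong n p)

  ^-+ : ∀ f m n → f ^ (m ℕ.+ n) ≐ f ^ m * f ^ n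
  ^-+ f zero    n = solve 1 (λ a → a := :1 :* a) ≐-refl (f ^ n)
  ^-+ f (suc m) n = ≐-trans (E.*-congˡ {f} (^-+ f m n)) (≐-sym (E.*-assoc f (f ^ m) (f ^ n)))

  ^-distrib-* : ∀ f g n → (f * g) ^ n ≐ f ^ n * g ^ n
  ^-distrib-* f g zero    = solve 0 (:1 := :1 :* :1) ≐-refl
  ^-distrib-* f g (suc n) = ≐-trans (E.*-congˡ {f * g} (^-distrib-* f g n))
    (solve 4 (λ a b c d → a :* b :* (c :* d) := a :* c :* (b :* d)) ≐-refl f g (f ^ n) (g ^ n))

  ^-* : ∀ f m n → f ^ (m ℕ.* n) ≐ (f ^ n) ^ m
  ^-* f zero    n = ≐-refl
  ^-* f (suc m) n = ≐-trans (^-+ f n (m ℕ.* n)) (E.*-congˡ {f ^ n} (^-* f m n))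

  ^-cong-≐ : ∀ n → f ≐ g → f ^ n ≐ g ^ n
  ^-cong-≐ zero    p = ≐-refl
  ^-cong-≐ (suc n) p = *-cong-≐ p (^-cong-≐ n p)

  con*con : ∀ a b → con (a ℤ.* b) ≐ con a * con b
  con*con = _-Raw-AlmostCommutative⟶_.*-homo con-homomorphism

-- Units, orders of vanishing, and substitutions q ↦ q u

module Substitutions where
  open SeriesRing public
  open import Data.Nat.DivMod using ()

  private variable
    f g h u : Series
    k l : ℤ
    M N : ℕ

  q : Series
  q .at = Defs.q

  shift : Series → Series
  shift f .at m = at f (suc m)

  q*-zero : ∀ f → at (q * f) 0 ≡ 0ℤ
  q*-zero f = refl

  q*-suc : ∀ f m → at (q * f) (suc m) ≡ at f m
  q*-suc f m = trans (cong₂ ℤ._+_ (ℤ.*-zeroˡ (at f (suc m))) (con⊗ {tail Defs.q} (λ _ → refl) (at f) m))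
    (trans (ℤ.+-identityˡ _) (ℤ.*-identityˡ (at f m)))

  head+q*shift : ∀ f → f ≐ con (at f 0) + q * shift f
  head+q*shift f = pointwise λ
    { zero    → sym (trans (cong (λ s → at f 0 ℤ.+ s) (q*-zero (shift f))) (ℤ.+-identityʳ _))
    ; (suc m) → sym (trans (cong (λ s → 0ℤ ℤ.+ s) (q*-suc (shift f) m)) (ℤ.+-identityˡ _)) }

  -- The gain of one coefficient drives the inductions on `N` for substitutions: knowledge of the
  -- shifted series modulo q^N suffices modulo q^(N+1).
  q*-≈ : f ≈[ k , N ] g → q * f ≈[ k , suc N ] q * g
  q*-≈ {f} {k} {N} {g} p = mk λ
    { zero    _         → ≡⇒≡[] refl
    ; (suc m) (s≤s m<N) → subst₂ (_≡[ k ]_) (sym (q*-suc f m)) (sym (q*-suc g m)) (coeff p m m<N) }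

  q^*-+ : ∀ j f m → at (q ^ j * f) (m ℕ.+ j) ≡ at f m
  q^*-+ zero f m = trans (con-* 1ℤ f (m ℕ.+ 0)) (trans (ℤ.*-identityˡ _) (cong (at f) (ℕ.+-identityʳ m)))
  q^*-+ (suc j) f m = begin
    at (q ^ suc j * f) (m ℕ.+ suc j)     ≡⟨ coeff= (solve 3 (λ a b c → a :* b :* c := a :* (b :* c)) ≐-refl q (q ^ j) f) (m ℕ.+ suc j) ⟩
    at (q * (q ^ j * f)) (m ℕ.+ suc j)   ≡⟨ cong (at (q * (q ^ j * f))) (ℕ.+-suc m j) ⟩
    at (q * (q ^ j * f)) (suc (m ℕ.+ j)) ≡⟨ q*-suc (q ^ j * f) (m ℕ.+ j) ⟩
    at (q ^ j * f) (m ℕ.+ j)             ≡⟨ q^*-+ j f m ⟩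
    at f m                               ∎
    where open ≡-Reasoning

  inv : Series → Series
  inv f .at = at f ⁻¹

  record Unit (f : Series) : Set where
    constructor unit
    field constant : at f 0 ≡ 1ℤ
  open Unit public

  *-inverse : Unit f → f * inv f ≐ 1ˢ
  *-inverse {f} (unit f0≡1) = pointwise λ
    { zero → ⊗-inverseʳ (at f) f0≡1 0 ; (suc m) → ⊗-inverseʳ (at f) f0≡1 (suc m) }

  -- A constant term 1 makes `f` invertible, so cancellation survives in a quotient with zero
  -- divisors. This is how truncated products are cleared from both sides.
  *-cancelˡ : Unit f → f * g ≈[ k , N ] f * h → g ≈[ k , N ] h
  *-cancelˡ {f} {g} {k} {N} {h} f0≡1 p = begin
    g               ≈⟨ lem g ⟨
    inv f * (f * g) ≈⟨ *-congˡ p ⟩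
    inv f * (f * h) ≈⟨ lem h ⟩
    h               ∎
    where
    open ≈-Reasoning
    lem : ∀ e → inv f * (f * e) ≈[ k , N ] e
    lem e = begin
      inv f * (f * e) ≈⟨ ≐⇒≈ (solve 3 (λ a b c → a :* (b :* c) := (b :* a) :* c) ≐-refl (inv f) f e) ⟩
      f * inv f * e   ≈⟨ *-congʳ (≐⇒≈ (*-inverse f0≡1)) ⟩
      1ˢ * e      ≈⟨ ≐⇒≈ (*-identityˡ-≐ e) ⟩
      e               ∎

  inv-cong : Unit f → Unit g → f ≈[ k , N ] g → inv f ≈[ k , N ] inv g
  inv-cong {f} {g} f0≡1 g0≡1 p = *-cancelˡ f0≡1 (begin
    f * inv f ≈⟨ ≐⇒≈ (*-inverse f0≡1) ⟩
    1ˢ    ≈⟨ ≐⇒≈ (*-inverse g0≡1) ⟨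
    g * inv g ≈⟨ *-congʳ p ⟨
    f * inv g ∎)
    where open ≈-Reasoning

  unit-con : Unit 1ˢ
  unit-con = unit refl

  unit-* : Unit f → Unit g → Unit (f * g)
  unit-* (unit p) (unit r) = unit (cong₂ (λ x y → x ℤ.* y ℤ.+ 0ℤ) p r)

  unit-inv : Unit (inv f)
  unit-inv = unit refl

  unit-^ : ∀ n → Unit f → Unit (f ^ n)
  unit-^ zero    p = unit-con
  unit-^ (suc n) p = unit-* p (unit-^ n p)

  unit-1+ : at f 0 ≡ 0ℤ → Unit (1ˢ + f)
  unit-1+ p = unit (cong (λ z → 1ℤ ℤ.+ z) p)

  unit-1- : at f 0 ≡ 0ℤ → Unit (1ˢ - f)
  unit-1- p = unit (cong (λ z → 1ℤ ℤ.+ ℤ.- z) p)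

  *-head₀ : ∀ f g → at f 0 ≡ 0ℤ → at (f * g) 0 ≡ 0ℤ
  *-head₀ f g p rewrite p = trans (ℤ.+-identityʳ _) (ℤ.*-zeroˡ (at g 0))

  ∑ ∏ : ℕ → (ℕ → Series) → Series
  ∑ zero    F = 0ˢ
  ∑ (suc n) F = ∑ n F + F n
  ∏ zero    F = 1ˢ
  ∏ (suc n) F = ∏ n F * F n

  ∑-cong : ∀ n {F G : ℕ → Series} → (∀ i → F i ≈[ k , N ] G i) → ∑ n F ≈[ k , N ] ∑ n G
  ∑-cong zero    p = ≈-refl
  ∑-cong (suc n) p = +-cong (∑-cong n p) (p n)

  ∏-cong : ∀ n {F G : ℕ → Series} → (∀ i → F i ≈[ k , N ] G i) → ∏ n F ≈[ k , N ] ∏ n G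
  ∏-cong zero    p = ≈-refl
  ∏-cong (suc n) p = *-cong (∏-cong n p) (p n)

  unit-∏ : ∀ n {F : ℕ → Series} → (∀ i → Unit (F i)) → Unit (∏ n F)
  unit-∏ zero    p = unit-con
  unit-∏ (suc n) p = unit-* (unit-∏ n p) (p n)

  ∏-distrib-* : ∀ n (F G : ℕ → Series) → ∏ n (λ i → F i * G i) ≈[ k , N ] ∏ n F * ∏ n G
  ∏-distrib-* zero    F G = ≐⇒≈ (solve 0 (:1 := :1 :* :1) ≐-refl)
  ∏-distrib-* (suc n) F G = ≈-trans (*-congʳ (∏-distrib-* n F G))
    (≐⇒≈ (solve 4 (λ a b c d → a :* b :* (c :* d) := a :* c :* (b :* d)) ≐-refl (∏ n F) (∏ n G) (F n) (G n)))

  ∑-distrib-+ : ∀ n (F G : ℕ → Series) → ∑ n (λ i → F i + G i) ≈[ k , N ] ∑ n F + ∑ n G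
  ∑-distrib-+ zero    F G = ≐⇒≈ (solve 0 (:0 := :0 :+ :0) ≐-refl)
  ∑-distrib-+ (suc n) F G = ≈-trans (+-congʳ (∑-distrib-+ n F G))
    (≐⇒≈ (solve 4 (λ a b c d → a :+ b :+ (c :+ d) := a :+ c :+ (b :+ d)) ≐-refl (∑ n F) (∑ n G) (F n) (G n)))

  ∑-*ˡ : ∀ n g (F : ℕ → Series) → g * ∑ n F ≈[ k , N ] ∑ n (λ i → g * F i)
  ∑-*ˡ zero    g F = ≐⇒≈ (zeroʳ-≐ g)
  ∑-*ˡ (suc n) g F = ≈-trans
    (≐⇒≈ (solve 3 (λ a b c → a :* (b :+ c) := a :* b :+ a :* c) ≐-refl g (∑ n F) (F n)))
    (+-congʳ (∑-*ˡ n g F))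

  con0-at : ∀ m → at 0ˢ m ≡ 0ℤ
  con0-at zero    = refl
  con0-at (suc _) = refl

  order : (∀ m → m < N → at f m ≡ 0ℤ) → f ≈[ k , N ] 0ˢ
  order p = mk λ m m<N → ≡⇒≡[] (trans (p m m<N) (sym (con0-at m)))

  order⁻¹ : f ≈[ 0ℤ , N ] 0ˢ → ∀ m → m < N → at f m ≡ 0ℤ
  order⁻¹ p m m<N = trans (≈⇒≡ p m m<N) (con0-at m)

  -- If i + j < M + N then i < M or j < N, so every summand of the Cauchy product has a vanishing
  -- factor.
  order-* : ∀ M N → f ≈[ 0ℤ , M ] 0ˢ → g ≈[ 0ℤ , N ] 0ˢ → f * g ≈[ k , M ℕ.+ N ] 0ˢ
  order-* {f} {g} M N p r = order λ m m<M+N → Σ<-zero (suc m) λ { i (s≤s i≤m) → term m m<M+N i i≤m }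
    where
    term : ∀ m → m < M ℕ.+ N → ∀ i → i ≤ m → at f i ℤ.* at g (m ∸ i) ≡ 0ℤ
    term m m<M+N i i≤m with i ℕ.<? M
    ... | yes i<M = trans (cong (ℤ._* at g (m ∸ i)) (order⁻¹ p i i<M)) (ℤ.*-zeroˡ (at g (m ∸ i)))
    ... | no i≮M with (m ∸ i) ℕ.<? N
    ...   | yes j<N = trans (cong (at f i ℤ.*_) (order⁻¹ r (m ∸ i) j<N)) (ℤ.*-zeroʳ (at f i))
    ...   | no j≮N = contradiction m<M+N (ℕ.≤⇒≯ (ℕ.≤-trans (ℕ.+-mono-≤ (ℕ.≮⇒≥ i≮M) (ℕ.≮⇒≥ j≮N))
                       (ℕ.≤-reflexive (ℕ.m+[n∸m]≡n i≤m))))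

  order-weaken : ∀ g → f ≈[ k , N ] 0ˢ → f * g ≈[ k , N ] 0ˢ
  order-weaken g p = ≈-trans (*-congʳ p) (≐⇒≈ (zeroˡ-≐ g))

  order-q^ : ∀ n → q ^ n ≈[ k , n ] 0ˢ
  order-q^ zero    = mk λ _ ()
  order-q^ (suc n) = ≈-trans (q*-≈ (order-q^ n)) (≐⇒≈ (zeroʳ-≐ q))

  -- Below q^N the coefficients of `f` are multiples of `k` and those of `g` multiples of `l`: the
  -- moduli multiply while the truncation stays. The passage from 3 to 9 to 27 rests on this.
  ideal-* : f ≈[ k , N ] 0ˢ → g ≈[ l , N ] 0ˢ → f * g ≈[ k ℤ.* l , N ] 0ˢ
  ideal-* {f} {k} {N} {g} {l} p r = mk λ m m<N →
    subst (λ z → at (f * g) m ≡[ k ℤ.* l ] z) (sym (con0-at m)) (∣⇒≡[] (Σ<-∣ (suc m) λ { i (s≤s i≤m) →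
      ∣-*-∣ (zero∣ p i (ℕ.≤-<-trans i≤m m<N)) (zero∣ r (m ∸ i) (ℕ.≤-<-trans (ℕ.m∸n≤m m i) m<N)) }))
    where
    zero∣ : ∀ {k f} → f ≈[ k , N ] 0ˢ → ∀ i → i < N → k ∣ at f i
    zero∣ {k} {f} p i i<N = ≡[]⇒∣ (subst (λ z → at f i ≡[ k ] z) (con0-at i) (coeff p i i<N))
    ∣-*-∣ : ∀ {a b} → k ∣ a → l ∣ b → k ℤ.* l ∣ a ℤ.* b
    ∣-*-∣ (divides x refl) (divides y refl) = divides (x ℤ.* y) (eq x k y l)
      where eq : ∀ x k y l → x ℤ.* k ℤ.* (y ℤ.* l) ≡ x ℤ.* y ℤ.* (k ℤ.* l)
            eq = solve-∀

  con-ideal : k ∣ l → con l ≈[ k , N ] 0ˢ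
  con-ideal d = mk λ { zero _ → ∣⇒≡[] d ; (suc _) _ → ≡⇒≡[] refl }

  -- Continuous ring endomorphisms of ℤ[[q]], that is q ↦ q u.
  record Substitution (E : Series → Series) (u : Series) : Set where
    field
      cong-≈  : f ≈[ k , N ] g → E f ≈[ k , N ] E g
      +-homo  : ∀ f g → E (f + g) ≐ E f + E g
      con-homo : ∀ c → E (con c) ≐ con c
      q*-homo : ∀ f → E (q * f) ≐ q * u * E f

    cong-≐ : f ≐ g → E f ≐ E g
    cong-≐ p = ≈⇒≐ λ N → cong-≈ (≐⇒≈ p)

    expand : ∀ f → E f ≈[ k , N ] con (at f 0) + q * u * E (shift f)
    expand f = begin
      E f                                ≈⟨ cong-≈ (≐⇒≈ (head+q*shift f)) ⟩
      E (con (at f 0) + q * shift f)     ≈⟨ ≐⇒≈ (+-homo _ _) ⟩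
      E (con (at f 0)) + E (q * shift f) ≈⟨ +-cong (≐⇒≈ (con-homo _)) (≐⇒≈ (q*-homo _)) ⟩
      con (at f 0) + q * u * E (shift f) ∎
      where open ≈-Reasoning

    private
      con*-homo : ∀ N c f → E (con c * f) ≈[ 0ℤ , N ] con c * E f
      con*-homo zero    c f = mk λ _ ()
      con*-homo (suc N) c f = begin
        E (con c * f)
          ≈⟨ cong-≈ (≈-trans (*-congˡ (≐⇒≈ (head+q*shift f)))
               (≐⇒≈ (≐-trans (solve 4 (λ c a q s → c :* (a :+ q :* s) := c :* a :+ q :* (c :* s)) ≐-refl (con c) (con (at f 0)) q (shift f))
                 (+-cong-≐ (≐-sym (con*con c (at f 0))) ≐-refl)))) ⟩
        E (con (c ℤ.* at f 0) + q * (con c * shift f))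
          ≈⟨ ≐⇒≈ (+-homo _ _) ⟩
        E (con (c ℤ.* at f 0)) + E (q * (con c * shift f))
          ≈⟨ +-cong (≐⇒≈ (≐-trans (con-homo _) (con*con c (at f 0)))) (≐⇒≈ (≐-trans (q*-homo _) (*-assoc-≐ q u _))) ⟩
        con c * con (at f 0) + q * (u * E (con c * shift f))
          ≈⟨ +-congˡ (q*-≈ (*-congˡ (con*-homo N c (shift f)))) ⟩
        con c * con (at f 0) + q * (u * (con c * E (shift f)))
          ≈⟨ ≐⇒≈ (solve 5 (λ c a q u s → c :* a :+ q :* (u :* (c :* s)) := c :* (a :+ q :* u :* s)) ≐-refl (con c) (con (at f 0)) q u _) ⟩
        con c * (con (at f 0) + q * u * E (shift f))
          ≈⟨ *-congˡ (expand f) ⟨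
        con c * E f ∎
        where open ≈-Reasoning

    -- Multiplicativity is derived from the law for q alone. Writing f = f(0) + q · `shift f` splits
    -- the product into a scalar multiple and a multiple of q, and for the latter one coefficient
    -- less has to be known.
    *-homo-≈ : ∀ N f g → E (f * g) ≈[ 0ℤ , N ] E f * E g
    *-homo-≈ zero    f g = mk λ _ ()
    *-homo-≈ (suc N) f g = begin
      E (f * g)
        ≈⟨ cong-≈ (≈-trans (*-congʳ (≐⇒≈ (head+q*shift f)))
             (≐⇒≈ (solve 4 (λ a q s g → (a :+ q :* s) :* g := a :* g :+ q :* (s :* g)) ≐-refl (con (at f 0)) q (shift f) g))) ⟩
      E (con (at f 0) * g + q * (shift f * g))
        ≈⟨ ≐⇒≈ (+-homo _ _) ⟩
      E (con (at f 0) * g) + E (q * (shift f * g))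
        ≈⟨ +-cong (con*-homo (suc N) (at f 0) g) (≐⇒≈ (≐-trans (q*-homo _) (*-assoc-≐ q u _))) ⟩
      con (at f 0) * E g + q * (u * E (shift f * g))
        ≈⟨ +-congˡ (q*-≈ (*-congˡ (*-homo-≈ N (shift f) g))) ⟩
      con (at f 0) * E g + q * (u * (E (shift f) * E g))
        ≈⟨ ≐⇒≈ (solve 5 (λ a q u s g → a :* g :+ q :* (u :* (s :* g)) := (a :+ q :* u :* s) :* g) ≐-refl (con (at f 0)) q u _ _) ⟩
      (con (at f 0) + q * u * E (shift f)) * E g
        ≈⟨ *-congʳ (expand f) ⟨
      E f * E g ∎
      where open ≈-Reasoning

    *-homo : ∀ f g → E (f * g) ≐ E f * E g
    *-homo f g = ≈⇒≐ λ N → *-homo-≈ N f g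

    q-homo : E q ≐ q * u
    q-homo = ≐-trans (cong-≐ (solve 1 (λ a → a := a :* :1) ≐-refl q))
      (≐-trans (q*-homo 1ˢ) (≐-trans (*-congˡ-≐ (con-homo 1ℤ)) (*-identityʳ-≐ (q * u))))

    neg-homo : ∀ f → E (- f) ≐ - E f
    neg-homo f = ≐-trans (cong-≐ (solve 1 (λ a → :- a := :con (ℤ.- 1ℤ) :* a) ≐-refl f))
      (≐-trans (*-homo _ _) (≐-trans (*-cong-≐ (con-homo _) ≐-refl)
        (solve 1 (λ a → :con (ℤ.- 1ℤ) :* a := :- a) ≐-refl (E f))))

    minus-homo : ∀ f g → E (f - g) ≐ E f - E g
    minus-homo f g = ≐-trans (+-homo _ _) (+-congˡ-≐ (neg-homo g))

    ^-homo : ∀ n f → E (f ^ n) ≐ E f ^ n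
    ^-homo zero    f = con-homo 1ℤ
    ^-homo (suc n) f = ≐-trans (*-homo f (f ^ n)) (*-congˡ-≐ (^-homo n f))

    q^-homo : ∀ n → E (q ^ n) ≐ (q * u) ^ n
    q^-homo n = ≐-trans (^-homo n q) (^-cong-≐ n q-homo)

    ∑-homo : ∀ n F → E (∑ n F) ≐ ∑ n (λ i → E (F i))
    ∑-homo zero    F = con-homo 0ℤ
    ∑-homo (suc n) F = ≐-trans (+-homo _ _) (+-cong-≐ (∑-homo n F) ≐-refl)

    ∏-homo : ∀ n F → E (∏ n F) ≐ ∏ n (λ i → E (F i))
    ∏-homo zero    F = con-homo 1ℤ
    ∏-homo (suc n) F = ≐-trans (*-homo _ _) (*-cong-≐ (∏-homo n F) ≐-refl)

-- The substitutions q ↦ q^j and q ↦ -q, and the derivation q d/dq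

module Dilation where
  open Substitutions public
  open import Data.Nat.DivMod using (_%_; _/_; m<n⇒m%n≡m; [m+n]%n≡m%n; +-distrib-/-∣ʳ; n/n≡1; m*n%n≡0; m*n/n≡m; m/n≤m; m≡m%n+[m/n]*n)

  private variable
    f f′ g u u′ : Series
    E E′ : Series → Series
    k : ℤ
    N : ℕ

  module _ (S : Substitution E u) (S′ : Substitution E′ u′) where
    private
      module S = Substitution S
      module S′ = Substitution S′

    ∘-substitution : Substitution (λ f → E (E′ f)) (u * E u′)
    ∘-substitution = record
      { cong-≈ = λ p → S.cong-≈ (S′.cong-≈ p)
      ; +-homo = λ f g → ≐-trans (S.cong-≐ (S′.+-homo f g)) (S.+-homo _ _)
      ; con-homo = λ c → ≐-trans (S.cong-≐ (S′.con-homo c)) (S.con-homo c)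
      ; q*-homo = λ f → ≐-trans (S.cong-≐ (S′.q*-homo f)) (≐-trans (S.*-homo (q * u′) (E′ f))
          (*-cong-≐ (≐-trans (S.q*-homo u′) (*-assoc-≐ q u (E u′))) ≐-refl)) }

    -- The image of q determines a continuous endomorphism. Composites of substitutions can thus be
    -- identified by their value at q, without computing quotients and remainders.
    substitution-unique : u ≐ u′ → ∀ f → E f ≐ E′ f
    substitution-unique u≐u′ f = ≈⇒≐ λ N → go N f
      where
      open ≈-Reasoning
      go : ∀ N f → E f ≈[ 0ℤ , N ] E′ f
      go zero    f = mk λ _ ()
      go (suc N) f = begin
        E f                                     ≈⟨ S.expand f ⟩
        con (at f 0) + q * u * E (shift f)      ≈⟨ +-congˡ (≐⇒≈ (*-assoc-≐ q u _)) ⟩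
        con (at f 0) + q * (u * E (shift f))    ≈⟨ +-congˡ (q*-≈ (*-cong (≐⇒≈ u≐u′) (go N (shift f)))) ⟩
        con (at f 0) + q * (u′ * E′ (shift f))  ≈⟨ +-congˡ (≐⇒≈ (*-assoc-≐ q u′ _)) ⟨
        con (at f 0) + q * u′ * E′ (shift f)    ≈⟨ S′.expand f ⟨
        E′ f                                    ∎

  private
    pick : ℕ → ℤ → ℤ
    pick zero    c = c
    pick (suc _) c = 0ℤ

    pick-+ : ∀ r a b → pick r (a ℤ.+ b) ≡ pick r a ℤ.+ pick r b
    pick-+ zero    a b = refl
    pick-+ (suc _) a b = refl

    pick-≡[] : ∀ r {a b} → a ≡[ k ] b → pick r a ≡[ k ] pick r b
    pick-≡[] zero    p = p
    pick-≡[] (suc _) p = ≡⇒≡[] refl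

    pick-0 : ∀ r → pick r 0ℤ ≡ 0ℤ
    pick-0 zero    = refl
    pick-0 (suc _) = refl

  dilate : ∀ j .{{_ : NonZero j}} → Series → Series
  dilate j f .at m = pick (m % j) (at f (m / j))

  dilate-at : ∀ j .{{_ : NonZero j}} f n → at (dilate j f) (n ℕ.* j) ≡ at f n
  dilate-at j f n = cong₂ pick (m*n%n≡0 n j) (cong (at f) (m*n/n≡m n j))

  dilate-off : ∀ j .{{_ : NonZero j}} f m → m % j ≢ 0 → at (dilate j f) m ≡ 0ℤ
  dilate-off j f m m%j≢0 with m % j
  ... | zero  = contradiction refl m%j≢0
  ... | suc _ = refl

  dilate-vanish : ∀ j .{{_ : NonZero j}} f m → at f (m / j) ≡ 0ℤ → at (dilate j f) m ≡ 0ℤ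
  dilate-vanish j f m p = trans (cong (pick (m % j)) p) (pick-0 (m % j))

  q^*-< : ∀ j f m → m < j → at (q ^ j * f) m ≡ 0ℤ
  q^*-< j f = order⁻¹ (order-weaken f (order-q^ j))

  -- Every exponent is below j + 1 or of the form m + (j + 1). Adding j + 1 keeps the remainder and
  -- raises the quotient by one, which is the law for multiplication by q.
  dilate-substitution : ∀ j → Substitution (dilate (suc j)) (q ^ j)
  dilate-substitution j = record
    { cong-≈ = λ p → mk λ m m<N → pick-≡[] (m % suc j) (coeff p _ (ℕ.≤-<-trans (m/n≤m m (suc j)) m<N))
    ; +-homo = λ f g → pointwise λ m → pick-+ (m % suc j) _ _
    ; con-homo = λ c → pointwise (con-at c)
    ; q*-homo = λ f → pointwise (q*-at f) }
    where
    open ≡-Reasoning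
    [m+j]/j : ∀ m → (m ℕ.+ suc j) / suc j ≡ suc (m / suc j)
    [m+j]/j m = trans (+-distrib-/-∣ʳ m ℕ∣.∣-refl) (trans (cong (m / suc j ℕ.+_) (n/n≡1 (suc j))) (ℕ.+-comm _ 1))
    split : (P : ℕ → Set) → (∀ m → m < suc j → P m) → (∀ m → P (m ℕ.+ suc j)) → ∀ m → P m
    split P p r m with m ℕ.<? suc j
    ... | yes m<j = p m m<j
    ... | no m≮j = subst P (ℕ.m∸n+n≡m (ℕ.≮⇒≥ m≮j)) (r (m ∸ suc j))
    con-at : ∀ c m → at (dilate (suc j) (con c)) m ≡ at (con c) m
    con-at c = split _
      (λ { zero    _    → refl
         ; (suc m) m<j → dilate-off (suc j) (con c) (suc m) (λ e → ℕ.1+n≢0 (trans (sym (m<n⇒m%n≡m m<j)) e)) })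
      (λ m → trans (cong (λ e → pick ((m ℕ.+ suc j) % suc j) (at (con c) e)) ([m+j]/j m))
        (trans (pick-0 ((m ℕ.+ suc j) % suc j)) (sym (cong (at (con c)) (ℕ.+-suc m j)))))
    q*-at : ∀ f m → at (dilate (suc j) (q * f)) m ≡ at (q ^ suc j * dilate (suc j) f) m
    q*-at f = split _
      (λ { zero    m<j → refl
         ; (suc m) m<j → trans (dilate-off (suc j) (q * f) (suc m) (λ e → ℕ.1+n≢0 (trans (sym (m<n⇒m%n≡m m<j)) e)))
                               (sym (q^*-< (suc j) (dilate (suc j) f) (suc m) m<j)) })
      (λ m → begin
        pick ((m ℕ.+ suc j) % suc j) (at (q * f) ((m ℕ.+ suc j) / suc j))
          ≡⟨ cong₂ (λ r e → pick r (at (q * f) e)) ([m+n]%n≡m%n m (suc j)) ([m+j]/j m) ⟩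
        pick (m % suc j) (at (q * f) (suc (m / suc j)))
          ≡⟨ cong (pick (m % suc j)) (q*-suc f (m / suc j)) ⟩
        at (dilate (suc j) f) m
          ≡⟨ q^*-+ (suc j) (dilate (suc j) f) m ⟨
        at (q ^ suc j * dilate (suc j) f) (m ℕ.+ suc j) ∎)

  module Dilate (j : ℕ) = Substitution (dilate-substitution j)

  dilate-∘ : ∀ a b f → dilate (suc a) (dilate (suc b) f) ≐ dilate (suc a ℕ.* suc b) f
  dilate-∘ a b = substitution-unique (∘-substitution (dilate-substitution a) (dilate-substitution b))
    (dilate-substitution (b ℕ.+ a ℕ.* suc b)) (begin
      q ^ a * dilate (suc a) (q ^ b) ≈⟨ *-congˡ-≐ {f′ = q ^ a} (Dilate.q^-homo a b) ⟩
      q ^ a * (q ^ suc a) ^ b        ≈⟨ *-congˡ-≐ {f′ = q ^ a} (^-* q b (suc a)) ⟨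
      q ^ a * q ^ (b ℕ.* suc a)      ≈⟨ ^-+ q a (b ℕ.* suc a) ⟨
      q ^ (a ℕ.+ b ℕ.* suc a)        ≡⟨ cong (q ^_) (eq a b) ⟩
      q ^ (b ℕ.+ a ℕ.* suc b)        ∎)
    where
    open ≐-Reasoning
    eq : ∀ a b → a ℕ.+ b ℕ.* suc a ≡ b ℕ.+ a ℕ.* suc b
    eq = ℕ.solve-∀

  dilate-q^ : ∀ j n → dilate (suc j) (q ^ n) ≐ q ^ (n ℕ.* suc j)
  dilate-q^ j n = ≐-trans (Dilate.q^-homo j n) (≐-sym (^-* q n (suc j)))

  dilate-injective : ∀ j .{{_ : NonZero j}} → dilate j f ≐ dilate j g → f ≐ g
  dilate-injective {f} {g} j p = pointwise λ n →
    trans (sym (dilate-at j f n)) (trans (coeff= p (n ℕ.* j)) (dilate-at j g n))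

  unit-dilate : ∀ j → Unit f → Unit (dilate (suc j) f)
  unit-dilate j (unit p) = unit p

  sgn : ℕ → ℤ
  sgn zero    = 1ℤ
  sgn (suc m) = ℤ.- sgn m

  flip : Series → Series
  flip f .at m = sgn m ℤ.* at f m

  flip-substitution : Substitution flip (- 1ˢ)
  flip-substitution = record
    { cong-≈ = λ p → mk λ m m<N → []-* (≡⇒≡[] {a = sgn m} refl) (coeff p m m<N)
    ; +-homo = λ f g → pointwise λ m → ℤ.*-distribˡ-+ (sgn m) _ _
    ; con-homo = λ c → pointwise λ { zero → ℤ.*-identityˡ c ; (suc m) → ℤ.*-zeroʳ (sgn (suc m)) }
    ; q*-homo = λ f → ≐-trans (pointwise λ
        { zero    → refl
        ; (suc m) → begin
            sgn (suc m) ℤ.* at (q * f) (suc m)  ≡⟨ cong (sgn (suc m) ℤ.*_) (q*-suc f m) ⟩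
            (ℤ.- sgn m) ℤ.* at f m                ≡⟨ ℤ.neg-distribˡ-* (sgn m) (at f m) ⟨
            ℤ.- (sgn m ℤ.* at f m)                ≡⟨ cong ℤ.-_ (q*-suc (flip f) m) ⟨
            ℤ.- at (q * flip f) (suc m)           ∎ })
        (solve 2 (λ q f → :- (q :* f) := q :* (:- :1) :* f) ≐-refl q (flip f)) }
    where open ≡-Reasoning

  module Flip = Substitution flip-substitution

  flip-dilate₂ : ∀ f → flip (dilate 2 f) ≐ dilate 2 f
  flip-dilate₂ = substitution-unique (∘-substitution flip-substitution (dilate-substitution 1))
    (dilate-substitution 1) (≐-trans (*-congˡ-≐ (Flip.q^-homo 1))
      (solve 1 (λ q → (:- :1) :* (q :* (:- :1)) :^ 1 := q :^ 1) ≐-refl q))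

  flip-flip : ∀ f → flip (flip f) ≐ f
  flip-flip f = pointwise λ m → trans (sym (ℤ.*-assoc (sgn m) (sgn m) (at f m)))
    (trans (cong (ℤ._* at f m) (sq m)) (ℤ.*-identityˡ (at f m)))
    where
    sq : ∀ m → sgn m ℤ.* sgn m ≡ 1ℤ
    sq zero    = refl
    sq (suc m) = trans (eq (sgn m)) (sq m)
      where eq : ∀ a → (ℤ.- a) ℤ.* (ℤ.- a) ≡ a ℤ.* a
            eq = solve-∀

  -- q d/dq
  D : Series → Series
  D f .at m = + m ℤ.* at f m

  D-cong : f ≈[ k , N ] g → D f ≈[ k , N ] D g
  D-cong p = mk λ m m<N → []-* (≡⇒≡[] {a = + m} refl) (coeff p m m<N)

  D-+ : ∀ f g → D (f + g) ≐ D f + D g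
  D-+ f g = pointwise λ m → ℤ.*-distribˡ-+ (+ m) _ _

  D-neg : ∀ f → D (- f) ≐ - D f
  D-neg f = pointwise λ m → sym (ℤ.neg-distribʳ-* (+ m) (at f m))

  D-con : ∀ c → D (con c) ≐ 0ˢ
  D-con c = pointwise λ { zero → ℤ.*-zeroˡ c ; (suc m) → ℤ.*-zeroʳ (+ suc m) }

  -- In each summand of the Cauchy product the exponent is distributed as m = i + (m - i).
  D-* : ∀ f g → D (f * g) ≐ D f * g + f * D g
  D-* f g = pointwise λ m → begin
    + m ℤ.* Σ< (suc m) (λ i → at f i ℤ.* at g (m ∸ i))
      ≡⟨ Σ<-* (suc m) (+ m) (λ i → at f i ℤ.* at g (m ∸ i)) ⟨
    Σ< (suc m) (λ i → + m ℤ.* (at f i ℤ.* at g (m ∸ i)))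
      ≡⟨ Σ<-cong (suc m) (λ { i (s≤s i≤m) → trans
           (cong (λ e → e ℤ.* (at f i ℤ.* at g (m ∸ i))) (trans (cong +_ (sym (ℕ.m+[n∸m]≡n i≤m))) (ℤ.pos-+ i (m ∸ i))))
           (eq (+ i) (+ (m ∸ i)) (at f i) (at g (m ∸ i))) }) ⟩
    Σ< (suc m) (λ i → + i ℤ.* at f i ℤ.* at g (m ∸ i) ℤ.+ at f i ℤ.* (+ (m ∸ i) ℤ.* at g (m ∸ i)))
      ≡⟨ Σ<-+ (suc m) (λ i → + i ℤ.* at f i ℤ.* at g (m ∸ i)) (λ i → at f i ℤ.* (+ (m ∸ i) ℤ.* at g (m ∸ i))) ⟩
    at (D f * g + f * D g) m ∎
    where
    open ≡-Reasoning
    eq : ∀ i j a b → (i ℤ.+ j) ℤ.* (a ℤ.* b) ≡ i ℤ.* a ℤ.* b ℤ.+ a ℤ.* (j ℤ.* b)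
    eq = solve-∀

  D-q^ : ∀ n → D (q ^ n) ≐ con (+ n) * q ^ n
  D-q^ zero    = ≐-trans (D-con 1ℤ) (solve 0 (:0 := :0 :* :1) ≐-refl)
  D-q^ (suc n) = begin
    D (q * q ^ n)                     ≈⟨ D-* q (q ^ n) ⟩
    D q * q ^ n + q * D (q ^ n)       ≈⟨ +-cong-≐ (*-cong-≐ Dq ≐-refl) (*-congˡ-≐ (D-q^ n)) ⟩
    q * q ^ n + q * (con (+ n) * q ^ n) ≈⟨ solve 3 (λ q p n → q :* p :+ q :* (n :* p) := (:1 :+ n) :* (q :* p))
        ≐-refl q (q ^ n) (con (+ n)) ⟩
    (1ˢ + con (+ n)) * q ^ suc n  ≈⟨ *-cong-≐ (pointwise λ { zero → refl ; (suc _) → refl }) ≐-refl ⟩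
    con (+ suc n) * q ^ suc n         ∎
    where
    open ≐-Reasoning
    Dq : D q ≐ q
    Dq = pointwise λ { zero → refl ; (suc zero) → refl ; (suc (suc m)) → ℤ.*-zeroʳ (+ suc (suc m)) }


  D-dilate : ∀ j f → D (dilate (suc j) f) ≐ con (+ suc j) * dilate (suc j) (D f)
  D-dilate j f = pointwise λ m → trans
    (scale (m % suc j) (m / suc j) m (at f (m / suc j)) (m≡m%n+[m/n]*n m (suc j)))
    (sym (con-* (+ suc j) (dilate (suc j) (D f)) m))
    where
    scale : ∀ r e m c → m ≡ r ℕ.+ e ℕ.* suc j → + m ℤ.* pick r c ≡ + suc j ℤ.* pick r (+ e ℤ.* c)
    scale zero e m c eq = trans (cong (ℤ._* c) (trans (cong +_ eq) (ℤ.pos-* e (suc j)))) (comm (+ e) (+ suc j) c)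
      where comm : ∀ e j c → e ℤ.* j ℤ.* c ≡ j ℤ.* (e ℤ.* c)
            comm = solve-∀
    scale (suc r) e m c eq = trans (ℤ.*-zeroʳ (+ m)) (sym (ℤ.*-zeroʳ (+ suc j)))

-- The series S(c) and its functional equation

module FunctionalEquation where
  open Dilation public

  private variable
    f g c c′ : Series
    k : ℤ
    N : ℕ

  order1 : at f 0 ≡ 0ℤ → f ≈[ k , 1 ] 0ˢ
  order1 p = order λ { zero _ → p ; (suc _) (s≤s ()) }

  order-^ : at f 0 ≡ 0ℤ → ∀ n → f ^ n ≈[ k , n ] 0ˢ
  order-^ p zero    = mk λ _ ()
  order-^ p (suc n) = order-* 1 n (order1 p) (order-^ p n)

  module QSeries (a Q : Series) (a² : a * a ≐ 1ˢ) (Q₀ : at Q 0 ≡ 0ℤ) where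

    den : Series → ℕ → Series
    den c n = 1ˢ - c * Q ^ n

    -- t c n = ∏_{i=1}^{n} Q^{i-1} (c - a Q^i) / (1 - c Q^{i-1})
    t : Series → ℕ → Series
    t c zero    = 1ˢ
    t c (suc n) = t c n * (Q ^ n * (c - a * Q ^ suc n)) * inv (den c n)

    -- These are the factors of the shift equation A(c) S(c) = B(c) S(cQ). Both are invariant under
    -- c ↦ ac since a² = 1.
    A B : Series → Series
    A c = (1ˢ - c) * (1ˢ - a * c)
    B c = 1ˢ - a * c * c

    T S : ℕ → Series → Series
    T K c = 1ˢ + ∑ K (λ n → t c (suc n))
    S K c = T K c + T K (a * c) - 1ˢ

    module _ (c₀ : at c 0 ≡ 0ℤ) where
      unit-den : ∀ n → Unit (den c n)
      unit-den n = unit-1- (*-head₀ c (Q ^ n) c₀)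

      private
        -- The certificate of the telescoping sum: t_(n+1) with its numerator factor c - aQ^(n+1)
        -- left out.
        h : ℕ → Series
        h n = t c n * Q ^ n * inv (den c n)

        d-inv : ∀ n → den c n * inv (den c n) ≐ 1ˢ
        d-inv n = *-inverse (unit-den n)

        t-suc : ∀ n → t c (suc n) ≐ h n * (c - a * Q ^ suc n)
        t-suc n = solve 4 (λ t p e i → t :* (p :* e) :* i := t :* p :* i :* e) ≐-refl (t c n) (Q ^ n) (c - a * Q ^ suc n) (inv (den c n))

        d-shift : ∀ n → inv (den (c * Q) n) * den c (suc n) ≐ 1ˢ
        d-shift n = ≐-trans
          (solve 4 (λ i c q p → i :* (:1 :- c :* (q :* p)) := (:1 :- (c :* q) :* p) :* i) ≐-refl (inv (den (c * Q) n)) c Q (Q ^ n))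
          (*-inverse (unit-1- (*-head₀ (c * Q) (Q ^ n) (*-head₀ c Q c₀))))

        -- Since cQ - aQ^i = Q(c - aQ^(i-1)), replacing c by cQ moves all factors by one index.
        -- Numerators and denominators are then shared with the product at c up to boundary factors,
        -- which form the explicit multiple of `h n`.
        t-shift : ∀ n → t (c * Q) (suc n) * den c (suc n) ≐ Q ^ suc n * (c - a) * (1ˢ - c) * h n
        t-shift zero = begin
          1ˢ * (1ˢ * (c * Q - a * (Q * 1ˢ))) * inv (den (c * Q) 0) * den c 1
            ≈⟨ solve 5 (λ c q a i d → :1 :* (:1 :* (c :* q :- a :* (q :* :1))) :* i :* d := q :* (c :- a) :* (i :* d))
                ≐-refl c Q a (inv (den (c * Q) 0)) (den c 1) ⟩
          Q * (c - a) * (inv (den (c * Q) 0) * den c 1)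
            ≈⟨ *-congˡ-≐ (d-shift 0) ⟩
          Q * (c - a) * 1ˢ
            ≈⟨ *-congˡ-≐ (d-inv 0) ⟨
          Q * (c - a) * ((1ˢ - c * 1ˢ) * inv (den c 0))
            ≈⟨ solve 4 (λ c q a i → q :* (c :- a) :* ((:1 :- c :* :1) :* i) := (q :* :1) :* (c :- a) :* (:1 :- c) :* (:1 :* :1 :* i))
                ≐-refl c Q a (inv (den c 0)) ⟩
          Q ^ 1 * (c - a) * (1ˢ - c) * h 0 ∎
          where open ≐-Reasoning
        t-shift (suc n) = begin
          t (c * Q) (suc n) * (P * (c * Q - a * (Q * P))) * inv (den (c * Q) (suc n)) * den c (suc (suc n))
            ≈⟨ solve 7 (λ t p c q a i d → t :* (p :* (c :* q :- a :* (q :* p))) :* i :* d := t :* (q :* p :* (c :- a :* p)) :* (i :* d))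
                ≐-refl (t (c * Q) (suc n)) P c Q a (inv (den (c * Q) (suc n))) (den c (suc (suc n))) ⟩
          t (c * Q) (suc n) * (Q * P * (c - a * P)) * (inv (den (c * Q) (suc n)) * den c (suc (suc n)))
            ≈⟨ *-congˡ-≐ (≐-trans (d-shift (suc n)) (≐-sym (d-inv (suc n)))) ⟩
          t (c * Q) (suc n) * (Q * P * (c - a * P)) * (den c (suc n) * inv (den c (suc n)))
            ≈⟨ solve 4 (λ t e d i → t :* e :* (d :* i) := t :* d :* (e :* i))
                ≐-refl (t (c * Q) (suc n)) (Q * P * (c - a * P)) (den c (suc n)) (inv (den c (suc n))) ⟩
          t (c * Q) (suc n) * den c (suc n) * (Q * P * (c - a * P) * inv (den c (suc n)))
            ≈⟨ *-cong-≐ (t-shift n) ≐-refl ⟩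
          P * (c - a) * (1ˢ - c) * h n * (Q * P * (c - a * P) * inv (den c (suc n)))
            ≈⟨ solve 7 (λ p e e′ h q g i → p :* e :* e′ :* h :* (q :* p :* g :* i) := q :* p :* e :* e′ :* (h :* g :* p :* i))
                ≐-refl P (c - a) (1ˢ - c) (h n) Q (c - a * P) (inv (den c (suc n))) ⟩
          Q * P * (c - a) * (1ˢ - c) * (h n * (c - a * P) * P * inv (den c (suc n)))
            ≈⟨ *-congˡ-≐ (*-cong-≐ (*-cong-≐ (t-suc n) ≐-refl) ≐-refl) ⟨
          Q ^ suc (suc n) * (c - a) * (1ˢ - c) * h (suc n) ∎
          where
          open ≐-Reasoning
          P = Q ^ suc n

        -- Multiplying by the unit 1 - cQ^(n+1) leaves a polynomial identity in c, a, Q^(n+1) and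
        -- `h n`, valid up to a multiple of a² - 1.
        telescope : ∀ n → A c * t c (suc n) - B c * t (c * Q) (suc n) ≐ c * A c * (h n - h (suc n))
        telescope n = ≈⇒≐ λ N → *-cancelˡ (unit-den (suc n)) (≐⇒≈ (begin
          den c (suc n) * (A c * t c (suc n) - B c * t (c * Q) (suc n))
            ≈⟨ solve 5 (λ d A x B y → d :* (A :* x :- B :* y) := A :* x :* d :- B :* (y :* d))
                ≐-refl (den c (suc n)) (A c) (t c (suc n)) (B c) (t (c * Q) (suc n)) ⟩
          A c * t c (suc n) * den c (suc n) - B c * (t (c * Q) (suc n) * den c (suc n))
            ≈⟨ +-cong-≐ (*-cong-≐ (*-congˡ-≐ (t-suc n)) ≐-refl) (-‿cong-≐ (*-congˡ-≐ (t-shift n))) ⟩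
          A c * (h n * (c - a * P)) * den c (suc n) - B c * (P * (c - a) * (1ˢ - c) * h n)
            ≈⟨ solve 4 (λ c a P h → let A = (:1 :- c) :* (:1 :- a :* c) in
                 A :* (h :* (c :- a :* P)) :* (:1 :- c :* P) :- (:1 :- a :* c :* c) :* (P :* (c :- a) :* (:1 :- c) :* h)
                 := c :* A :* (h :* (:1 :- c :* P) :- h :* (c :- a :* P) :* P) :+ (a :* a :- :1) :* (h :* (:1 :- c) :* (:1 :- c) :* c :* P)) ≐-refl c a P (h n) ⟩
          c * A c * (h n * den c (suc n) - h n * (c - a * P) * P) + (a * a - 1ˢ) * (h n * (1ˢ - c) * (1ˢ - c) * c * P)
            ≈⟨ +-cong-≐ (*-congˡ-≐ (+-congˡ-≐ (-‿cong-≐ (≐-trans (*-cong-≐ (≐-sym (t-suc n)) ≐-refl) (≐-sym h-suc))))) (*-cong-≐ (+-cong-≐ a² ≐-refl) ≐-refl) ⟩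
          c * A c * (h n * den c (suc n) - h (suc n) * den c (suc n)) + (1ˢ - 1ˢ) * (h n * (1ˢ - c) * (1ˢ - c) * c * P)
            ≈⟨ solve 5 (λ e h d h′ z → e :* (h :* d :- h′ :* d) :+ (:1 :- :1) :* z := d :* (e :* (h :- h′)))
                ≐-refl (c * A c) (h n) (den c (suc n)) (h (suc n)) (h n * (1ˢ - c) * (1ˢ - c) * c * P) ⟩
          den c (suc n) * (c * A c * (h n - h (suc n))) ∎))
          where
          open ≐-Reasoning
          P = Q ^ suc n
          h-suc : h (suc n) * den c (suc n) ≐ t c (suc n) * P
          h-suc = begin
            t c (suc n) * P * inv (den c (suc n)) * den c (suc n)
              ≈⟨ solve 3 (λ x i d → x :* i :* d := x :* (d :* i)) ≐-refl (t c (suc n) * P) (inv (den c (suc n))) (den c (suc n)) ⟩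
            t c (suc n) * P * (den c (suc n) * inv (den c (suc n))) ≈⟨ *-congˡ-≐ (d-inv (suc n)) ⟩
            t c (suc n) * P * 1ˢ ≈⟨ *-identityʳ-≐ (t c (suc n) * P) ⟩
            t c (suc n) * P ∎

        telescoped : ∀ K → A c * ∑ K (λ n → t c (suc n)) - B c * ∑ K (λ n → t (c * Q) (suc n)) ≐ c * A c * (h 0 - h K)
        telescoped zero = solve 4 (λ A B c h → A :* :0 :- B :* :0 := c :* A :* (h :- h)) ≐-refl (A c) (B c) c (h 0)
        telescoped (suc K) = begin
          A c * (X + x) - B c * (Y + y)
            ≈⟨ solve 6 (λ A B X x Y y → A :* (X :+ x) :- B :* (Y :+ y) := (A :* X :- B :* Y) :+ (A :* x :- B :* y))
                ≐-refl (A c) (B c) X x Y y ⟩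
          (A c * X - B c * Y) + (A c * x - B c * y)
            ≈⟨ +-cong-≐ (telescoped K) (telescope K) ⟩
          c * A c * (h 0 - h K) + c * A c * (h K - h (suc K))
            ≈⟨ solve 4 (λ e x y z → e :* (x :- y) :+ e :* (y :- z) := e :* (x :- z)) ≐-refl (c * A c) (h 0) (h K) (h (suc K)) ⟩
          c * A c * (h 0 - h (suc K)) ∎
          where
          open ≐-Reasoning
          X = ∑ K (λ n → t c (suc n))
          Y = ∑ K (λ n → t (c * Q) (suc n))
          x = t c (suc K)
          y = t (c * Q) (suc K)

      -- Each numerator factor c - aQ^i has constant term 0 and contributes one order of vanishing.
      t-order : ∀ n → t c n ≈[ k , n ] 0ˢ
      t-order zero = mk λ _ ()
      t-order (suc n) = ≈-trans (≐⇒≈ (solve 4 (λ t p e i → t :* (p :* e) :* i := e :* t :* (p :* i))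
          ≐-refl (t c n) (Q ^ n) (c - a * Q ^ suc n) (inv (den c n))))
        (order-weaken _ (order-* 1 n (order1 c-aQ) (t-order n)))
        where
        c-aQ : at (c - a * Q ^ suc n) 0 ≡ 0ℤ
        c-aQ = cong₂ (λ x y → x ℤ.- y) c₀ (trans (coeff= (solve 3 (λ a q p → a :* (q :* p) := q :* (a :* p))
            ≐-refl a Q (Q ^ n)) 0) (*-head₀ Q (a * Q ^ n) Q₀))

      -- The telescoped sum is c A(c) (h(0) - h(K)). Here h(0) = 1/(1 - c) produces the
      -- inhomogeneous term c(1 - ac), and h(K) vanishes modulo q^N.
      T-shift : ∀ {K} → N ≤ K → A c * T K c ≈[ k , N ] B c * T K (c * Q) + (A c - B c + c * (1ˢ - a * c))
      T-shift {N} {k} {K} N≤K = begin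
        A c * (1ˢ + X)
          ≈⟨ ≐⇒≈ (solve 4 (λ A B X Y → A :* (:1 :+ X) := B :* (:1 :+ Y) :+ (A :- B :+ (A :* X :- B :* Y))) ≐-refl (A c) (B c) X Y) ⟩
        B c * (1ˢ + Y) + (A c - B c + (A c * X - B c * Y))
          ≈⟨ +-congˡ (+-congˡ (≐⇒≈ (telescoped K))) ⟩
        B c * (1ˢ + Y) + (A c - B c + c * A c * (h 0 - h K))
          ≈⟨ +-congˡ (+-congˡ (*-congˡ (+-congˡ (-‿cong h-small)))) ⟩
        B c * (1ˢ + Y) + (A c - B c + c * A c * (h 0 - 0ˢ))
          ≈⟨ +-congˡ (+-congˡ (≐⇒≈ (solve 3 (λ c a i → c :* ((:1 :- c) :* (:1 :- a :* c)) :* (:1 :* :1 :* i :- :0) :=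
              c :* (:1 :- a :* c) :* ((:1 :- c :* :1) :* i))
              ≐-refl c a (inv (den c 0))))) ⟩
        B c * (1ˢ + Y) + (A c - B c + c * (1ˢ - a * c) * (den c 0 * inv (den c 0)))
          ≈⟨ +-congˡ (+-congˡ (*-congˡ (≐⇒≈ (d-inv 0)))) ⟩
        B c * (1ˢ + Y) + (A c - B c + c * (1ˢ - a * c) * 1ˢ)
          ≈⟨ +-congˡ (+-congˡ (≐⇒≈ (*-identityʳ-≐ (c * (1ˢ - a * c))))) ⟩
        B c * (1ˢ + Y) + (A c - B c + c * (1ˢ - a * c)) ∎
        where
        open ≈-Reasoning
        X = ∑ K (λ n → t c (suc n))
        Y = ∑ K (λ n → t (c * Q) (suc n))
        h-small : h K ≈[ k , N ] 0ˢ
        h-small = order-weaken _ (order-weaken _ (≈-weaken N≤K (t-order K)))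

    t-cong : at c 0 ≡ 0ℤ → at c′ 0 ≡ 0ℤ → c ≈[ k , N ] c′ → ∀ n → t c n ≈[ k , N ] t c′ n
    t-cong c₀ c′₀ p zero    = ≈-refl
    t-cong c₀ c′₀ p (suc n) = *-cong (*-cong (t-cong c₀ c′₀ p n) (*-congˡ (+-congʳ p)))
      (inv-cong (unit-den c₀ n) (unit-den c′₀ n) (≈-refl -cong *-congʳ p))

    T-cong : ∀ K → at c 0 ≡ 0ℤ → at c′ 0 ≡ 0ℤ → c ≈[ k , N ] c′ → T K c ≈[ k , N ] T K c′
    T-cong K c₀ c′₀ p = +-congˡ (∑-cong K λ n → t-cong c₀ c′₀ p (suc n))

    ac₀ : ∀ c → at c 0 ≡ 0ℤ → at (a * c) 0 ≡ 0ℤ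
    ac₀ c c₀ = trans (coeff= (*-comm-≐ a c) 0) (*-head₀ c a c₀)

    S-cong : ∀ K → at c 0 ≡ 0ℤ → at c′ 0 ≡ 0ℤ → c ≈[ k , N ] c′ → S K c ≈[ k , N ] S K c′
    S-cong {c} {c′} K c₀ c′₀ p = +-cong (T-cong K c₀ c′₀ p) (T-cong K (ac₀ c c₀) (ac₀ c′ c′₀) (*-congˡ p)) -cong ≈-refl

    -- The corrections A - B + c(1 - ac) and A - B + ac(1 - c), together with -A from the subtracted
    -- 1, add up to -B because A - B = -c - ac + 2ac². What is left is homogeneous.
    S-shift : ∀ {K} → at c 0 ≡ 0ℤ → N ≤ K → A c * S K c ≈[ k , N ] B c * S K (c * Q)
    S-shift {c} {N} {k} {K} c₀ N≤K = begin
      A c * (x + y - 1ˢ)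
        ≈⟨ ≐⇒≈ (solve 3 (λ A x y → A :* (x :+ y :- :1) := A :* x :+ A :* y :- A) ≐-refl (A c) x y) ⟩
      A c * x + A c * y - A c
        ≈⟨ +-cong (T-shift c₀ N≤K) (≈-trans (*-congʳ (≈-sym A′)) (T-shift (ac₀ c c₀) N≤K)) -cong ≈-refl ⟩
      (B c * x′ + (A c - B c + c * (1ˢ - a * c))) + (B (a * c) * T K (a * c * Q) + (A (a * c) - B (a * c) + a * c * (1ˢ - a * (a * c)))) - A c
        ≈⟨ +-cong ≈-refl (+-cong (*-cong B′ (T-cong K (*-head₀ (a * c) Q (ac₀ c c₀)) (ac₀ (c * Q) (*-head₀ c Q c₀)) (≐⇒≈ (*-assoc-≐ a c Q)))) (+-cong (A′ -cong B′) (*-congˡ (≈-refl -cong aac)))) -cong ≈-refl ⟩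
      (B c * x′ + (A c - B c + c * (1ˢ - a * c))) + (B c * y′ + (A c - B c + a * c * (1ˢ - c))) - A c
        ≈⟨ ≐⇒≈ (solve 4 (λ a c x y → let A = (:1 :- c) :* (:1 :- a :* c) ; B = :1 :- a :* c :* c in
              (B :* x :+ (A :- B :+ c :* (:1 :- a :* c))) :+ (B :* y :+ (A :- B :+ a :* c :* (:1 :- c))) :- A := B :* (x :+ y :- :1)) ≐-refl a c x′ y′) ⟩
      B c * (x′ + y′ - 1ˢ) ∎
      where
      open ≈-Reasoning
      x = T K c
      y = T K (a * c)
      x′ = T K (c * Q)
      y′ = T K (a * (c * Q))
      aac : a * (a * c) ≈[ k , N ] c
      aac = ≐⇒≈ (≐-trans (≐-sym (*-assoc-≐ a a c)) (≐-trans (*-cong-≐ a² ≐-refl) (*-identityˡ-≐ c)))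
      A′ : A (a * c) ≈[ k , N ] A c
      A′ = ≈-trans (*-congˡ (≈-refl -cong aac)) (≐⇒≈ (*-comm-≐ (1ˢ - a * c) (1ˢ - c)))
      B′ : B (a * c) ≈[ k , N ] B c
      B′ = ≈-refl -cong ≈-trans (*-congʳ aac) (≐⇒≈ (solve 2 (λ a c → c :* (a :* c) := a :* c :* c) ≐-refl a c))

    S-iterate : ∀ {K} → at c 0 ≡ 0ℤ → N ≤ K → ∀ n →
                ∏ n (λ i → A (c * Q ^ i)) * S K c ≈[ k , N ] ∏ n (λ i → B (c * Q ^ i)) * S K (c * Q ^ n)
    S-iterate {c} {N} {k} {K} c₀ N≤K zero = *-congˡ (S-cong K c₀ (*-head₀ c 1ˢ c₀) (≐⇒≈ (solve 1 (λ c → c := c :* :1) ≐-refl c)))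
    S-iterate {c} {N} {k} {K} c₀ N≤K (suc n) = begin
      ∏ n Aᵢ * Aᵢ n * S K c               ≈⟨ ≐⇒≈ (solve 3 (λ x y z → x :* y :* z := y :* (x :* z)) ≐-refl (∏ n Aᵢ) (Aᵢ n) (S K c)) ⟩
      Aᵢ n * (∏ n Aᵢ * S K c)             ≈⟨ *-congˡ (S-iterate c₀ N≤K n) ⟩
      Aᵢ n * (∏ n Bᵢ * S K (c * Q ^ n))   ≈⟨ ≐⇒≈ (solve 3 (λ x y z → x :* (y :* z) := y :* (x :* z))
          ≐-refl (Aᵢ n) (∏ n Bᵢ) (S K (c * Q ^ n))) ⟩
      ∏ n Bᵢ * (Aᵢ n * S K (c * Q ^ n))   ≈⟨ *-congˡ (S-shift cn₀ N≤K) ⟩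
      ∏ n Bᵢ * (Bᵢ n * S K (c * Q ^ n * Q)) ≈⟨ *-congˡ (*-congˡ (S-cong K (*-head₀ (c * Q ^ n) Q cn₀) (*-head₀ c (Q ^ suc n) c₀)
                                                  (≐⇒≈ (solve 3 (λ c p q → c :* p :* q := c :* (q :* p)) ≐-refl c (Q ^ n) Q)))) ⟩
      ∏ n Bᵢ * (Bᵢ n * S K (c * Q ^ suc n)) ≈⟨ ≐⇒≈ (≐-sym (*-assoc-≐ (∏ n Bᵢ) (Bᵢ n) _)) ⟩
      ∏ n Bᵢ * Bᵢ n * S K (c * Q ^ suc n) ∎
      where
      open ≈-Reasoning
      Aᵢ Bᵢ : ℕ → Series
      Aᵢ i = A (c * Q ^ i)
      Bᵢ i = B (c * Q ^ i)
      cn₀ : at (c * Q ^ n) 0 ≡ 0ℤ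
      cn₀ = *-head₀ c (Q ^ n) c₀

    S-product : ∀ {K} → at c 0 ≡ 0ℤ → N ≤ K →
                ∏ K (λ i → A (c * Q ^ i)) * S K c ≈[ k , N ] ∏ K (λ i → B (c * Q ^ i)) * S K 0ˢ
    S-product {c} {N} {k} {K} c₀ N≤K = ≈-trans (S-iterate c₀ N≤K K)
      -- Q has constant term 0, so cQ^K vanishes modulo q^K and K shifts reach S(0) to the required
      -- precision.
      (*-congˡ (S-cong K (*-head₀ c (Q ^ K) c₀) refl
        (≈-weaken N≤K (≈-trans (≐⇒≈ (*-comm-≐ c (Q ^ K))) (order-weaken c (order-^ Q₀ K))))))

    -- The i-th factor at c = 0 is -aQ^(2i-1), and the first n odd numbers sum to n².
    t-zero : ∀ n → t 0ˢ n ≐ (- a) ^ n * Q ^ (n ℕ.* n)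
    t-zero zero = solve 0 (:1 := :1 :* :1) ≐-refl
    t-zero (suc n) = begin
      t 0ˢ n * (Q ^ n * (0ˢ - a * (Q * Q ^ n))) * inv (den 0ˢ n)
        ≈⟨ *-cong-≐ (*-cong-≐ (t-zero n) ≐-refl) inv1 ⟩
      (- a) ^ n * Q ^ (n ℕ.* n) * (Q ^ n * (0ˢ - a * (Q * Q ^ n))) * 1ˢ
        ≈⟨ solve 5 (λ x y p a q → x :* y :* (p :* (:0 :- a :* (q :* p))) :* :1 := (:- a) :* x :* (q :* (p :* (y :* p))))
            ≐-refl ((- a) ^ n) (Q ^ (n ℕ.* n)) (Q ^ n) a Q ⟩
      (- a) ^ suc n * (Q * (Q ^ n * (Q ^ (n ℕ.* n) * Q ^ n)))
        ≈⟨ *-congˡ-≐ (*-congˡ-≐ (≐-trans (*-congˡ-≐ (≐-sym (^-+ Q (n ℕ.* n) n))) (≐-sym (^-+ Q n (n ℕ.* n ℕ.+ n))))) ⟩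
      (- a) ^ suc n * Q ^ suc (n ℕ.+ (n ℕ.* n ℕ.+ n))
        ≡⟨ cong (λ e → (- a) ^ suc n * Q ^ e) (eq n) ⟩
      (- a) ^ suc n * Q ^ (suc n ℕ.* suc n) ∎
      where
      open ≐-Reasoning
      eq : ∀ n → suc (n ℕ.+ (n ℕ.* n ℕ.+ n)) ≡ suc n ℕ.* suc n
      eq = ℕ.solve-∀
      inv1 : inv (den 0ˢ n) ≐ 1ˢ
      inv1 = begin
        inv (den 0ˢ n) ≈⟨ solve 2 (λ i p → i := (:1 :- :0 :* p) :* i) ≐-refl (inv (den 0ˢ n)) (Q ^ n) ⟩
        den 0ˢ n * inv (den 0ˢ n) ≈⟨ *-inverse (unit-den refl n) ⟩
        1ˢ ∎

-- Theta series and their product formulas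

module ThetaProducts where
  open FunctionalEquation public

  private variable
    f : Series
    k : ℤ
    K N : ℕ

  Σ<-snoc : ∀ n (F : ℕ → ℤ) → Σ< (suc n) F ≡ Σ< n F ℤ.+ F n
  Σ<-snoc zero    F = ℤ.+-comm (F 0) 0ℤ
  Σ<-snoc (suc n) F = trans (cong (λ s → F 0 ℤ.+ s) (Σ<-snoc n (λ i → F (suc i)))) (sym (ℤ.+-assoc (F 0) _ _))

  ∑-at : ∀ n F m → at (∑ n F) m ≡ Σ< n (λ i → at (F i) m)
  ∑-at zero    F m = con0-at m
  ∑-at (suc n) F m = trans (cong (ℤ._+ at (F n) m) (∑-at n F m)) (sym (Σ<-snoc n (λ i → at (F i) m)))

  ∑-head : ∀ n F → ∑ (suc n) F ≐ F 0 + ∑ n (λ i → F (suc i))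
  ∑-head zero    F = solve 1 (λ a → :0 :+ a := a :+ :0) ≐-refl (F 0)
  ∑-head (suc n) F = ≐-trans (+-cong-≐ (∑-head n F) ≐-refl)
    (solve 3 (λ a b c → a :+ b :+ c := a :+ (b :+ c)) ≐-refl (F 0) (∑ n (λ i → F (suc i))) (F (suc n)))

  -- The sum of a family in which q^n divides F n.
  ∑∞ : (ℕ → Series) → Series
  ∑∞ F .at m = at (∑ (suc m) F) m

  -- Terms beyond the index of a coefficient have too high an order to affect it, so any partial sum
  -- of length at least `N` will do.
  ∑∞-≈∑ : ∀ {F} → (∀ n → F n ≈[ 0ℤ , n ] 0ˢ) → N ≤ K → ∑∞ F ≈[ k , N ] ∑ K F
  ∑∞-≈∑ {N} {K} {k} {F} ord N≤K = mk λ m m<N → ≡⇒≡[] (stable m K (ℕ.≤-trans m<N N≤K))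
    where
    stable : ∀ m K → suc m ≤ K → at (∑ (suc m) F) m ≡ at (∑ K F) m
    stable m (suc K) m<1+K with m ℕ.<? K
    ... | no  m≮K rewrite ℕ.≤-antisym (ℕ.≤-pred m<1+K) (ℕ.≮⇒≥ m≮K) = refl
    ... | yes m<K = trans (stable m K m<K)
      (sym (trans (cong (λ z → at (∑ K F) m ℤ.+ z) (order⁻¹ (ord K) m m<K)) (ℤ.+-identityʳ _)))

  ∑∞-≈ : ∀ {F} → (∀ n → F n ≈[ 0ℤ , n ] 0ˢ) → N ≤ K → ∑∞ F ≈[ k , N ] F 0 + ∑ K (λ n → F (suc n))
  ∑∞-≈ {F = F} ord N≤K = ≈-trans (∑∞-≈∑ ord (ℕ.m≤n⇒m≤1+n N≤K)) (≐⇒≈ (∑-head _ F))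

  ∑∞-at : ∀ F m → at (∑∞ F) m ≡ Σ∞ (λ n → at (F n)) m
  ∑∞-at F m = ∑-at (suc m) F m

  -- θ s = Σ_{n ∈ ℤ} s^n q^{n²} for s = ±1
  θ-term : ℤ → ℕ → Series
  θ-term s n = con s ^ n * q ^ (n ℕ.* n)

  θ : ℤ → Series
  θ s = con (+ 2) * ∑∞ (θ-term s) - 1ˢ

  θ-order : ∀ s n → θ-term s n ≈[ k , n ] 0ˢ
  θ-order s n = ≈-trans (≐⇒≈ (*-comm-≐ (con s ^ n) (q ^ (n ℕ.* n))))
    (order-weaken _ (≈-weaken (n≤n² n) (order-q^ (n ℕ.* n))))
    where
    n≤n² : ∀ n → n ≤ n ℕ.* n
    n≤n² zero    = z≤n
    n≤n² (suc n) = ℕ.m≤m*n (suc n) (suc n)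

  φ φ⁻ : Series
  φ  = θ 1ℤ
  φ⁻ = θ -1ℤ

  θ-≈ : ∀ s → N ≤ K → θ s ≈[ k , N ] con (+ 2) * (1ˢ + ∑ K (λ n → θ-term s (suc n))) - 1ˢ
  θ-≈ s N≤K = *-congˡ (≈-trans (∑∞-≈ (θ-order s) N≤K) (+-congʳ (≐⇒≈ (solve 0 (:1 :* :1 := :1) ≐-refl)))) -cong ≈-refl

  con-neg : ∀ s → - con s ≐ con (ℤ.- s)
  con-neg s = pointwise λ { zero → refl ; (suc _) → refl }

  module QTheta (s : ℤ) (s² : s ℤ.* s ≡ 1ℤ) (j : ℕ) where

    a² : con s * con s ≐ 1ˢ
    a² = ≐-trans (≐-sym (con*con s s)) (subst (λ z → con z ≐ 1ˢ) (sym s²) ≐-refl)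

    open QSeries (con s) (q ^ suc j) a² refl public

    -- The sign of the theta series is opposite to `s` because the terms at c = 0 carry (-a)^n.
    S-zero : N ≤ K → S K 0ˢ ≈[ k , N ] dilate (suc j) (θ (ℤ.- s))
    S-zero {N} {K} {k} N≤K = begin
      T K 0ˢ + T K (con s * 0ˢ) - 1ˢ
        ≈⟨ +-congˡ (T-cong K (ac₀ 0ˢ refl) refl (≐⇒≈ (zeroʳ-≐ (con s)))) -cong ≈-refl ⟩
      T K 0ˢ + T K 0ˢ - 1ˢ
        ≈⟨ ≐⇒≈ (solve 1 (λ x → x :+ x :- :1 := :con (+ 2) :* x :- :1) ≐-refl (T K 0ˢ)) ⟩
      con (+ 2) * T K 0ˢ - 1ˢ
        ≈⟨ *-congˡ (+-cong (≈-sym (≐⇒≈ (E.con-homo 1ℤ))) (≈-trans (∑-cong K (λ n → ≐⇒≈ (term (suc n)))) (≈-sym (≐⇒≈ (E.∑-homo K _))))) -cong ≈-refl ⟩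
      con (+ 2) * (dil (1ˢ) + dil (∑ K (λ n → θ-term (ℤ.- s) (suc n)))) - 1ˢ
        ≈⟨ ≐⇒≈ (+-cong-≐ (≐-trans (*-cong-≐ (≐-sym (E.con-homo (+ 2))) (≐-sym (E.+-homo _ _))) (≐-sym (E.*-homo _ _))) (-‿cong-≐ (≐-sym (E.con-homo 1ℤ)))) ⟩
      dil (con (+ 2) * (1ˢ + ∑ K (λ n → θ-term (ℤ.- s) (suc n)))) - dil 1ˢ
        ≈⟨ ≐⇒≈ (E.minus-homo _ _) ⟨
      dil (con (+ 2) * (1ˢ + ∑ K (λ n → θ-term (ℤ.- s) (suc n))) - 1ˢ)
        ≈⟨ E.cong-≈ (θ-≈ (ℤ.- s) N≤K) ⟨
      dil (θ (ℤ.- s)) ∎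
      where
      open ≈-Reasoning
      module E = Dilate j
      dil = dilate (suc j)
      term : ∀ n → t 0ˢ n ≐ dil (θ-term (ℤ.- s) n)
      term n = ≐-trans (t-zero n) (≐-trans
        (*-cong-≐ (≐-trans (^-cong-≐ n (≐-trans (con-neg s) (≐-sym (E.con-homo _)))) (≐-sym (E.^-homo n _)))
                  (≐-sym (E.q^-homo (n ℕ.* n))))
        (≐-sym (E.*-homo _ _)))

  odd : ℕ → Series
  odd i = q * (q ^ 2) ^ i

  P⁻ P⁺ : ℕ → Series
  P⁻ K = ∏ K (λ i → 1ˢ - odd i)
  P⁺ K = ∏ K (λ i → 1ˢ + odd i)

  unit-P⁻ : ∀ K → Unit (P⁻ K)
  unit-P⁻ K = unit-∏ K λ i → unit-1- refl

  unit-P⁺ : ∀ K → Unit (P⁺ K)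
  unit-P⁺ K = unit-∏ K λ i → unit-1+ refl

  module _ where
    open QTheta 1ℤ refl 1

    private
      -- For a = 1, Q = q², c = q the numerator q - q^(2n+2) is q times the denominator 1 -
      -- q^(2n+1), so all denominators disappear.
      t-odd : ∀ n → t q n ≐ θ-term 1ℤ n
      t-odd zero = solve 0 (:1 := :1 :* :1) ≐-refl
      t-odd (suc n) = begin
        t q n * (Qn * (q - 1ˢ * (q ^ 2 * Qn))) * inv (den q n)
          ≈⟨ *-cong-≐ (*-cong-≐ (t-odd n) ≐-refl) ≐-refl ⟩
        1ˢ ^ n * q ^ (n ℕ.* n) * (Qn * (q - 1ˢ * (q ^ 2 * Qn))) * inv (den q n)
          ≈⟨ solve 5 (λ e x p q i → e :* x :* (p :* (q :- :1 :* (q :^ 2 :* p))) :* i := :1 :* e :* (q :* (x :* p)) :* ((:1 :- q :* p) :* i))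
               ≐-refl (1ˢ ^ n) (q ^ (n ℕ.* n)) Qn q (inv (den q n)) ⟩
        1ˢ ^ suc n * (q * (q ^ (n ℕ.* n) * Qn)) * (den q n * inv (den q n))
          ≈⟨ *-congˡ-≐ (*-inverse (unit-den refl n)) ⟩
        1ˢ ^ suc n * (q * (q ^ (n ℕ.* n) * Qn)) * 1ˢ
          ≈⟨ *-identityʳ-≐ _ ⟩
        1ˢ ^ suc n * (q * (q ^ (n ℕ.* n) * Qn))
          ≈⟨ *-congˡ-≐ (*-congˡ-≐ (≐-trans (*-congˡ-≐ (≐-sym (^-* q n 2))) (≐-sym (^-+ q (n ℕ.* n) (n ℕ.* 2))))) ⟩
        1ˢ ^ suc n * q ^ suc (n ℕ.* n ℕ.+ n ℕ.* 2)
          ≡⟨ cong (λ e → 1ˢ ^ suc n * q ^ e) (eq n) ⟩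
        θ-term 1ℤ (suc n) ∎
        where
        open ≐-Reasoning
        Qn = (q ^ 2) ^ n
        eq : ∀ n → suc (n ℕ.* n ℕ.+ n ℕ.* 2) ≡ suc n ℕ.* suc n
        eq = ℕ.solve-∀

      S-odd : N ≤ K → S K q ≈[ k , N ] φ
      S-odd {N} {K} {k} N≤K = begin
        T K q + T K (1ˢ * q) - 1ˢ
          ≈⟨ +-congˡ (T-cong K refl refl (≐⇒≈ (*-identityˡ-≐ q))) -cong ≈-refl ⟩
        T K q + T K q - 1ˢ
          ≈⟨ ≐⇒≈ (solve 1 (λ x → x :+ x :- :1 := :con (+ 2) :* x :- :1) ≐-refl (T K q)) ⟩
        con (+ 2) * T K q - 1ˢ
          ≈⟨ *-congˡ (+-congˡ (∑-cong K (λ n → ≐⇒≈ (t-odd (suc n))))) -cong ≈-refl ⟩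
        con (+ 2) * (1ˢ + ∑ K (λ n → θ-term 1ℤ (suc n))) - 1ˢ
          ≈⟨ θ-≈ 1ℤ N≤K ⟨
        φ ∎
        where open ≈-Reasoning

    -- With a = 1 the factors are A = (1 - c)² and B = (1 - c)(1 + c), so one copy of `P⁻ K`
    -- cancels.
    φ-odd-product : N ≤ K → P⁻ K * φ ≈[ k , N ] P⁺ K * dilate 2 φ⁻
    φ-odd-product {N} {K} {k} N≤K = *-cancelˡ (unit-P⁻ K) (begin
      P⁻ K * (P⁻ K * φ) ≈⟨ ≐⇒≈ (≐-sym (*-assoc-≐ _ _ _)) ⟩
      P⁻ K * P⁻ K * φ   ≈⟨ *-congʳ (∏-distrib-* K _ _) ⟨
      ∏ K (λ i → (1ˢ - odd i) * (1ˢ - odd i)) * φ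
        ≈⟨ *-cong (∏-cong K (λ i → *-congˡ (≈-refl -cong ≐⇒≈ (solve 1 (λ x → x := :1 :* x) ≐-refl (odd i))))) (≈-sym (S-odd N≤K)) ⟩
      ∏ K (λ i → A (odd i)) * S K q ≈⟨ S-product refl N≤K ⟩
      ∏ K (λ i → B (odd i)) * S K 0ˢ
        ≈⟨ *-cong (∏-cong K (λ i → ≐⇒≈ (solve 1 (λ x → :1 :- :1 :* x :* x := (:1 :- x) :* (:1 :+ x)) ≐-refl (odd i)))) (S-zero N≤K) ⟩
      ∏ K (λ i → (1ˢ - odd i) * (1ˢ + odd i)) * dilate 2 φ⁻ ≈⟨ *-congʳ (∏-distrib-* K _ _) ⟩
      P⁻ K * P⁺ K * dilate 2 φ⁻ ≈⟨ ≐⇒≈ (*-assoc-≐ _ _ _) ⟩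
      P⁻ K * (P⁺ K * dilate 2 φ⁻) ∎)
      where open ≈-Reasoning

  qⁿ : ℕ → Series
  qⁿ i = q * (q ^ 1) ^ i

  Q⁻ Q⁺ : ℕ → Series
  Q⁻ K = ∏ K (λ i → 1ˢ - qⁿ i)
  Q⁺ K = ∏ K (λ i → 1ˢ + qⁿ i)

  unit-Q⁻ : ∀ K → Unit (Q⁻ K)
  unit-Q⁻ K = unit-∏ K λ i → unit-1- refl

  dilate-1 : ∀ f → dilate 1 f ≐ f
  dilate-1 f = pointwise λ m → trans (cong (at (dilate 1 f)) (sym (ℕ.*-identityʳ m))) (dilate-at 1 f m)

  module _ where
    open QTheta 1ℤ refl 0

    private
      -- For a = 1 and c = Q = q the first numerator c - aQ is already 0: the series collapses to
      -- its constant term, and S(q) = 1.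
      t-vanish : ∀ n → t q (suc n) ≐ 0ˢ
      t-vanish zero = solve 2 (λ q i → :1 :* (:1 :* (q :- :1 :* (q :* :1 :* :1))) :* i := :0) ≐-refl q _
      t-vanish (suc n) = ≐-trans (*-cong-≐ (*-cong-≐ (t-vanish n) ≐-refl) ≐-refl)
        (solve 2 (λ x y → :0 :* x :* y := :0) ≐-refl _ _)

      ∑-vanish : ∀ K → ∑ K (λ n → t q (suc n)) ≐ 0ˢ
      ∑-vanish zero    = ≐-refl
      ∑-vanish (suc K) = ≐-trans (+-cong-≐ (∑-vanish K) (t-vanish K)) (solve 0 (:0 :+ :0 := :0) ≐-refl)

      S-one : ∀ K → S K q ≈[ k , N ] 1ˢ
      S-one {k} {N} K = begin
        T K q + T K (1ˢ * q) - 1ˢ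
          ≈⟨ +-congˡ (T-cong K refl refl (≐⇒≈ (*-identityˡ-≐ q))) -cong ≈-refl ⟩
        T K q + T K q - 1ˢ
          ≈⟨ ≐⇒≈ (+-cong-≐ (+-cong-≐ (+-congˡ-≐ (∑-vanish K)) (+-congˡ-≐ (∑-vanish K))) ≐-refl) ⟩
        1ˢ + 0ˢ + (1ˢ + 0ˢ) - 1ˢ
          ≈⟨ ≐⇒≈ (solve 0 (:1 :+ :0 :+ (:1 :+ :0) :- :1 := :1) ≐-refl) ⟩
        1ˢ ∎
        where open ≈-Reasoning

    -- Gauss' identity φ(-q) = ∏ (1 - q^n)/(1 + q^n), read off from the collapsed instance: its left
    -- side is a bare product.
    φ⁻-product : N ≤ K → Q⁻ K ≈[ k , N ] Q⁺ K * φ⁻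
    φ⁻-product {N} {K} {k} N≤K = *-cancelˡ (unit-Q⁻ K) (begin
      Q⁻ K * Q⁻ K ≈⟨ ∏-distrib-* K _ _ ⟨
      ∏ K (λ i → (1ˢ - qⁿ i) * (1ˢ - qⁿ i))
        ≈⟨ ∏-cong K (λ i → *-congˡ (≈-refl -cong ≐⇒≈ (solve 1 (λ x → x := :1 :* x) ≐-refl (qⁿ i)))) ⟩
      ∏ K (λ i → A (qⁿ i)) ≈⟨ ≐⇒≈ (solve 1 (λ x → x := x :* :1) ≐-refl _) ⟩
      ∏ K (λ i → A (qⁿ i)) * 1ˢ ≈⟨ *-congˡ (S-one K) ⟨
      ∏ K (λ i → A (qⁿ i)) * S K q ≈⟨ S-product refl N≤K ⟩
      ∏ K (λ i → B (qⁿ i)) * S K 0ˢ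
        ≈⟨ *-cong (∏-cong K (λ i → ≐⇒≈ (solve 1 (λ x → :1 :- :1 :* x :* x := (:1 :- x) :* (:1 :+ x)) ≐-refl (qⁿ i))))
             (≈-trans (S-zero N≤K) (≐⇒≈ (dilate-1 φ⁻))) ⟩
      ∏ K (λ i → (1ˢ - qⁿ i) * (1ˢ + qⁿ i)) * φ⁻ ≈⟨ *-congʳ (∏-distrib-* K _ _) ⟩
      Q⁻ K * Q⁺ K * φ⁻ ≈⟨ ≐⇒≈ (*-assoc-≐ _ _ _) ⟩
      Q⁻ K * (Q⁺ K * φ⁻) ∎)
      where open ≈-Reasoning

-- V(q) + V(-q) - 1 as a theta quotient

module MockTheta where
  open ThetaProducts public
  open import Data.Nat.DivMod using ()

  private variable
    k : ℤ
    K N : ℕ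

  wrap-q^^ : ∀ n → series (Defs.q ^^ n) ≐ q ^ n
  wrap-q^^ zero    = pointwise λ { zero → refl ; (suc _) → refl }
  wrap-q^^ (suc n) = ≐-trans {_} {q * series (Defs.q ^^ n)} (pointwise λ _ → refl) (*-congˡ-≐ (wrap-q^^ n))

  wrap-poch : ∀ a b b′ n → series b ≐ b′ → series (poch a b n) ≐ ∏ n (λ i → 1ˢ - series a * b′ ^ i)
  wrap-poch a b b′ zero    p = pointwise λ { zero → refl ; (suc _) → refl }
  wrap-poch a b b′ (suc n) p = ≐-trans {_} {series (poch a b n) * (series 𝟙 - series a * series (b ^^ n))}
    (pointwise λ _ → refl)
    (*-cong-≐ (wrap-poch a b b′ n p) (+-cong-≐ 𝟙≐1 (-‿cong-≐ (*-congˡ-≐ (wrap-^^ n)))))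
    where
    𝟙≐1 : series 𝟙 ≐ 1ˢ
    𝟙≐1 = pointwise λ { zero → refl ; (suc _) → refl }
    wrap-^^ : ∀ n → series (b ^^ n) ≐ b′ ^ n
    wrap-^^ zero    = 𝟙≐1
    wrap-^^ (suc n) = ≐-trans {_} {series b * series (b ^^ n)} (pointwise λ _ → refl) (*-cong-≐ p (wrap-^^ n))

  module _ where
    open QTheta -1ℤ refl 1

    private
      -- For a = -1, Q = q², c = q the numerator q + q^(2n+2) is q(1 + q^(2n+1)), which builds up
      -- `P⁺`. The denominators are multiplied out so that no inverse of a product occurs.
      t-closed : ∀ n → t q n * P⁻ n ≐ q ^ (n ℕ.* n) * P⁺ n
      t-closed zero = ≐-refl
      t-closed (suc n) = begin
        t q n * (Qn * (q - con -1ℤ * (q ^ 2 * Qn))) * inv (den q n) * (P⁻ n * den q n)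
          ≈⟨ solve 6 (λ t p q i x d → t :* (p :* (q :- :con -1ℤ :* (q :^ 2 :* p))) :* i :* (x :* d) := t :* x :* (q :* p :* (:1 :+ q :* p)) :* (d :* i))
               ≐-refl (t q n) Qn q (inv (den q n)) (P⁻ n) (den q n) ⟩
        t q n * P⁻ n * (q * Qn * (1ˢ + q * Qn)) * (den q n * inv (den q n))
          ≈⟨ *-cong-≐ (*-cong-≐ (t-closed n) ≐-refl) (*-inverse (unit-den refl n)) ⟩
        q ^ (n ℕ.* n) * P⁺ n * (q * Qn * (1ˢ + q * Qn)) * 1ˢ
          ≈⟨ solve 4 (λ x y q p → x :* y :* (q :* p :* (:1 :+ q :* p)) :* :1 := q :* (x :* p) :* (y :* (:1 :+ q :* p)))
              ≐-refl (q ^ (n ℕ.* n)) (P⁺ n) q Qn ⟩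
        q * (q ^ (n ℕ.* n) * Qn) * P⁺ (suc n)
          ≈⟨ *-cong-≐ (*-congˡ-≐ (≐-trans (*-congˡ-≐ (≐-sym (^-* q n 2))) (≐-sym (^-+ q (n ℕ.* n) (n ℕ.* 2))))) ≐-refl ⟩
        q ^ suc (n ℕ.* n ℕ.+ n ℕ.* 2) * P⁺ (suc n)
          ≡⟨ cong (λ e → q ^ e * P⁺ (suc n)) (eq n) ⟩
        q ^ (suc n ℕ.* suc n) * P⁺ (suc n) ∎
        where
        open ≐-Reasoning
        Qn = (q ^ 2) ^ n
        eq : ∀ n → suc (n ℕ.* n ℕ.+ n ℕ.* 2) ≡ suc n ℕ.* suc n
        eq = ℕ.solve-∀

      t≐v₀-term : ∀ n → t q n ≐ series (v₀-term n)
      t≐v₀-term n = ≈⇒≐ λ N → *-cancelˡ (unit-P⁻ n) (≐⇒≈ (begin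
        P⁻ n * t q n                        ≈⟨ *-comm-≐ _ _ ⟩
        t q n * P⁻ n                        ≈⟨ t-closed n ⟩
        q ^ (n ℕ.* n) * P⁺ n                ≈⟨ *-cong-≐ (wrap-q^^ (n ℕ.* n)) (≐-trans (wrap-poch _ _ _ n (wrap-q^^ 2)) (≈⇒≐ λ N → ∏-cong n λ i →
                                                 ≐⇒≈ (≐-trans (+-congˡ-≐ (-‿cong-≐ (*-cong-≐ {series (⊝ Defs.q)} { - q} (pointwise λ _ → refl) ≐-refl)))
                                                 (solve 2 (λ x y → :1 :- (:- x) :* y := :1 :+ x :* y) ≐-refl q ((q ^ 2) ^ i))))) ⟨
        num                                 ≈⟨ solve 1 (λ x → x := x :* :1) ≐-refl num ⟩
        num * 1ˢ                        ≈⟨ *-congˡ-≐ (*-inverse {dn} (unit (poch-constant Defs.q _ n refl))) ⟨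
        num * (dn * inv dn)                 ≈⟨ solve 3 (λ x y z → x :* (y :* z) := y :* (x :* z)) ≐-refl num dn (inv dn) ⟩
        dn * (num * inv dn)                 ≈⟨ *-cong-≐ (≐-trans (wrap-poch _ _ _ n (wrap-q^^ 2)) (≈⇒≐ λ N → ∏-cong n λ i →
                                                 ≐⇒≈ (+-congˡ-≐ (-‿cong-≐ (*-cong-≐ {series Defs.q} {q} (pointwise λ _ → refl) ≐-refl)))))
                                                 (pointwise λ _ → refl) ⟩
        P⁻ n * series (v₀-term n)           ∎))
        where
        open ≐-Reasoning
        num = series (Defs.q ^^ (n ℕ.* n)) * series (poch (⊝ Defs.q) (Defs.q ^^ 2) n)
        dn = series (poch Defs.q (Defs.q ^^ 2) n)

      -- Q = q² is fixed by q ↦ -q, so only c changes sign; the half of S belonging to ac is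
      -- therefore V(-q).
      t-flip : ∀ n → flip (t q n) ≐ t (con -1ℤ * q) n
      t-flip zero    = Flip.con-homo 1ℤ
      t-flip (suc n) = ≐-trans (Flip.*-homo _ _)
        (*-cong-≐ (≐-trans (Flip.*-homo _ _) (*-cong-≐ (t-flip n) flip-mid)) flip-inv)
        where
        open ≐-Reasoning
        Qn = (q ^ 2) ^ n
        flip-q : flip q ≐ con -1ℤ * q
        flip-q = ≐-trans Flip.q-homo (solve 1 (λ q → q :* (:- :1) := :con -1ℤ :* q) ≐-refl q)
        flip-q² : flip (q ^ 2) ≐ q ^ 2
        flip-q² = ≐-trans (Flip.^-homo 2 q) (≐-trans (^-cong-≐ 2 flip-q) (solve 1 (λ q → (:con -1ℤ :* q) :^ 2 := q :^ 2) ≐-refl q))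
        flip-Qn : flip Qn ≐ Qn
        flip-Qn = ≐-trans (Flip.^-homo n (q ^ 2)) (^-cong-≐ n flip-q²)
        flip-mid : flip (Qn * (q - con -1ℤ * (q ^ 2 * Qn))) ≐ Qn * (con -1ℤ * q - con -1ℤ * (q ^ 2 * Qn))
        flip-mid = ≐-trans (Flip.*-homo _ _) (*-cong-≐ flip-Qn (≐-trans (Flip.minus-homo _ _)
          (+-cong-≐ flip-q (-‿cong-≐ (≐-trans (Flip.*-homo _ _) (*-cong-≐ (Flip.con-homo -1ℤ)
            (≐-trans (Flip.*-homo _ _) (*-cong-≐ flip-q² flip-Qn))))))))
        flip-den : flip (den q n) ≐ den (con -1ℤ * q) n
        flip-den = ≐-trans (Flip.minus-homo _ _) (+-cong-≐ (Flip.con-homo 1ℤ) (-‿cong-≐ (≐-trans (Flip.*-homo _ _) (*-cong-≐ flip-q flip-Qn))))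
        flip-inv : flip (inv (den q n)) ≐ inv (den (con -1ℤ * q) n)
        flip-inv = ≈⇒≐ λ N → *-cancelˡ (unit-den {con -1ℤ * q} refl n) (≐⇒≈ (begin
          den (con -1ℤ * q) n * flip (inv (den q n))  ≈⟨ *-cong-≐ flip-den ≐-refl ⟨
          flip (den q n) * flip (inv (den q n))       ≈⟨ Flip.*-homo _ _ ⟨
          flip (den q n * inv (den q n))              ≈⟨ Flip.cong-≐ (*-inverse (unit-den {q} refl n)) ⟩
          flip 1ˢ                               ≈⟨ Flip.con-homo 1ℤ ⟩
          1ˢ                                      ≈⟨ *-inverse (unit-den {con -1ℤ * q} refl n) ⟨
          den (con -1ℤ * q) n * inv (den (con -1ℤ * q) n) ∎))

    V : Series
    V = ∑∞ (t q)

    V-at : ∀ m → at V m ≡ v₀ m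
    V-at m = trans (∑∞-at (t q) m) (Σ<-cong (suc m) λ n _ → coeff= (t≐v₀-term n) m)

    V-even : Series
    V-even = V + flip V - 1ˢ

    private
      S-V : N ≤ K → V-even ≈[ k , N ] S K q
      S-V {N} {K} {k} N≤K = +-cong T-V (≈-trans (Flip.cong-≈ T-V) (≐⇒≈ flip-T)) -cong ≈-refl
        where
        T-V : V ≈[ k , N ] T K q
        T-V = ∑∞-≈ (λ n → t-order refl n) N≤K
        flip-T : flip (T K q) ≐ T K (con -1ℤ * q)
        flip-T = ≐-trans (Flip.+-homo _ _) (+-cong-≐ (Flip.con-homo 1ℤ)
          (≐-trans (Flip.∑-homo K _) (≈⇒≐ λ N → ∑-cong K λ n → ≐⇒≈ (t-flip (suc n)))))

    dilate-odd : ∀ i → dilate 2 (odd i) ≐ odd i * odd i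
    dilate-odd i = begin
      dilate 2 (q * (q ^ 2) ^ i)          ≈⟨ Dilate.*-homo 1 _ _ ⟩
      dilate 2 q * dilate 2 ((q ^ 2) ^ i) ≈⟨ *-cong-≐ (Dilate.q-homo 1) (≐-trans (Dilate.^-homo 1 i (q ^ 2)) (^-cong-≐ i (Dilate.q^-homo 1 2))) ⟩
      q * q ^ 1 * ((q * q ^ 1) ^ 2) ^ i   ≈⟨ *-congˡ-≐ (^-cong-≐ i (solve 1 (λ q → (q :* q :^ 1) :^ 2 := q :^ 2 :* q :^ 2) ≐-refl q)) ⟩
      q * q ^ 1 * (q ^ 2 * q ^ 2) ^ i     ≈⟨ *-congˡ-≐ (^-distrib-* (q ^ 2) (q ^ 2) i) ⟩
      q * q ^ 1 * ((q ^ 2) ^ i * (q ^ 2) ^ i) ≈⟨ solve 2 (λ q x → q :* q :^ 1 :* (x :* x) := q :* x :* (q :* x)) ≐-refl q ((q ^ 2) ^ i) ⟩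
      odd i * odd i ∎
      where open ≐-Reasoning

    -- For a = -1 the factors are A = 1 - c² and B = 1 + c²; at c = q^(2i+1) they are the factors of
    -- `P⁻` and `P⁺` at q².
    V-even-product : N ≤ K → dilate 2 (P⁻ K) * V-even ≈[ k , N ] dilate 2 (P⁺ K) * dilate 2 φ
    V-even-product {N} {K} {k} N≤K = begin
      dilate 2 (P⁻ K) * V-even ≈⟨ *-cong (≐⇒≈ (≐-trans (Dilate.∏-homo 1 K _) (≈⇒≐ λ N → ∏-cong K λ i → ≐⇒≈ (factor⁻ i)))) (S-V N≤K) ⟩
      ∏ K (λ i → A (odd i)) * S K q ≈⟨ S-product refl N≤K ⟩
      ∏ K (λ i → B (odd i)) * S K 0ˢ ≈⟨ *-cong (≐⇒≈ (≐-trans (Dilate.∏-homo 1 K _) (≈⇒≐ λ N → ∏-cong K λ i → ≐⇒≈ (factor⁺ i)))) (≈-sym (S-zero N≤K)) ⟨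
      dilate 2 (P⁺ K) * dilate 2 φ ∎
      where
      open ≈-Reasoning
      factor⁻ : ∀ i → dilate 2 (1ˢ - odd i) ≐ A (odd i)
      factor⁻ i = ≐-trans (Dilate.minus-homo 1 _ _) (≐-trans (+-cong-≐ (Dilate.con-homo 1 1ℤ) (-‿cong-≐ (dilate-odd i)))
        (solve 1 (λ x → :1 :- x :* x := (:1 :- x) :* (:1 :- :con -1ℤ :* x)) ≐-refl (odd i)))
      factor⁺ : ∀ i → dilate 2 (1ˢ + odd i) ≐ B (odd i)
      factor⁺ i = ≐-trans (Dilate.+-homo 1 _ _) (≐-trans (+-cong-≐ (Dilate.con-homo 1 1ℤ) (dilate-odd i))
        (solve 1 (λ x → :1 :+ x :* x := :1 :- :con -1ℤ :* x :* x) ≐-refl (odd i)))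

  -- At q² the identity `φ-odd-product` evaluates the quotient of `P⁺` by `P⁻` as φ_2/φ⁻_4, which
  -- removes the remaining product.
  V-even-θ : V-even * dilate 2 (dilate 2 φ⁻) ≐ dilate 2 (φ * φ)
  V-even-θ = ≈⇒≐ λ N → *-cancelˡ (unit-dilate 1 (unit-P⁻ N)) (begin
    p⁻ N * (V-even * φ⁻₄)        ≈⟨ ≐⇒≈ (≐-sym (*-assoc-≐ _ _ _)) ⟩
    p⁻ N * V-even * φ⁻₄          ≈⟨ *-congʳ (V-even-product ℕ.≤-refl) ⟩
    p⁺ N * dilate 2 φ * φ⁻₄      ≈⟨ ≐⇒≈ (solve 3 (λ x y z → x :* y :* z := x :* z :* y) ≐-refl (p⁺ N) (dilate 2 φ) φ⁻₄) ⟩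
    p⁺ N * φ⁻₄ * dilate 2 φ      ≈⟨ *-congʳ (≐⇒≈ (Dilate.*-homo 1 _ _)) ⟨
    dilate 2 (P⁺ N * dilate 2 φ⁻) * dilate 2 φ ≈⟨ *-congʳ (Dilate.cong-≈ 1 (φ-odd-product ℕ.≤-refl)) ⟨
    dilate 2 (P⁻ N * φ) * dilate 2 φ ≈⟨ *-congʳ (≐⇒≈ (Dilate.*-homo 1 _ _)) ⟩
    p⁻ N * dilate 2 φ * dilate 2 φ ≈⟨ ≐⇒≈ (*-assoc-≐ _ _ _) ⟩
    p⁻ N * (dilate 2 φ * dilate 2 φ) ≈⟨ *-congˡ (≐⇒≈ (Dilate.*-homo 1 _ _)) ⟨
    p⁻ N * dilate 2 (φ * φ) ∎)
    where
    open ≈-Reasoning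
    φ⁻₄ = dilate 2 (dilate 2 φ⁻)
    p⁻ p⁺ : ℕ → Series
    p⁻ N = dilate 2 (P⁻ N)
    p⁺ N = dilate 2 (P⁺ N)

-- Dissections and quadratic identities of φ, φ⁻ and ψ

module ThetaDissections where
  open MockTheta public
  open import Data.Nat.DivMod using ()

  private variable
    f g : Series
    k : ℤ
    K N : ℕ

  ∑-append : ∀ m n F → ∑ (m ℕ.+ n) F ≐ ∑ m F + ∑ n (λ i → F (m ℕ.+ i))
  ∑-append m zero F rewrite ℕ.+-identityʳ m = solve 1 (λ x → x := x :+ :0) ≐-refl (∑ m F)
  ∑-append m (suc n) F rewrite ℕ.+-suc m n = ≐-trans (+-cong-≐ (∑-append m n F) ≐-refl)
    (solve 3 (λ x y z → x :+ y :+ z := x :+ (y :+ z)) ≐-refl (∑ m F) (∑ n (λ i → F (m ℕ.+ i))) (F (m ℕ.+ n)))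

  ∑-block : ∀ d n F → ∑ (n ℕ.* d) F ≐ ∑ n (λ j → ∑ d (λ r → F (j ℕ.* d ℕ.+ r)))
  ∑-block d zero    F = ≐-refl
  ∑-block d (suc n) F rewrite ℕ.+-comm d (n ℕ.* d) = ≐-trans (∑-append (n ℕ.* d) d F) (+-cong-≐ (∑-block d n F) ≐-refl)

  triangle : ℕ → ℕ
  triangle zero    = 0
  triangle (suc n) = suc n ℕ.+ triangle n

  triangle-double : ∀ n → triangle n ℕ.* 2 ≡ n ℕ.* suc n
  triangle-double zero    = refl
  triangle-double (suc n) = trans (ℕ.*-distribʳ-+ 2 (suc n) (triangle n))
    (trans (cong (λ e → suc n ℕ.* 2 ℕ.+ e) (triangle-double n)) (eq n))
    where
    eq : ∀ n → suc n ℕ.* 2 ℕ.+ n ℕ.* suc n ≡ suc n ℕ.* suc (suc n)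
    eq = ℕ.solve-∀

  ψ-term : ℕ → Series
  ψ-term n = q ^ triangle n

  ψ : Series
  ψ = ∑∞ ψ-term

  ψ-order : ∀ n → ψ-term n ≈[ k , n ] 0ˢ
  ψ-order n = ≈-weaken (n≤ n) (order-q^ (triangle n))
    where
    n≤ : ∀ n → n ≤ triangle n
    n≤ zero    = z≤n
    n≤ (suc n) = ℕ.m≤m+n (suc n) (triangle n)

  ∑∞-dilate : ∀ j {F} → (∀ n → F n ≈[ 0ℤ , n ] 0ˢ) → N ≤ K →
              dilate (suc j) (∑∞ F) ≈[ k , N ] ∑ K (λ n → dilate (suc j) (F n))
  ∑∞-dilate {K = K} j {F} ord N≤K = ≈-trans (Dilate.cong-≈ j (∑∞-≈∑ ord N≤K)) (≐⇒≈ (Dilate.∑-homo j K F))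

  -- Even n give (2j)² = 4j², odd n give (2j + 1)² = 8T_j + 1 with T_j triangular; s^n is 1 on the
  -- former and s on the latter.
  θ-2-dissection : ∀ s → s ℤ.* s ≡ 1ℤ → θ s ≐ dilate 4 φ + con (+ 2 ℤ.* s) * q * dilate 8 ψ
  θ-2-dissection s s² = ≈⇒≐ λ N → begin
    con (+ 2) * ∑∞ (θ-term s) - 1ˢ
      ≈⟨ *-congˡ (halves N) -cong ≈-refl ⟩
    con (+ 2) * (dilate 4 (∑∞ (θ-term 1ℤ)) + con s * q * dilate 8 ψ) - 1ˢ
      ≈⟨ ≐⇒≈ (≐-trans (solve 4 (λ x s q y → :con (+ 2) :* (x :+ s :* q :* y) :- :1 := :con (+ 2) :* x :- :1 :+ :con (+ 2) :* s :* q :* y)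
          ≐-refl (dilate 4 (∑∞ (θ-term 1ℤ))) (con s) q (dilate 8 ψ))
           (+-cong-≐ (≐-sym outer) (*-cong-≐ (*-cong-≐ (≐-sym (con*con (+ 2) s)) ≐-refl) ≐-refl))) ⟩
    dilate 4 φ + con (+ 2 ℤ.* s) * q * dilate 8 ψ ∎
    where
    open ≈-Reasoning
    outer : dilate 4 φ ≐ con (+ 2) * dilate 4 (∑∞ (θ-term 1ℤ)) - 1ˢ
    outer = ≐-trans (Dilate.minus-homo 3 _ _) (+-cong-≐ (≐-trans (Dilate.*-homo 3 _ _) (*-cong-≐ (Dilate.con-homo 3 (+ 2)) ≐-refl))
      (-‿cong-≐ (Dilate.con-homo 3 1ℤ)))
    s^2 : con s ^ 2 ≐ 1ˢ
    s^2 = ≐-trans (solve 1 (λ x → x :^ 2 := x :* x)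
        ≐-refl (con s)) (≐-trans (≐-sym (con*con s s)) (subst (λ z → con z ≐ 1ˢ) (sym s²) ≐-refl))
    s^even : ∀ j → con s ^ (j ℕ.* 2) ≐ 1ˢ ^ j
    s^even j = ≐-trans (^-* (con s) j 2) (^-cong-≐ j s^2)
    even : ∀ j → θ-term s (j ℕ.* 2 ℕ.+ 0) ≐ dilate 4 (θ-term 1ℤ j)
    even j = ≐-trans (*-cong-≐ e1 e2) (≐-sym (Dilate.*-homo 3 _ _))
      where
      e1 : con s ^ (j ℕ.* 2 ℕ.+ 0) ≐ dilate 4 (1ˢ ^ j)
      e1 = subst (λ e → con s ^ e ≐ dilate 4 (1ˢ ^ j)) (sym (ℕ.+-identityʳ (j ℕ.* 2)))
        (≐-trans (s^even j) (≐-sym (≐-trans (Dilate.^-homo 3 j _) (^-cong-≐ j (Dilate.con-homo 3 1ℤ)))))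
      e2 : q ^ ((j ℕ.* 2 ℕ.+ 0) ℕ.* (j ℕ.* 2 ℕ.+ 0)) ≐ dilate 4 (q ^ (j ℕ.* j))
      e2 = ≐-sym (subst (λ e → dilate 4 (q ^ (j ℕ.* j)) ≐ q ^ e) (eq j) (dilate-q^ 3 (j ℕ.* j)))
        where eq : ∀ j → j ℕ.* j ℕ.* 4 ≡ (j ℕ.* 2 ℕ.+ 0) ℕ.* (j ℕ.* 2 ℕ.+ 0)
              eq = ℕ.solve-∀
    odds : ∀ j → θ-term s (j ℕ.* 2 ℕ.+ 1) ≐ con s * q * dilate 8 (ψ-term j)
    odds j = ≐-trans (*-cong-≐ o1 o2) (solve 3 (λ s q x → s :* (q :* x) := s :* q :* x) ≐-refl (con s) q _)
      where
      one^ : ∀ j → 1ˢ ^ j ≐ 1ˢ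
      one^ zero    = ≐-refl
      one^ (suc j) = ≐-trans (*-congˡ-≐ (one^ j)) (solve 0 (:1 :* :1 := :1) ≐-refl)
      o1 : con s ^ (j ℕ.* 2 ℕ.+ 1) ≐ con s
      o1 = ≐-trans (^-+ (con s) (j ℕ.* 2) 1) (≐-trans (*-cong-≐ (≐-trans (s^even j) (one^ j)) ≐-refl)
        (solve 1 (λ s → :1 :* s :^ 1 := s) ≐-refl (con s)))
      o2 : q ^ ((j ℕ.* 2 ℕ.+ 1) ℕ.* (j ℕ.* 2 ℕ.+ 1)) ≐ q * dilate 8 (ψ-term j)
      o2 = ≐-sym (subst (λ e → q * dilate 8 (ψ-term j) ≐ q ^ e) (trans (cong suc (trans (eq₁ (triangle j)) (cong (ℕ._* 4) (triangle-double j)))) (eq₂ j))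
             (*-congˡ-≐ {f′ = q} (dilate-q^ 7 (triangle j))))
        where eq₁ : ∀ t → t ℕ.* 8 ≡ t ℕ.* 2 ℕ.* 4
              eq₁ = ℕ.solve-∀
              eq₂ : ∀ j → suc (j ℕ.* suc j ℕ.* 4) ≡ (j ℕ.* 2 ℕ.+ 1) ℕ.* (j ℕ.* 2 ℕ.+ 1)
              eq₂ = ℕ.solve-∀
    halves : ∀ N → ∑∞ (θ-term s) ≈[ 0ℤ , N ] dilate 4 (∑∞ (θ-term 1ℤ)) + con s * q * dilate 8 ψ
    halves N = begin
      ∑∞ (θ-term s)                              ≈⟨ ∑∞-≈∑ (θ-order s) (ℕ.m≤m*n N 2) ⟩
      ∑ (N ℕ.* 2) (θ-term s)                     ≈⟨ ≐⇒≈ (∑-block 2 N (θ-term s)) ⟩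
      ∑ N (λ j → 0ˢ + θ-term s (j ℕ.* 2 ℕ.+ 0) + θ-term s (j ℕ.* 2 ℕ.+ 1))
        ≈⟨ ∑-cong N (λ j → ≐⇒≈ (+-cong-≐ (≐-trans (+-identityˡ-≐ _) (even j)) (odds j))) ⟩
      ∑ N (λ j → dilate 4 (θ-term 1ℤ j) + con s * q * dilate 8 (ψ-term j))
        ≈⟨ ∑-distrib-+ N _ _ ⟩
      ∑ N (λ j → dilate 4 (θ-term 1ℤ j)) + ∑ N (λ j → con s * q * dilate 8 (ψ-term j))
        ≈⟨ +-cong (∑∞-dilate 3 (θ-order 1ℤ) ℕ.≤-refl) (≈-trans (*-congˡ (∑∞-dilate 7 ψ-order ℕ.≤-refl)) (∑-*ˡ N _ _)) ⟨
      dilate 4 (∑∞ (θ-term 1ℤ)) + con s * q * dilate 8 ψ ∎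

  private
    a b : Series
    a = dilate 4 φ
    b = con (+ 2) * q * dilate 8 ψ

  φ-dissection : φ ≐ a + b
  φ-dissection = θ-2-dissection 1ℤ refl

  φ⁻-dissection : φ⁻ ≐ a - b
  φ⁻-dissection = ≐-trans (θ-2-dissection -1ℤ refl) (≐-trans (+-congˡ-≐ (*-cong-≐ (*-cong-≐ (≐-sym (con-neg (+ 2))) ≐-refl) ≐-refl))
    (solve 3 (λ a q x → a :+ (:- :con (+ 2)) :* q :* x := a :- :con (+ 2) :* q :* x) ≐-refl a q (dilate 8 ψ)))

  flip-dilate₄ : ∀ f → flip (dilate 4 f) ≐ dilate 4 f
  flip-dilate₄ f = ≐-trans (Flip.cong-≐ (≐-sym (dilate-∘ 1 1 f))) (≐-trans (flip-dilate₂ (dilate 2 f)) (dilate-∘ 1 1 f))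

  flip-dilate₈ : ∀ f → flip (dilate 8 f) ≐ dilate 8 f
  flip-dilate₈ f = ≐-trans (Flip.cong-≐ (≐-sym (dilate-∘ 1 3 f))) (≐-trans (flip-dilate₂ (dilate 4 f)) (dilate-∘ 1 3 f))

  flip-φ : flip φ ≐ φ⁻
  flip-φ = begin
    flip φ            ≈⟨ Flip.cong-≐ φ-dissection ⟩
    flip (a + b)      ≈⟨ Flip.+-homo a b ⟩
    flip a + flip b   ≈⟨ +-cong-≐ (flip-dilate₄ φ) (≐-trans (Flip.*-homo _ _) (*-cong-≐ (≐-trans (Flip.*-homo _ _) (*-cong-≐ (Flip.con-homo _) Flip.q-homo)) (flip-dilate₈ ψ))) ⟩
    a + con (+ 2) * (q * - 1ˢ) * dilate 8 ψ
                      ≈⟨ solve 3 (λ a q x → a :+ :con (+ 2) :* (q :* (:- :1)) :* x := a :- :con (+ 2) :* q :* x) ≐-refl a q (dilate 8 ψ) ⟩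
    a - b             ≈⟨ φ⁻-dissection ⟨
    φ⁻ ∎
    where open ≐-Reasoning

  -- The product of `φ-odd-product` with its image under q ↦ -q, which exchanges `P⁻` and `P⁺` and
  -- fixes the dilated factor.
  φφ⁻ : φ * φ⁻ ≐ dilate 2 (φ⁻ * φ⁻)
  φφ⁻ = ≈⇒≐ λ N → *-cancelˡ (unit-* (unit-P⁻ N) (unit-P⁺ N)) (begin
    P⁻ N * P⁺ N * (φ * φ⁻)           ≈⟨ ≐⇒≈ (solve 4 (λ x y z w → x :* y :* (z :* w) := (x :* z) :* (y :* w)) ≐-refl (P⁻ N) (P⁺ N) φ φ⁻) ⟩
    P⁻ N * φ * (P⁺ N * φ⁻)           ≈⟨ *-cong (φ-odd-product ℕ.≤-refl) (flipped N) ⟩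
    P⁺ N * φ⁻₂ * (P⁻ N * φ⁻₂)        ≈⟨ ≐⇒≈ (solve 3 (λ x y z → x :* z :* (y :* z) := y :* x :* (z :* z)) ≐-refl (P⁺ N) (P⁻ N) φ⁻₂) ⟩
    P⁻ N * P⁺ N * (φ⁻₂ * φ⁻₂)        ≈⟨ *-congˡ (≐⇒≈ (Dilate.*-homo 1 φ⁻ φ⁻)) ⟨
    P⁻ N * P⁺ N * dilate 2 (φ⁻ * φ⁻) ∎)
    where
    open ≈-Reasoning
    φ⁻₂ = dilate 2 φ⁻
    flip-odd : ∀ i → flip (odd i) ≐ - odd i
    flip-odd i = ≐-trans (Flip.*-homo q _) (≐-trans (*-cong-≐ Flip.q-homo (≐-trans (Flip.^-homo i _) (^-cong-≐ i (≐-trans (Flip.q^-homo 2)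
      (solve 1 (λ q → (q :* (:- :1)) :^ 2 := q :^ 2) ≐-refl q)))))
      (solve 2 (λ q x → q :* (:- :1) :* x := :- (q :* x)) ≐-refl q ((q ^ 2) ^ i)))
    flip-P⁻ : ∀ K → flip (P⁻ K) ≐ P⁺ K
    flip-P⁻ K = ≐-trans (Flip.∏-homo K _) (≈⇒≐ λ N → ∏-cong K λ i → ≐⇒≈ (≐-trans (Flip.minus-homo _ _)
      (≐-trans (+-cong-≐ (Flip.con-homo 1ℤ) (-‿cong-≐ (flip-odd i))) (solve 1 (λ x → :1 :- (:- x) := :1 :+ x) ≐-refl (odd i)))))
    flip-P⁺ : ∀ K → flip (P⁺ K) ≐ P⁻ K
    flip-P⁺ K = ≐-trans (Flip.∏-homo K _) (≈⇒≐ λ N → ∏-cong K λ i → ≐⇒≈ (≐-trans (Flip.+-homo _ _)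
      (+-cong-≐ (Flip.con-homo 1ℤ) (flip-odd i))))
    flipped : ∀ N → P⁺ N * φ⁻ ≈[ 0ℤ , N ] P⁻ N * φ⁻₂
    flipped N = begin
      P⁺ N * φ⁻                 ≈⟨ ≐⇒≈ (*-cong-≐ (flip-P⁻ N) flip-φ) ⟨
      flip (P⁻ N) * flip φ      ≈⟨ ≐⇒≈ (Flip.*-homo _ _) ⟨
      flip (P⁻ N * φ)           ≈⟨ Flip.cong-≈ (φ-odd-product ℕ.≤-refl) ⟩
      flip (P⁺ N * φ⁻₂)         ≈⟨ ≐⇒≈ (Flip.*-homo _ _) ⟩
      flip (P⁺ N) * flip φ⁻₂    ≈⟨ ≐⇒≈ (*-cong-≐ (flip-P⁺ N) (flip-dilate₂ φ⁻)) ⟩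
      P⁻ N * φ⁻₂                ∎

  ψ₄² : Series
  ψ₄² = dilate 4 (ψ * ψ)

  -- At q² the right side becomes a² - b² = (a + b)(a - b) = φ φ⁻, so the identity is proved there
  -- and pulled back by `dilate-injective`.
  φ⁻² : φ⁻ * φ⁻ ≐ dilate 2 (φ * φ) - con (+ 4) * q * ψ₄²
  φ⁻² = ≐-sym (dilate-injective 2 (begin
    dilate 2 (dilate 2 (φ * φ) - con (+ 4) * q * ψ₄²)
      ≈⟨ ≐-trans (Dilate.minus-homo 1 _ _) (+-cong-≐ (dilate-∘ 1 1 _) (-‿cong-≐ (≐-trans (Dilate.*-homo 1 _ _) (*-cong-≐ (≐-trans (Dilate.*-homo 1 _ _)
           (*-cong-≐ (Dilate.con-homo 1 (+ 4)) (Dilate.q-homo 1))) (dilate-∘ 1 3 _))))) ⟩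
    dilate 4 (φ * φ) - con (+ 4) * (q * q ^ 1) * dilate 8 (ψ * ψ)
      ≈⟨ +-cong-≐ (Dilate.*-homo 3 φ φ) (-‿cong-≐ (*-congˡ-≐ (Dilate.*-homo 7 ψ ψ))) ⟩
    a * a - con (+ 4) * (q * q ^ 1) * (dilate 8 ψ * dilate 8 ψ)
      ≈⟨ solve 3 (λ a q x → a :* a :- :con (+ 4) :* (q :* q :^ 1) :* (x :* x) := (a :+ :con (+ 2) :* q :* x) :* (a :- :con (+ 2) :* q :* x))
          ≐-refl a q (dilate 8 ψ) ⟩
    (a + b) * (a - b) ≈⟨ *-cong-≐ φ-dissection φ⁻-dissection ⟨
    φ * φ⁻            ≈⟨ φφ⁻ ⟩
    dilate 2 (φ⁻ * φ⁻) ∎))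
    where open ≐-Reasoning

  φ² : φ * φ ≐ dilate 2 (φ * φ) + con (+ 4) * q * ψ₄²
  φ² = begin
    φ * φ                 ≈⟨ flip-flip (φ * φ) ⟨
    flip (flip (φ * φ))   ≈⟨ Flip.cong-≐ (≐-trans (Flip.*-homo φ φ) (*-cong-≐ flip-φ flip-φ)) ⟩
    flip (φ⁻ * φ⁻)        ≈⟨ Flip.cong-≐ φ⁻² ⟩
    flip (dilate 2 (φ * φ) - con (+ 4) * q * ψ₄²)
      ≈⟨ ≐-trans (Flip.minus-homo _ _) (+-cong-≐ (flip-dilate₂ _) (-‿cong-≐ (≐-trans (Flip.*-homo _ _)
           (*-cong-≐ (≐-trans (Flip.*-homo _ _) (*-cong-≐ (Flip.con-homo _) Flip.q-homo)) (flip-dilate₄ _))))) ⟩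
    dilate 2 (φ * φ) - con (+ 4) * (q * - 1ˢ) * ψ₄²
      ≈⟨ solve 3 (λ x q y → x :- :con (+ 4) :* (q :* (:- :1)) :* y := x :+ :con (+ 4) :* q :* y) ≐-refl (dilate 2 (φ * φ)) q ψ₄² ⟩
    dilate 2 (φ * φ) + con (+ 4) * q * ψ₄² ∎
    where open ≐-Reasoning

  q*-cancel : q * f ≐ q * g → f ≐ g
  q*-cancel {f} {g} p = pointwise λ m → trans (sym (q*-suc f m)) (trans (coeff= p (suc m)) (q*-suc g m))

  con*-cancel : ∀ c .{{_ : ℤ.NonZero c}} → con c * f ≐ con c * g → f ≐ g
  con*-cancel {f} {g} c p = pointwise λ m → ℤ.*-cancelˡ-≡ c (at f m) (at g m)
    (trans (sym (con-* c f m)) (trans (coeff= p m) (con-* c g m)))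

  -- The difference φ² - (φ⁻)² is computed twice: as 8qψ_4² from the formulas for the squares, and
  -- as 4ab = 8qφ_4ψ_8 from the dissections.
  ψ² : ψ * ψ ≐ φ * dilate 2 ψ
  ψ² = dilate-injective 4 (q*-cancel (con*-cancel (+ 8) (begin
    con (+ 8) * (q * ψ₄²)
      ≈⟨ solve 3 (λ x q y → :con (+ 8) :* (q :* y) := (x :+ :con (+ 4) :* q :* y) :- (x :- :con (+ 4) :* q :* y))
          ≐-refl (dilate 2 (φ * φ)) q ψ₄² ⟩
    (dilate 2 (φ * φ) + con (+ 4) * q * ψ₄²) - (dilate 2 (φ * φ) - con (+ 4) * q * ψ₄²)
      ≈⟨ +-cong-≐ φ² (-‿cong-≐ φ⁻²) ⟨
    φ * φ - φ⁻ * φ⁻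
      ≈⟨ +-cong-≐ (*-cong-≐ φ-dissection φ-dissection) (-‿cong-≐ (*-cong-≐ φ⁻-dissection φ⁻-dissection)) ⟩
    (a + b) * (a + b) - (a - b) * (a - b)
      ≈⟨ solve 3 (λ a q x → let b = :con (+ 2) :* q :* x in (a :+ b) :* (a :+ b) :- (a :- b) :* (a :- b) := :con (+ 8) :* (q :* (a :* x)))
          ≐-refl a q (dilate 8 ψ) ⟩
    con (+ 8) * (q * (a * dilate 8 ψ))
      ≈⟨ *-congˡ-≐ (*-congˡ-≐ (≐-trans (Dilate.*-homo 3 _ _) (*-congˡ-≐ (dilate-∘ 3 1 ψ)))) ⟨
    con (+ 8) * (q * dilate 4 (φ * dilate 2 ψ)) ∎)))
    where open ≐-Reasoning

-- Extraction of the coefficients with index 4(8n + 1)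

module Coefficients where
  open ThetaDissections public
  open import Data.Nat.DivMod using (_%_; _/_; [m+kn]%n≡m%n; %-distribˡ-+)

  private variable
    f g : Series
    N : ℕ

  unit-φ⁻ : Unit φ⁻
  unit-φ⁻ = unit refl

  -- Summands living in a wrong residue class are dropped by support instead of being computed. The
  -- class is given by an unreduced representative `r`, so that classes simply add in products.
  record Supported (d : ℕ) .{{_ : NonZero d}} (r : ℕ) (f : Series) : Set where
    constructor supported
    field vanish : ∀ m → m % d ≢ r % d → at f m ≡ 0ℤ
  open Supported public

  module _ {d : ℕ} .{{_ : NonZero d}} where

    supported-≐ : ∀ {r} → f ≐ g → Supported d r f → Supported d r g
    supported-≐ p s = supported λ m m≢r → trans (sym (coeff= p m)) (vanish s m m≢r)

    supported-mod : ∀ {r s} → r % d ≡ s % d → Supported d r f → Supported d s f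
    supported-mod e s = supported λ m m≢s → vanish s m λ m≡r → m≢s (trans m≡r e)

    supported-+ : ∀ {r} → Supported d r f → Supported d r g → Supported d r (f + g)
    supported-+ s t = supported λ m m≢r → cong₂ ℤ._+_ (vanish s m m≢r) (vanish t m m≢r)

    supported-* : ∀ {r s} → Supported d r f → Supported d s g → Supported d (r ℕ.+ s) (f * g)
    supported-* {f} {g} {r} {s} S T = supported λ m m≢r+s → Σ<-zero (suc m) λ { i (s≤s i≤m) → term m i i≤m m≢r+s }
      where
      term : ∀ m i → i ≤ m → m % d ≢ (r ℕ.+ s) % d → at f i ℤ.* at g (m ∸ i) ≡ 0ℤ
      term m i i≤m m≢r+s with i % d ℕ.≟ r % d
      ... | no i≢r = trans (cong (ℤ._* at g (m ∸ i)) (vanish S i i≢r)) (ℤ.*-zeroˡ (at g (m ∸ i)))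
      ... | yes i≡r = trans (cong (at f i ℤ.*_) (vanish T (m ∸ i) λ j≡s → m≢r+s (begin
        m % d                               ≡⟨ cong (_% d) (ℕ.m+[n∸m]≡n i≤m) ⟨
        (i ℕ.+ (m ∸ i)) % d                 ≡⟨ %-distribˡ-+ i (m ∸ i) d ⟩
        (i % d ℕ.+ (m ∸ i) % d) % d         ≡⟨ cong₂ (λ x y → (x ℕ.+ y) % d) i≡r j≡s ⟩
        (r % d ℕ.+ s % d) % d               ≡⟨ %-distribˡ-+ r s d ⟨
        (r ℕ.+ s) % d                       ∎))) (ℤ.*-zeroʳ (at f i))
        where open ≡-Reasoning

    supported-con : ∀ c → Supported d 0 (con c)
    supported-con c = supported λ { zero 0≢0 → contradiction refl 0≢0 ; (suc m) _ → refl }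

    supported-^ : ∀ {r} n → Supported d r f → Supported d (n ℕ.* r) (f ^ n)
    supported-^ zero    S = supported-con 1ℤ
    supported-^ (suc n) S = supported-* S (supported-^ n S)

    supported-q : Supported d 1 q
    supported-q = supported λ { zero _ → refl ; (suc zero) 1≢1 → contradiction refl 1≢1 ; (suc (suc m)) _ → refl }

  supported-dilate : ∀ j f → Supported (suc j) 0 (dilate (suc j) f)
  supported-dilate j f = supported λ m m≢0 → dilate-off (suc j) f m m≢0

  supported-dilate₈ : ∀ f → Supported 4 0 (dilate 8 f)
  supported-dilate₈ f = supported-≐ (dilate-∘ 3 1 f) (supported-dilate 3 (dilate 2 f))

  -- What remains after halving the exponents twice: its coefficient at m ≥ 1 is 2v₀(4m).
  R : Series
  R = φ * φ * inv φ⁻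

  private
    X Y : Series
    X = φ * φ * inv (dilate 2 φ⁻)
    Y = con (+ 4) * dilate 2 (ψ * ψ) * inv φ⁻

    V-even≐ : V-even ≐ dilate 2 X
    V-even≐ = ≈⇒≐ λ N → *-cancelˡ (unit-dilate 1 (unit-dilate 1 unit-φ⁻)) (≐⇒≈ (begin
      dilate 2 φ⁻₂ * V-even   ≈⟨ *-comm-≐ _ _ ⟩
      V-even * dilate 2 φ⁻₂   ≈⟨ V-even-θ ⟩
      dilate 2 (φ * φ)        ≈⟨ Dilate.cong-≐ 1 (≐-trans (*-congˡ-≐ (*-inverse (unit-dilate 1 unit-φ⁻))) (*-identityʳ-≐ (φ * φ))) ⟨
      dilate 2 (φ * φ * (φ⁻₂ * inv φ⁻₂)) ≈⟨ Dilate.cong-≐ 1 (solve 3 (λ x y z → x :* (y :* z) := y :* (x :* z))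
          ≐-refl (φ * φ) φ⁻₂ (inv φ⁻₂)) ⟩
      dilate 2 (φ⁻₂ * X)      ≈⟨ Dilate.*-homo 1 φ⁻₂ X ⟩
      dilate 2 φ⁻₂ * dilate 2 X ∎))
      where
      open ≐-Reasoning
      φ⁻₂ = dilate 2 φ⁻

    -- The denominator φ⁻_2 has only even exponents, so the two parities are those in the dissection
    -- of φ².
    X≐ : X ≐ dilate 2 R + q * dilate 2 Y
    X≐ = ≈⇒≐ λ N → *-cancelˡ (unit-dilate 1 unit-φ⁻) (≐⇒≈ (begin
      φ⁻₂ * (φ * φ * inv φ⁻₂) ≈⟨ solve 3 (λ x y z → y :* (x :* z) := x :* (y :* z)) ≐-refl (φ * φ) φ⁻₂ (inv φ⁻₂) ⟩
      φ * φ * (φ⁻₂ * inv φ⁻₂) ≈⟨ ≐-trans (*-congˡ-≐ (*-inverse (unit-dilate 1 unit-φ⁻))) (*-identityʳ-≐ (φ * φ)) ⟩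
      φ * φ                   ≈⟨ φ² ⟩
      dilate 2 (φ * φ) + con (+ 4) * q * ψ₄²
        ≈⟨ +-congˡ-≐ (≐-trans (solve 2 (λ q x → :con (+ 4) :* q :* x := q :* (:con (+ 4) :* x)) ≐-refl q ψ₄²)
             (*-congˡ-≐ (≐-trans (*-cong-≐ (≐-sym (Dilate.con-homo 1 (+ 4))) (≐-sym (dilate-∘ 1 1 (ψ * ψ)))) (≐-sym (Dilate.*-homo 1 _ _))))) ⟩
      dilate 2 (φ * φ) + q * dilate 2 (con (+ 4) * dilate 2 (ψ * ψ))
        ≈⟨ +-cong-≐ (Dilate.cong-≐ 1 (clear (φ * φ))) (*-congˡ-≐ (Dilate.cong-≐ 1 (clear (con (+ 4) * dilate 2 (ψ * ψ))))) ⟩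
      dilate 2 (φ⁻ * R) + q * dilate 2 (φ⁻ * Y)
        ≈⟨ +-cong-≐ (Dilate.*-homo 1 φ⁻ R) (*-congˡ-≐ (Dilate.*-homo 1 φ⁻ Y)) ⟩
      φ⁻₂ * dilate 2 R + q * (φ⁻₂ * dilate 2 Y)
        ≈⟨ solve 4 (λ x y z w → x :* y :+ z :* (x :* w) := x :* (y :+ z :* w)) ≐-refl φ⁻₂ (dilate 2 R) q (dilate 2 Y) ⟩
      φ⁻₂ * (dilate 2 R + q * dilate 2 Y) ∎))
      where
      open ≐-Reasoning
      φ⁻₂ = dilate 2 φ⁻
      clear : ∀ x → x ≐ φ⁻ * (x * inv φ⁻)
      clear x = ≐-trans (solve 1 (λ x → x := x :* :1) ≐-refl x) (≐-trans (*-congˡ-≐ (≐-sym (*-inverse unit-φ⁻)))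
        (solve 3 (λ x y z → x :* (y :* z) := y :* (x :* z)) ≐-refl x φ⁻ (inv φ⁻)))

  sgn-even : ∀ n → sgn (n ℕ.* 2) ≡ 1ℤ
  sgn-even zero    = refl
  sgn-even (suc n) = trans (ℤ.neg-involutive (sgn (n ℕ.* 2))) (sgn-even n)

  -- The index is a successor because the constant 1 subtracted in `V-even` would disturb exponent
  -- 0.
  v₀-4 : ∀ n → + 2 ℤ.* v₀ (suc n ℕ.* 2 ℕ.* 2) ≡ at R (suc n)
  v₀-4 n = begin
    + 2 ℤ.* v₀ (M ℕ.* 2)                              ≡⟨ cong (+ 2 ℤ.*_) (V-at (M ℕ.* 2)) ⟨
    + 2 ℤ.* at V (M ℕ.* 2)                            ≡⟨ eq (at V (M ℕ.* 2)) ⟩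
    at V (M ℕ.* 2) ℤ.+ 1ℤ ℤ.* at V (M ℕ.* 2) ℤ.- 0ℤ   ≡⟨ cong (λ e → at V (M ℕ.* 2) ℤ.+ e ℤ.* at V (M ℕ.* 2) ℤ.- 0ℤ) (sgn-even M) ⟨
    at V-even (M ℕ.* 2)                               ≡⟨ coeff= V-even≐ (M ℕ.* 2) ⟩
    at (dilate 2 X) (M ℕ.* 2)                         ≡⟨ dilate-at 2 X M ⟩
    at X M                                            ≡⟨ coeff= X≐ M ⟩
    at (dilate 2 R) M ℤ.+ at (q * dilate 2 Y) M       ≡⟨ cong₂ ℤ._+_ (dilate-at 2 R (suc n)) (vanish odd-part M even) ⟩
    at R (suc n) ℤ.+ 0ℤ                               ≡⟨ ℤ.+-identityʳ _ ⟩
    at R (suc n)                                      ∎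
    where
    open ≡-Reasoning
    M = suc n ℕ.* 2
    eq : ∀ x → + 2 ℤ.* x ≡ x ℤ.+ 1ℤ ℤ.* x ℤ.- 0ℤ
    eq = solve-∀
    odd-part : Supported 2 1 (q * dilate 2 Y)
    odd-part = supported-* supported-q (supported-dilate 1 Y)
    even : M % 2 ≢ 1
    even e = ℕ.1+n≢0 (trans (sym e) ([m+kn]%n≡m%n 0 (suc n) 2))

  W : Series
  W = q * ψ ^ 9 * inv φ⁻ ^ 8

  private
    -- `A` and `B` are the parts of a² = φ_4² with exponents 0 and 4 modulo 8, and `U` inverts
    -- (φ⁻_8)^8. In the numerator, `E₀`, `E₂`, `E₃` gather the classes 0, 2, 3 modulo 4 and `E₅` the
    -- class 5 modulo 8, none of which contains 8n + 1.
    a b A B U E₀ E₂ E₃ E₅ : Series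
    a = dilate 4 φ
    b = con (+ 2) * q * dilate 8 ψ
    A = dilate 8 (φ * φ)
    B = con (+ 4) * q ^ 4 * dilate 16 (ψ * ψ)
    U = dilate 8 (inv φ⁻ ^ 8)
    E₀ = a ^ 4 * (a * (a ^ 4 + con (+ 3) * b ^ 4))
    E₂ = a ^ 4 * (con (+ 4) * a ^ 3 * b ^ 2)
    E₃ = a ^ 4 * (con (+ 4) * a ^ 2 * b ^ 3)
    E₅ = con (+ 16) * b * (A * B) * (A ^ 2 + B ^ 2)

    supported-a : Supported 4 0 a
    supported-a = supported-dilate 3 φ
    supported-b : Supported 4 1 b
    supported-b = supported-* (supported-* (supported-con (+ 2)) supported-q) (supported-dilate₈ ψ)
    supported-b₈ : Supported 8 1 b
    supported-b₈ = supported-* (supported-* (supported-con (+ 2)) supported-q) (supported-dilate 7 ψ)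
    supported-A : Supported 8 0 A
    supported-A = supported-dilate 7 (φ * φ)
    supported-B : Supported 8 4 B
    supported-B = supported-* (supported-* (supported-con (+ 4)) (supported-^ 4 supported-q))
      (supported-≐ (dilate-∘ 7 1 (ψ * ψ)) (supported-dilate 7 (dilate 2 (ψ * ψ))))
    supported-U : Supported 4 0 U
    supported-U = supported-dilate₈ _

    supported-E₀ : Supported 4 0 E₀
    supported-E₀ = supported-* (supported-^ 4 supported-a) (supported-* supported-a
      (supported-+ (supported-^ 4 supported-a) (supported-mod refl (supported-* (supported-con (+ 3)) (supported-^ 4 supported-b)))))
    supported-E₂ : Supported 4 2 E₂
    supported-E₂ = supported-* (supported-^ 4 supported-a)
      (supported-* (supported-* (supported-con (+ 4)) (supported-^ 3 supported-a)) (supported-^ 2 supported-b))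
    supported-E₃ : Supported 4 3 E₃
    supported-E₃ = supported-* (supported-^ 4 supported-a)
      (supported-* (supported-* (supported-con (+ 4)) (supported-^ 2 supported-a)) (supported-^ 3 supported-b))
    supported-E₅ : Supported 8 5 E₅
    supported-E₅ = supported-* (supported-* (supported-* (supported-con (+ 16)) supported-b₈) (supported-* supported-A supported-B))
      (supported-+ (supported-^ 2 supported-A) (supported-mod refl (supported-^ 2 supported-B)))

    a²≐ : a * a ≐ A + B
    a²≐ = ≐-trans (≐-sym (Dilate.*-homo 3 φ φ)) (≐-trans (Dilate.cong-≐ 3 φ²) (≐-trans (Dilate.+-homo 3 _ _)
      (+-cong-≐ (dilate-∘ 3 1 _) (≐-trans (Dilate.*-homo 3 _ _) (*-cong-≐ (≐-trans (Dilate.*-homo 3 _ _) (*-cong-≐ (Dilate.con-homo 3 _) (Dilate.q-homo 3))) (dilate-∘ 3 3 _))))))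

    φ⁻₄² : dilate 4 (φ⁻ * φ⁻) ≐ A - B
    φ⁻₄² = ≐-trans (Dilate.cong-≐ 3 φ⁻²) (≐-trans (Dilate.minus-homo 3 _ _)
      (+-cong-≐ (dilate-∘ 3 1 _) (-‿cong-≐ (≐-trans (Dilate.*-homo 3 _ _) (*-cong-≐ (≐-trans (Dilate.*-homo 3 _ _) (*-cong-≐ (Dilate.con-homo 3 _) (Dilate.q-homo 3))) (dilate-∘ 3 3 _))))))

    a²+b² : dilate 2 φ * dilate 2 φ ≐ a * a + b * b
    a²+b² = ≐-trans (≐-sym (Dilate.*-homo 1 φ φ)) (≐-trans (Dilate.cong-≐ 1 φ²) (≐-trans (Dilate.+-homo 1 _ _)
      (+-cong-≐ (≐-trans (dilate-∘ 1 1 _) (Dilate.*-homo 3 φ φ))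
        (≐-trans (Dilate.*-homo 1 _ _) (≐-trans (*-cong-≐ (≐-trans (Dilate.*-homo 1 _ _) (*-cong-≐ (Dilate.con-homo 1 _) (Dilate.q-homo 1))) (≐-trans (dilate-∘ 1 3 _) (Dilate.*-homo 7 ψ ψ)))
          (solve 2 (λ q x → :con (+ 4) :* (q :* q :^ 1) :* (x :* x) := (:con (+ 2) :* q :* x) :* (:con (+ 2) :* q :* x))
              ≐-refl q (dilate 8 ψ)))))))

    b⁴ : b ^ 4 ≐ con (+ 4) * (A * B)
    b⁴ = begin
      b ^ 4
        ≈⟨ solve 2 (λ q x → (:con (+ 2) :* q :* x) :^ 4 := :con (+ 16) :* q :^ 4 :* ((x :* x) :* (x :* x))) ≐-refl q (dilate 8 ψ) ⟩
      con (+ 16) * q ^ 4 * (dilate 8 ψ * dilate 8 ψ * (dilate 8 ψ * dilate 8 ψ))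
        ≈⟨ *-congˡ-≐ (*-cong-≐ ψ₈² ψ₈²) ⟩
      con (+ 16) * q ^ 4 * (dilate 8 φ * dilate 16 ψ * (dilate 8 φ * dilate 16 ψ))
        ≈⟨ solve 3 (λ q x y → :con (+ 16) :* q :^ 4 :* (x :* y :* (x :* y)) := :con (+ 4) :* (x :* x :* (:con (+ 4) :* q :^ 4 :* (y :* y))))
            ≐-refl q (dilate 8 φ) (dilate 16 ψ) ⟩
      con (+ 4) * (dilate 8 φ * dilate 8 φ * (con (+ 4) * q ^ 4 * (dilate 16 ψ * dilate 16 ψ)))
        ≈⟨ *-congˡ-≐ (*-cong-≐ (Dilate.*-homo 7 φ φ) (*-congˡ-≐ (Dilate.*-homo 15 ψ ψ))) ⟨
      con (+ 4) * (A * B) ∎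
      where
      open ≐-Reasoning
      ψ₈² : dilate 8 ψ * dilate 8 ψ ≐ dilate 8 φ * dilate 16 ψ
      ψ₈² = ≐-trans (≐-sym (Dilate.*-homo 7 ψ ψ)) (≐-trans (Dilate.cong-≐ 7 ψ²) (≐-trans (Dilate.*-homo 7 _ _) (*-congˡ-≐ (dilate-∘ 7 1 ψ))))

    φ⁻₈ : Series
    φ⁻₈ = dilate 8 φ⁻

    φ⁻₈² : φ⁻₈ * φ⁻₈ ≐ a * dilate 4 φ⁻
    φ⁻₈² = ≐-trans (≐-sym (Dilate.*-homo 7 φ⁻ φ⁻)) (≐-trans (≐-sym (dilate-∘ 3 1 _)) (≐-trans (≐-sym (Dilate.cong-≐ 3 φφ⁻)) (Dilate.*-homo 3 φ φ⁻)))

    φ⁻₈⁴ : φ⁻₈ ^ 4 ≐ (A + B) * (A - B)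
    φ⁻₈⁴ = begin
      φ⁻₈ ^ 4                       ≈⟨ solve 1 (λ x → x :^ 4 := (x :* x) :* (x :* x)) ≐-refl φ⁻₈ ⟩
      φ⁻₈ * φ⁻₈ * (φ⁻₈ * φ⁻₈)       ≈⟨ *-cong-≐ φ⁻₈² φ⁻₈² ⟩
      a * dilate 4 φ⁻ * (a * dilate 4 φ⁻) ≈⟨ solve 2 (λ x y → x :* y :* (x :* y) := x :* x :* (y :* y)) ≐-refl a (dilate 4 φ⁻) ⟩
      a * a * (dilate 4 φ⁻ * dilate 4 φ⁻) ≈⟨ *-cong-≐ a²≐ (≐-trans (≐-sym (Dilate.*-homo 3 φ⁻ φ⁻)) φ⁻₄²) ⟩
      (A + B) * (A - B) ∎
      where open ≐-Reasoning

    -- The identity (φ⁻_2)² = φ φ⁻ is applied at q^4, q² and q in turn. Each use releases a factor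
    -- φ, until φ⁻ itself appears and can cancel the denominator of `R`.
    φ⁻₈⁸ : φ⁻₈ ^ 8 ≐ a ^ 4 * (dilate 2 φ * dilate 2 φ) * (φ * φ⁻)
    φ⁻₈⁸ = begin
      φ⁻₈ ^ 8                       ≈⟨ solve 1 (λ x → x :^ 8 := (x :* x) :^ 4) ≐-refl φ⁻₈ ⟩
      (φ⁻₈ * φ⁻₈) ^ 4               ≈⟨ ^-cong-≐ 4 φ⁻₈² ⟩
      (a * dilate 4 φ⁻) ^ 4         ≈⟨ solve 2 (λ x y → (x :* y) :^ 4 := x :^ 4 :* (y :* y) :^ 2) ≐-refl a (dilate 4 φ⁻) ⟩
      a ^ 4 * (dilate 4 φ⁻ * dilate 4 φ⁻) ^ 2
        ≈⟨ *-congˡ-≐ (^-cong-≐ 2 (≐-trans (≐-sym (Dilate.*-homo 3 φ⁻ φ⁻)) (≐-trans (≐-sym (dilate-∘ 1 1 _)) (≐-trans (≐-sym (Dilate.cong-≐ 1 φφ⁻)) (Dilate.*-homo 1 φ φ⁻))))) ⟩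
      a ^ 4 * (dilate 2 φ * dilate 2 φ⁻) ^ 2
        ≈⟨ solve 3 (λ x y z → x :* (y :* z) :^ 2 := x :* (y :* y) :* (z :* z)) ≐-refl (a ^ 4) (dilate 2 φ) (dilate 2 φ⁻) ⟩
      a ^ 4 * (dilate 2 φ * dilate 2 φ) * (dilate 2 φ⁻ * dilate 2 φ⁻)
        ≈⟨ *-congˡ-≐ (≐-trans (≐-sym (Dilate.*-homo 1 φ⁻ φ⁻)) (≐-sym φφ⁻)) ⟩
      a ^ 4 * (dilate 2 φ * dilate 2 φ) * (φ * φ⁻) ∎
      where open ≐-Reasoning

    φ⁻₈⁸*U : φ⁻₈ ^ 8 * U ≐ 1ˢ
    φ⁻₈⁸*U = ≐-trans (*-cong-≐ (≐-sym (Dilate.^-homo 7 8 φ⁻)) ≐-refl) (≐-trans (≐-sym (Dilate.*-homo 7 _ _))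
      (≐-trans (Dilate.cong-≐ 7 (≐-trans (≐-sym (^-distrib-* φ⁻ (inv φ⁻) 8)) (≐-trans (^-cong-≐ 8 (*-inverse unit-φ⁻)) (solve 0 (:1 :^ 8 := :1) ≐-refl))))
        (Dilate.con-homo 7 1ℤ)))

    numerator : φ⁻₈ ^ 8 * R ≐ con (+ 3) * b * φ⁻₈ ^ 8 + con (+ 2) * b ^ 9 + (E₀ + E₂ + E₃ + E₅)
    numerator = begin
      φ⁻₈ ^ 8 * R
        ≈⟨ *-cong-≐ φ⁻₈⁸ ≐-refl ⟩
      a ^ 4 * (dilate 2 φ * dilate 2 φ) * (φ * φ⁻) * (φ * φ * inv φ⁻)
        ≈⟨ solve 5 (λ a s f g i → a :* s :* (f :* g) :* (f :* f :* i) := f :^ 3 :* s :* a :* (g :* i))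
            ≐-refl (a ^ 4) (dilate 2 φ * dilate 2 φ) φ φ⁻ (inv φ⁻) ⟩
      φ ^ 3 * (dilate 2 φ * dilate 2 φ) * a ^ 4 * (φ⁻ * inv φ⁻)
        ≈⟨ *-cong-≐ (*-cong-≐ (*-cong-≐ (^-cong-≐ 3 φ-dissection) a²+b²) ≐-refl) (*-inverse unit-φ⁻) ⟩
      (a + b) ^ 3 * (a * a + b * b) * a ^ 4 * 1ˢ
        -- Sorted by the power of b modulo 4, which is also the exponent of q modulo 4.
        ≈⟨ solve 2 (λ a b → (a :+ b) :^ 3 :* (a :* a :+ b :* b) :* a :^ 4 :* :1 :=
             (:con (+ 3) :* b :* (a :* a) :^ 4 :+ b :* b :^ 4 :* (a :* a) :^ 2) :+
             (a :^ 4 :* (a :* (a :^ 4 :+ :con (+ 3) :* b :^ 4)) :+ a :^ 4 :* (:con (+ 4) :* a :^ 3 :* b :^ 2) :+ a :^ 4 :* (:con (+ 4) :* a :^ 2 :* b :^ 3))) ≐-refl a b ⟩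
      (con (+ 3) * b * (a * a) ^ 4 + b * b ^ 4 * (a * a) ^ 2) + (E₀ + E₂ + E₃)
        ≈⟨ +-cong-≐ (+-cong-≐ (*-congˡ-≐ (^-cong-≐ 4 a²≐)) (*-cong-≐ (*-congˡ-≐ b⁴) (^-cong-≐ 2 a²≐))) ≐-refl ⟩
      (con (+ 3) * b * (A + B) ^ 4 + b * (con (+ 4) * (A * B)) * (A + B) ^ 2) + (E₀ + E₂ + E₃)
        -- As (A + B)² - (A - B)² = 4AB, replacing 3(A + B)⁴ by 3((A + B)(A - B))² brings the mixed
        -- term to 16AB(A + B)². Of this 32A²B² = 2(4AB)² is kept, and the rest has exponents 4
        -- modulo 8 before the factor b.
        ≈⟨ solve 4 (λ b A B E → (:con (+ 3) :* b :* (A :+ B) :^ 4 :+ b :* (:con (+ 4) :* (A :* B)) :* (A :+ B) :^ 2) :+ E :=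
             :con (+ 3) :* b :* ((A :+ B) :* (A :- B)) :^ 2 :+ :con (+ 2) :* b :* (:con (+ 4) :* (A :* B)) :^ 2 :+ (E :+ :con (+ 16) :* b :* (A :* B) :* (A :^ 2 :+ B :^ 2))) ≐-refl b A B (E₀ + E₂ + E₃) ⟩
      con (+ 3) * b * ((A + B) * (A - B)) ^ 2 + con (+ 2) * b * (con (+ 4) * (A * B)) ^ 2 + (E₀ + E₂ + E₃ + E₅)
        ≈⟨ +-cong-≐ (+-cong-≐ (*-congˡ-≐ (^-cong-≐ 2 φ⁻₈⁴)) (*-congˡ-≐ (^-cong-≐ 2 b⁴))) ≐-refl ⟨
      con (+ 3) * b * (φ⁻₈ ^ 4) ^ 2 + con (+ 2) * b * (b ^ 4) ^ 2 + (E₀ + E₂ + E₃ + E₅)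
        ≈⟨ solve 3 (λ b x E → :con (+ 3) :* b :* (x :^ 4) :^ 2 :+ :con (+ 2) :* b :* (b :^ 4) :^ 2 :+ E :=
            :con (+ 3) :* b :* x :^ 8 :+ :con (+ 2) :* b :^ 9 :+ E)
            ≐-refl b φ⁻₈ (E₀ + E₂ + E₃ + E₅) ⟩
      con (+ 3) * b * φ⁻₈ ^ 8 + con (+ 2) * b ^ 9 + (E₀ + E₂ + E₃ + E₅) ∎
      where open ≐-Reasoning

    G : Series
    G = con (+ 3) * ψ + con (+ 512) * W

    R≐ : R ≐ con (+ 2) * (q * dilate 8 G) + (E₀ * U + E₂ * U + E₃ * U + E₅ * U)
    R≐ = begin
      R ≈⟨ solve 1 (λ x → x := :1 :* x) ≐-refl R ⟩
      1ˢ * R ≈⟨ *-cong-≐ φ⁻₈⁸*U ≐-refl ⟨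
      φ⁻₈ ^ 8 * U * R ≈⟨ solve 3 (λ x y z → x :* y :* z := x :* z :* y) ≐-refl (φ⁻₈ ^ 8) U R ⟩
      φ⁻₈ ^ 8 * R * U ≈⟨ *-cong-≐ numerator ≐-refl ⟩
      (con (+ 3) * b * φ⁻₈ ^ 8 + con (+ 2) * b ^ 9 + (E₀ + E₂ + E₃ + E₅)) * U
        ≈⟨ *-cong-≐ (+-cong-≐ (+-congˡ-≐ (*-congˡ-≐ b⁹)) ≐-refl) ≐-refl ⟩
      (con (+ 3) * b * φ⁻₈ ^ 8 + con (+ 2) * (con (+ 512) * (q * z)) + (E₀ + E₂ + E₃ + E₅)) * U
        ≈⟨ linear (solve 5 (λ q y x U z →
             (:con (+ 3) :* (:con (+ 2) :* q :* y) :* x :+ :con (+ 2) :* (:con (+ 512) :* (q :* z))) :* U :=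
             :con (+ 2) :* (q :* (:con (+ 3) :* y :* (x :* U) :+ :con (+ 512) :* (z :* U)))) ≐-refl
             q (dilate 8 ψ) (φ⁻₈ ^ 8) U z)
             (solve 5 (λ U e₀ e₂ e₃ e₅ → (e₀ :+ e₂ :+ e₃ :+ e₅) :* U := e₀ :* U :+ e₂ :* U :+ e₃ :* U :+ e₅ :* U) ≐-refl U E₀ E₂ E₃ E₅) ⟩
      con (+ 2) * (q * (con (+ 3) * dilate 8 ψ * (φ⁻₈ ^ 8 * U) + con (+ 512) * (z * U))) + (E₀ * U + E₂ * U + E₃ * U + E₅ * U)
        ≈⟨ +-cong-≐ (*-congˡ-≐ (*-congˡ-≐ (+-cong-≐ first second))) ≐-refl ⟩
      con (+ 2) * (q * (dilate 8 (con (+ 3) * ψ) + dilate 8 (con (+ 512) * W))) + (E₀ * U + E₂ * U + E₃ * U + E₅ * U)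
        ≈⟨ +-cong-≐ (*-congˡ-≐ (*-congˡ-≐ (Dilate.+-homo 7 _ _))) ≐-refl ⟨
      con (+ 2) * (q * dilate 8 G) + (E₀ * U + E₂ * U + E₃ * U + E₅ * U) ∎
      where
      open ≐-Reasoning
      z = q * q ^ 7 * dilate 8 ψ ^ 9
      b⁹ : b ^ 9 ≐ con (+ 512) * (q * z)
      b⁹ = solve 2 (λ q y → (:con (+ 2) :* q :* y) :^ 9 := :con (+ 512) :* (q :* (q :* q :^ 7 :* y :^ 9))) ≐-refl q (dilate 8 ψ)
      linear : ∀ {x y u x′ y′} → x * u ≐ x′ → y * u ≐ y′ → (x + y) * u ≐ x′ + y′
      linear {x} {y} {u} p r = ≐-trans (solve 3 (λ x y u → (x :+ y) :* u := x :* u :+ y :* u) ≐-refl x y u) (+-cong-≐ p r)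
      first : con (+ 3) * dilate 8 ψ * (φ⁻₈ ^ 8 * U) ≐ dilate 8 (con (+ 3) * ψ)
      first = ≐-trans (*-congˡ-≐ φ⁻₈⁸*U) (≐-trans (*-identityʳ-≐ _)
        (≐-trans (*-cong-≐ (≐-sym (Dilate.con-homo 7 (+ 3))) ≐-refl) (≐-sym (Dilate.*-homo 7 _ _))))
      second : con (+ 512) * (q * q ^ 7 * dilate 8 ψ ^ 9 * U) ≐ dilate 8 (con (+ 512) * W)
      second = ≐-trans (*-cong-≐ (≐-sym (Dilate.con-homo 7 (+ 512)))
          (≐-trans (*-cong-≐ (≐-trans (*-cong-≐ (≐-sym (Dilate.q-homo 7)) (≐-sym (Dilate.^-homo 7 9 ψ))) (≐-sym (Dilate.*-homo 7 q (ψ ^ 9)))) ≐-refl)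
            (≐-sym (Dilate.*-homo 7 (q * ψ ^ 9) (inv φ⁻ ^ 8)))))
        (≐-sym (Dilate.*-homo 7 _ _))

    -- Stated for arbitrary series, so that the concrete ones are not unfolded by the type checker.
    main-part : ∀ {r g e₀ e₂ e₃ e₅} m → r ≐ con (+ 2) * g + (e₀ + e₂ + e₃ + e₅) →
                at e₀ m ≡ 0ℤ → at e₂ m ≡ 0ℤ → at e₃ m ≡ 0ℤ → at e₅ m ≡ 0ℤ → at r m ≡ + 2 ℤ.* at g m
    main-part {g = g} m p z₀ z₂ z₃ z₅ = trans (coeff= p m)
      (trans (cong₂ ℤ._+_ (con-* (+ 2) g m) (cong₂ ℤ._+_ (cong₂ ℤ._+_ (cong₂ ℤ._+_ z₀ z₂) z₃) z₅)) (ℤ.+-identityʳ _))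

    R-at : ∀ n → at R (suc (n ℕ.* 8)) ≡ + 2 ℤ.* at G n
    R-at n = trans
      (main-part m R≐
        (vanish (supported-* supported-E₀ supported-U) m (off₄ λ ()))
        (vanish (supported-* supported-E₂ supported-U) m (off₄ λ ()))
        (vanish (supported-* supported-E₃ supported-U) m (off₄ λ ()))
        (vanish (supported-* supported-E₅ (supported-dilate 7 (inv φ⁻ ^ 8))) m off₈))
      (cong (λ e → + 2 ℤ.* e) (trans (q*-suc (dilate 8 G) (n ℕ.* 8)) (dilate-at 8 G n)))
      where
      m = suc (n ℕ.* 8)
      m%4 : m % 4 ≡ 1
      m%4 = trans (cong (λ e → suc e % 4) (sym (ℕ.*-assoc n 2 4))) ([m+kn]%n≡m%n 1 (n ℕ.* 2) 4)
      off₄ : ∀ {r} → 1 ≢ r → m % 4 ≢ r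
      off₄ 1≢r e = 1≢r (trans (sym m%4) e)
      off₈ : m % 8 ≢ 5
      off₈ e with trans (sym ([m+kn]%n≡m%n 1 n 8)) e
      ... | ()

    combination-at : ∀ c d f g n → at (con c * f + con d * g) n ≡ c ℤ.* at f n ℤ.+ d ℤ.* at g n
    combination-at c d f g n = cong₂ ℤ._+_ (con-* c f n) (con-* d g n)

  v₀-8n+1 : ∀ n → v₀ (suc (n ℕ.* 8) ℕ.* 2 ℕ.* 2) ≡ + 3 ℤ.* at ψ n ℤ.+ + 512 ℤ.* at W n
  v₀-8n+1 n = trans (ℤ.*-cancelˡ-≡ (+ 2) (v₀ (suc (n ℕ.* 8) ℕ.* 2 ℕ.* 2)) (at G n) (trans (v₀-4 (n ℕ.* 8)) (R-at n)))
    (combination-at (+ 3) (+ 512) ψ W n)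

-- Euler products, the product for ψ, and W modulo 27

module EulerProducts where
  open Coefficients public
  open import Data.Nat.DivMod using (_/_; m/n<m)

  private variable
    f g h : Series
    k l : ℤ
    K M N : ℕ

  euler⁻ euler⁺ : ℕ → Series
  euler⁻ K = ∏ K (λ i → 1ˢ - q ^ suc i)
  euler⁺ K = ∏ K (λ i → 1ˢ + q ^ suc i)

  unit-euler⁻ : ∀ K → Unit (euler⁻ K)
  unit-euler⁻ K = unit-∏ K λ i → unit-1- refl

  unit-euler⁺ : ∀ K → Unit (euler⁺ K)
  unit-euler⁺ K = unit-∏ K λ i → unit-1+ refl

  euler-φ⁻ : N ≤ K → euler⁻ K ≈[ k , N ] euler⁺ K * φ⁻
  euler-φ⁻ {N} {K} {k} N≤K = begin
    euler⁻ K       ≈⟨ ∏-cong K (λ i → ≐⇒≈ (+-congˡ-≐ (-‿cong-≐ (power i)))) ⟨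
    Q⁻ K           ≈⟨ φ⁻-product N≤K ⟩
    Q⁺ K * φ⁻      ≈⟨ *-congʳ (∏-cong K (λ i → ≐⇒≈ (+-congˡ-≐ (power i)))) ⟩
    euler⁺ K * φ⁻  ∎
    where
    open ≈-Reasoning
    power : ∀ i → qⁿ i ≐ q ^ suc i
    power i = *-congˡ-≐ (^-cong-≐ i (solve 1 (λ q → q :^ 1 := q) ≐-refl q))

  dilate-q^suc : ∀ j i → dilate (suc j) (q ^ suc i) ≐ (q ^ suc i) ^ suc j
  dilate-q^suc j i = ≐-trans (dilate-q^ j (suc i)) (subst (λ e → q ^ e ≐ (q ^ suc i) ^ suc j) (ℕ.*-comm (suc j) (suc i)) (^-* q (suc j) (suc i)))

  dilate-1- : ∀ j i → dilate (suc j) (1ˢ - q ^ suc i) ≐ 1ˢ - (q ^ suc i) ^ suc j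
  dilate-1- j i = ≐-trans (Dilate.minus-homo j _ _) (+-cong-≐ (Dilate.con-homo j 1ℤ) (-‿cong-≐ (dilate-q^suc j i)))

  dilate-1+ : ∀ j i → dilate (suc j) (1ˢ + q ^ suc i) ≐ 1ˢ + (q ^ suc i) ^ suc j
  dilate-1+ j i = ≐-trans (Dilate.+-homo j _ _) (+-cong-≐ (Dilate.con-homo j 1ℤ) (dilate-q^suc j i))

  euler⁺*euler⁻ : ∀ K → euler⁺ K * euler⁻ K ≐ dilate 2 (euler⁻ K)
  euler⁺*euler⁻ K = ≈⇒≐ λ N → begin
    euler⁺ K * euler⁻ K
      ≈⟨ ∏-distrib-* K _ _ ⟨
    ∏ K (λ i → (1ˢ + q ^ suc i) * (1ˢ - q ^ suc i))
      ≈⟨ ∏-cong K (λ i → ≐⇒≈ (≐-trans (solve 1 (λ x → (:1 :+ x) :* (:1 :- x) := :1 :- x :^ 2)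
          ≐-refl (q ^ suc i)) (≐-sym (dilate-1- 1 i)))) ⟩
    ∏ K (λ i → dilate 2 (1ˢ - q ^ suc i))
      ≈⟨ ≐⇒≈ (Dilate.∏-homo 1 K _) ⟨
    dilate 2 (euler⁻ K) ∎
    where open ≈-Reasoning

  con*-cancel-at : ∀ f m → at (con (+ 2) * f) m ≡ 0ℤ → at f m ≡ 0ℤ
  con*-cancel-at f m p = ℤ.*-cancelˡ-≡ (+ 2) (at f m) 0ℤ (trans (sym (con-* (+ 2) f m)) p)

  -- A series with constant term 1 and f(q)² = f(q²) is 1: the lowest term of f - 1 would double.
  square-dilate-unique : Unit f → f * f ≈[ 0ℤ , N ] dilate 2 f → f ≈[ 0ℤ , N ] 1ˢ
  square-dilate-unique {f} {N} (unit f₀) sq = go N ℕ.≤-refl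
    where
    open ≈-Reasoning
    z : Series
    z = f - 1ˢ
    2z : con (+ 2) * z + z * z ≈[ 0ℤ , N ] dilate 2 z
    2z = begin
      con (+ 2) * z + z * z    ≈⟨ ≐⇒≈ (solve 1 (λ f → :con (+ 2) :* (f :- :1) :+ (f :- :1) :* (f :- :1) := f :* f :- :1) ≐-refl f) ⟩
      f * f - 1ˢ           ≈⟨ sq -cong ≐⇒≈ (≐-sym (Dilate.con-homo 1 1ℤ)) ⟩
      dilate 2 f - dilate 2 1ˢ ≈⟨ ≐⇒≈ (Dilate.minus-homo 1 _ _) ⟨
      dilate 2 z               ∎
    step : ∀ M → suc (suc M) ≤ N → z ≈[ 0ℤ , suc M ] 0ˢ → con (+ 2) * z ≈[ 0ℤ , suc (suc M) ] 0ˢ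
    step M M<N p = begin
      con (+ 2) * z                    ≈⟨ ≐⇒≈ (solve 2 (λ x y → x := (x :+ y) :- y) ≐-refl (con (+ 2) * z) (z * z)) ⟩
      con (+ 2) * z + z * z - z * z    ≈⟨ ≈-weaken M<N 2z -cong ≈-weaken (s≤s (ℕ.≤-trans (s≤s (ℕ.m≤m+n M M)) (ℕ.≤-reflexive (sym (ℕ.+-suc M M))))) (order-* (suc M) (suc M) p p) ⟩
      dilate 2 z - 0ˢ              ≈⟨ order dil -cong ≈-refl ⟩
      0ˢ - 0ˢ                  ≈⟨ ≐⇒≈ (solve 0 (:0 :- :0 := :0) ≐-refl) ⟩
      0ˢ ∎
      where
      half : ∀ m → m < suc (suc M) → m / 2 < suc M
      half zero    _         = s≤s z≤n
      half (suc m) (s≤s m<M) = ℕ.<-≤-trans (m/n<m (suc m) 2 (s≤s (s≤s z≤n))) m<M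
      dil : ∀ m → m < suc (suc M) → at (dilate 2 z) m ≡ 0ℤ
      dil m m<M = dilate-vanish 2 z m (order⁻¹ p (m / 2) (half m m<M))
    small : ∀ M → M ≤ N → z ≈[ 0ℤ , M ] 0ˢ
    small zero          _   = mk λ _ ()
    small (suc zero)    _   = order λ { zero _ → cong (λ e → e ℤ.+ -1ℤ) f₀ ; (suc _) (s≤s ()) }
    small (suc (suc M)) M<N = order λ m m<M → con*-cancel-at z m (order⁻¹ (step M M<N (small (suc M) (ℕ.<⇒≤ M<N))) m m<M)
    go : ∀ M → M ≤ N → f ≈[ 0ℤ , M ] 1ˢ
    go M M≤N = begin
      f                ≈⟨ ≐⇒≈ (solve 1 (λ f → f := (f :- :1) :+ :1) ≐-refl f) ⟩
      z + 1ˢ       ≈⟨ +-congʳ (small M M≤N) ⟩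
      0ˢ + 1ˢ  ≈⟨ ≐⇒≈ (solve 0 (:0 :+ :1 := :1) ≐-refl) ⟩
      1ˢ           ∎

  -- The hypothesis equates the ratios f(q)²/f(q²) and g(q)²/g(q²), so f · `inv g` falls under
  -- `square-dilate-unique`.
  square-dilate-injective : Unit f → Unit g → f * f * dilate 2 g ≈[ 0ℤ , N ] g * g * dilate 2 f → f ≈[ 0ℤ , N ] g
  square-dilate-injective {f} {g} {N} uf ug p = begin
    f               ≈⟨ ≐⇒≈ (≐-trans (solve 1 (λ x → x := x :* :1) ≐-refl f) (*-congˡ-≐ (≐-sym (*-inverse ug)))) ⟩
    f * (g * inv g) ≈⟨ ≐⇒≈ (solve 3 (λ x y z → x :* (y :* z) := x :* z :* y) ≐-refl f g (inv g)) ⟩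
    f * inv g * g   ≈⟨ *-congʳ (square-dilate-unique (unit-* uf unit-inv) quotient) ⟩
    1ˢ * g      ≈⟨ ≐⇒≈ (*-identityˡ-≐ g) ⟩
    g ∎
    where
    open ≈-Reasoning
    quotient : f * inv g * (f * inv g) ≈[ 0ℤ , N ] dilate 2 (f * inv g)
    quotient = *-cancelˡ (unit-* (unit-* ug ug) (unit-dilate 1 ug)) (begin
      g * g * dilate 2 g * (f * inv g * (f * inv g))
        ≈⟨ ≐⇒≈ (solve 4 (λ f g i d → g :* g :* d :* (f :* i :* (f :* i)) := f :* f :* d :* ((g :* i) :* (g :* i)))
            ≐-refl f g (inv g) (dilate 2 g)) ⟩
      f * f * dilate 2 g * (g * inv g * (g * inv g))
        ≈⟨ *-cong p (≐⇒≈ (≐-trans (*-cong-≐ (*-inverse ug) (*-inverse ug)) (solve 0 (:1 :* :1 := :1) ≐-refl))) ⟩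
      g * g * dilate 2 f * 1ˢ
        ≈⟨ *-congˡ (≐⇒≈ (≐-trans (Dilate.cong-≐ 1 (*-inverse ug)) (Dilate.con-homo 1 1ℤ))) ⟨
      g * g * dilate 2 f * dilate 2 (g * inv g)
        ≈⟨ ≐⇒≈ (≐-trans (*-congˡ-≐ (Dilate.*-homo 1 _ _)) (solve 4 (λ g f d i → g :* f :* (d :* i) := g :* d :* (f :* i))
            ≐-refl (g * g) (dilate 2 f) (dilate 2 g) (dilate 2 (inv g)))) ⟩
      g * g * dilate 2 g * (dilate 2 f * dilate 2 (inv g))
        ≈⟨ *-congˡ (≐⇒≈ (Dilate.*-homo 1 _ _)) ⟨
      g * g * dilate 2 g * dilate 2 (f * inv g) ∎)

  unit-ψ : Unit ψ
  unit-ψ = unit refl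

  -- Both sides have the ratio f(q)²/f(q²) = φ. For ψ this is `ψ²`; for the product it follows from
  -- `euler-φ⁻`, `euler⁺*euler⁻` and `φφ⁻`. The uniqueness argument cancels a factor 2, hence it is
  -- run over the integers and reduced modulo `k` afterwards.
  euler-ψ : N ≤ K → ψ ≈[ k , N ] euler⁺ K ^ 2 * euler⁻ K
  euler-ψ {N} {K} N≤K = ≈-reduce (square-dilate-injective unit-ψ (unit-* (unit-^ 2 (unit-euler⁺ K)) (unit-euler⁻ K)) (begin
    ψ * ψ * dilate 2 (H ^ 2 * Q)        ≈⟨ *-congʳ (≐⇒≈ ψ²) ⟩
    φ * dilate 2 ψ * dilate 2 (H ^ 2 * Q) ≈⟨ ≐⇒≈ (solve 3 (λ x y z → x :* y :* z := (x :* z) :* y)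
        ≐-refl φ (dilate 2 ψ) (dilate 2 (H ^ 2 * Q))) ⟩
    φ * dilate 2 (H ^ 2 * Q) * dilate 2 ψ ≈⟨ *-congʳ core ⟩
    (H ^ 2 * Q) * (H ^ 2 * Q) * dilate 2 ψ ∎))
    where
    open ≈-Reasoning
    H = euler⁺ K
    Q = euler⁻ K
    core : φ * dilate 2 (H ^ 2 * Q) ≈[ 0ℤ , N ] (H ^ 2 * Q) * (H ^ 2 * Q)
    core = *-cancelˡ unit-φ⁻ (begin
      φ⁻ * (φ * dilate 2 (H ^ 2 * Q))     ≈⟨ ≐⇒≈ (solve 3 (λ x y z → x :* (y :* z) := y :* x :* z) ≐-refl φ⁻ φ (dilate 2 (H ^ 2 * Q))) ⟩
      φ * φ⁻ * dilate 2 (H ^ 2 * Q)       ≈⟨ ≐⇒≈ (≐-trans (*-cong-≐ φφ⁻ ≐-refl) (≐-sym (Dilate.*-homo 1 _ _))) ⟩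
      dilate 2 (φ⁻ * φ⁻ * (H ^ 2 * Q))    ≈⟨ Dilate.cong-≈ 1 (≐⇒≈ (solve 3 (λ f h q → f :* f :* (h :^ 2 :* q) := (h :* f) :^ 2 :* q)
          ≐-refl φ⁻ H Q)) ⟩
      dilate 2 ((H * φ⁻) ^ 2 * Q)         ≈⟨ Dilate.cong-≈ 1 (*-congʳ (^-cong 2 (euler-φ⁻ N≤K))) ⟨
      dilate 2 (Q ^ 2 * Q)                ≈⟨ ≐⇒≈ (≐-trans (Dilate.*-homo 1 _ _) (*-cong-≐ (Dilate.^-homo 1 2 Q) ≐-refl)) ⟩
      dilate 2 Q ^ 2 * dilate 2 Q         ≈⟨ ≐⇒≈ (*-cong-≐ (^-cong-≐ 2 (euler⁺*euler⁻ K)) (euler⁺*euler⁻ K)) ⟨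
      (H * Q) ^ 2 * (H * Q)               ≈⟨ ≐⇒≈ (solve 2 (λ h q → (h :* q) :^ 2 :* (h :* q) := h :^ 3 :* q :^ 2 :* q) ≐-refl H Q) ⟩
      H ^ 3 * Q ^ 2 * Q                   ≈⟨ *-congˡ (euler-φ⁻ N≤K) ⟩
      H ^ 3 * Q ^ 2 * (H * φ⁻)            ≈⟨ ≐⇒≈ (solve 3 (λ h q f → h :^ 3 :* q :^ 2 :* (h :* f) := f :* ((h :^ 2 :* q) :* (h :^ 2 :* q)))
          ≐-refl H Q φ⁻) ⟩
      φ⁻ * ((H ^ 2 * Q) * (H ^ 2 * Q))    ∎)

  cube-mod-3 : ∀ x → (1ˢ + x) ^ 3 ≈[ + 3 , N ] 1ˢ + x ^ 3
  cube-mod-3 x = begin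
    (1ˢ + x) ^ 3 ≈⟨ ≐⇒≈ (solve 1 (λ x → (:1 :+ x) :^ 3 := :1 :+ x :^ 3 :+ :con (+ 3) :* (x :+ x :^ 2)) ≐-refl x) ⟩
    1ˢ + x ^ 3 + con (+ 3) * (x + x ^ 2) ≈⟨ +-congˡ (≈-trans (*-congʳ (con-ideal (divides 1ℤ refl))) (≐⇒≈ (zeroˡ-≐ (x + x ^ 2)))) ⟩
    1ˢ + x ^ 3 + 0ˢ ≈⟨ ≐⇒≈ (+-identityʳ-≐ _) ⟩
    1ˢ + x ^ 3 ∎
    where open ≈-Reasoning

  ∏-^ : ∀ n F e → ∏ n F ^ e ≈[ k , N ] ∏ n (λ i → F i ^ e)
  ∏-^ zero    F zero    = ≈-refl
  ∏-^ zero    F (suc e) = ≈-trans (*-congˡ (∏-^ zero F e)) (≐⇒≈ (solve 0 (:1 :* :1 := :1) ≐-refl))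
  ∏-^ (suc n) F e = ≈-trans (≐⇒≈ (^-distrib-* (∏ n F) (F n) e)) (*-congʳ (∏-^ n F e))

  frobenius-euler⁺ : ∀ K → euler⁺ K ^ 3 ≈[ + 3 , N ] dilate 3 (euler⁺ K)
  frobenius-euler⁺ K = begin
    euler⁺ K ^ 3                               ≈⟨ ∏-^ K _ 3 ⟩
    ∏ K (λ i → (1ˢ + q ^ suc i) ^ 3)       ≈⟨ ∏-cong K (λ i → cube-mod-3 (q ^ suc i)) ⟩
    ∏ K (λ i → 1ˢ + (q ^ suc i) ^ 3)       ≈⟨ ∏-cong K (λ i → ≐⇒≈ (dilate-1+ 2 i)) ⟨
    ∏ K (λ i → dilate 3 (1ˢ + q ^ suc i))  ≈⟨ ≐⇒≈ (Dilate.∏-homo 2 K _) ⟨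
    dilate 3 (euler⁺ K) ∎
    where open ≈-Reasoning

  ≈⇒-≈0 : f ≈[ k , N ] g → f - g ≈[ k , N ] 0ˢ
  ≈⇒-≈0 {f} {g = g} p = ≈-trans (p -cong ≈-refl) (≐⇒≈ (solve 1 (λ x → x :- x := :0) ≐-refl g))

  -≈0⇒≈ : f - g ≈[ k , N ] 0ˢ → f ≈[ k , N ] g
  -≈0⇒≈ {f} {g} p = ≈-trans (≐⇒≈ (solve 2 (λ x y → x := (x :- y) :+ y) ≐-refl f g))
    (≈-trans (+-congʳ p) (≐⇒≈ (+-identityˡ-≐ g)))

  mod-weaken : k ∣ l → f ≈[ l , N ] g → f ≈[ k , N ] g
  mod-weaken k∣l p = mk λ m m<N → mod (∣-trans k∣l (divisible (coeff p m m<N)))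

  -- f³ - g³ = (f - g)(f² + fg + g²), and the second factor is 3g² modulo k.
  cube-lift : + 3 ∣ k → f ≈[ k , N ] g → f ^ 3 ≈[ k ℤ.* + 3 , N ] g ^ 3
  cube-lift {k} {f} {N} {g} 3∣k p = -≈0⇒≈ (begin
    f ^ 3 - g ^ 3 ≈⟨ ≐⇒≈ (solve 2 (λ f g → f :^ 3 :- g :^ 3 := (f :- g) :* (f :* f :+ f :* g :+ g :* g)) ≐-refl f g) ⟩
    (f - g) * (f * f + f * g + g * g) ≈⟨ ideal-* (≈⇒-≈0 p) quadratic ⟩
    0ˢ ∎)
    where
    open ≈-Reasoning
    quadratic : f * f + f * g + g * g ≈[ + 3 , N ] 0ˢ
    quadratic = begin
      f * f + f * g + g * g ≈⟨ +-congʳ (+-cong (*-cong p₃ p₃) (*-congʳ p₃)) ⟩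
      g * g + g * g + g * g ≈⟨ ≐⇒≈ (solve 1 (λ g → g :* g :+ g :* g :+ g :* g := :con (+ 3) :* (g :* g)) ≐-refl g) ⟩
      con (+ 3) * (g * g)   ≈⟨ *-congʳ (con-ideal (divides 1ℤ refl)) ⟩
      0ˢ * (g * g)      ≈⟨ ≐⇒≈ (zeroˡ-≐ (g * g)) ⟩
      0ˢ ∎
      where p₃ = mod-weaken 3∣k p

  -- Since ψ = H³φ⁻, the ninth power contributes H^27(φ⁻)^9, and eight of the nine factors φ⁻ are
  -- cancelled by the denominator.
  W-euler : N ≤ K → W ≈[ k , N ] q * (euler⁺ K ^ 27 * φ⁻)
  W-euler {N} {K} {k} N≤K = begin
    q * ψ ^ 9 * I ^ 8                     ≈⟨ *-congʳ (*-congˡ (^-cong 9 (≈-trans (euler-ψ N≤K) (*-congˡ (euler-φ⁻ N≤K))))) ⟩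
    q * (H ^ 2 * (H * φ⁻)) ^ 9 * I ^ 8    ≈⟨ *-congʳ (*-congˡ (≐⇒≈ (≐-trans (solve 2 (λ h f → (h :^ 2 :* (h :* f)) :^ 9 :=
        (h :^ 3) :^ 9 :* f :^ 9)
        ≐-refl H φ⁻) (*-cong-≐ (≐-sym (^-* H 9 3)) ≐-refl)))) ⟩
    q * (H ^ 27 * φ⁻ ^ 9) * I ^ 8         ≈⟨ ≐⇒≈ (solve 4 (λ q h f i → q :* (h :* (f :* f :^ 8)) :* i := q :* (h :* f) :* (f :^ 8 :* i))
        ≐-refl q (H ^ 27) φ⁻ (I ^ 8)) ⟩
    q * (H ^ 27 * φ⁻) * (φ⁻ ^ 8 * I ^ 8)  ≈⟨ *-congˡ (≐⇒≈ (≐-trans (≐-sym (^-distrib-* φ⁻ I 8)) (≐-trans (^-cong-≐ 8 (*-inverse unit-φ⁻)) (solve 0 (:1 :^ 8 := :1) ≐-refl)))) ⟩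
    q * (H ^ 27 * φ⁻) * 1ˢ            ≈⟨ ≐⇒≈ (*-identityʳ-≐ _) ⟩
    q * (H ^ 27 * φ⁻) ∎
    where
    open ≈-Reasoning
    H = euler⁺ K
    I = inv φ⁻

  W-mod-27 : N ≤ K → W ≈[ + 27 , N ] q * (dilate 3 (euler⁺ K ^ 9) * φ⁻)
  W-mod-27 {N} {K} N≤K = ≈-trans (W-euler N≤K) (*-congˡ (*-congʳ (begin
    H ^ 27              ≈⟨ ≐⇒≈ (≐-trans (^-* H 9 3) (^-* (H ^ 3) 3 3)) ⟩
    -- The Frobenius congruence modulo 3 is cubed twice, each time gaining a factor 3 in the
    -- modulus.
    ((H ^ 3) ^ 3) ^ 3   ≈⟨ cube-lift (divides (+ 3) refl) (cube-lift (divides 1ℤ refl) (frobenius-euler⁺ K)) ⟩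
    (dilate 3 H ^ 3) ^ 3 ≈⟨ ≐⇒≈ (≐-trans (≐-sym (^-* (dilate 3 H) 3 3)) (≐-sym (Dilate.^-homo 2 9 H))) ⟩
    dilate 3 (H ^ 9)    ∎)))
    where
    open ≈-Reasoning
    H = euler⁺ K

-- Lambert series and the correction to H⁹ modulo 27

module Lambert where
  open EulerProducts public
  open import Data.Nat.DivMod using (_/_)

  private variable
    f g h : Series
    k l : ℤ
    K N : ℕ

  ∑-swap : ∀ m n (F : ℕ → ℕ → Series) → ∑ m (λ i → ∑ n (F i)) ≐ ∑ n (λ j → ∑ m (λ i → F i j))
  ∑-swap zero    n F = zeros n
    where
    zeros : ∀ n → 0ˢ ≐ ∑ n (λ _ → 0ˢ)
    zeros zero    = ≐-refl
    zeros (suc n) = ≐-trans (solve 0 (:0 := :0 :+ :0) ≐-refl) (+-cong-≐ (zeros n) ≐-refl)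
  ∑-swap (suc m) n F = ≐-trans (+-cong-≐ (∑-swap m n F) ≐-refl)
    (≈⇒≐ λ N → ≈-sym (∑-distrib-+ n (λ j → ∑ m (λ i → F i j)) (F m)))

  con-suc : ∀ n → con (+ suc n) ≐ 1ˢ + con (+ n)
  con-suc n = pointwise λ { zero → refl ; (suc _) → refl }

  geometric : ∀ K x → (1ˢ - x) * ∑ K (λ j → x ^ suc j) ≐ x - x ^ suc K
  geometric zero    x = solve 1 (λ x → (:1 :- x) :* :0 := x :- x :* :1) ≐-refl x
  geometric (suc K) x = ≐-trans (solve 3 (λ x s p → (:1 :- x) :* (s :+ p) := (:1 :- x) :* s :+ p :- x :* p) ≐-refl x _ (x ^ suc K))
    (≐-trans (+-cong-≐ (+-cong-≐ (geometric K x) ≐-refl) ≐-refl) (solve 2 (λ x p → x :- p :+ p :- x :* p := x :- x :* p)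
        ≐-refl x (x ^ suc K)))

  -- A finite form of Σ j x^j = x/(1 - x)². Both boundary terms contain x^(K+1) and disappear modulo
  -- q^N for the x in use.
  geometric′ : ∀ K x → (1ˢ - x) ^ 2 * ∑ K (λ j → con (+ suc j) * x ^ suc j)
               ≐ x - con (+ suc K) * x ^ suc K + con (+ K) * x ^ suc (suc K)
  geometric′ zero    x = solve 1 (λ x → (:1 :- x) :^ 2 :* :0 := x :- :1 :* (x :* :1) :+ :0 :* (x :* (x :* :1))) ≐-refl x
  geometric′ (suc K) x = begin
    (1ˢ - x) ^ 2 * (s + con (+ suc K) * p)
      ≈⟨ solve 4 (λ x s c p → (:1 :- x) :^ 2 :* (s :+ c :* p) := (:1 :- x) :^ 2 :* s :+ (:1 :- x) :^ 2 :* (c :* p))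
          ≐-refl x s (con (+ suc K)) p ⟩
    (1ˢ - x) ^ 2 * s + (1ˢ - x) ^ 2 * (con (+ suc K) * p)
      ≈⟨ +-cong-≐ (geometric′ K x) ≐-refl ⟩
    x - con (+ suc K) * p + con (+ K) * (x * p) + (1ˢ - x) ^ 2 * (con (+ suc K) * p)
      ≈⟨ +-cong-≐ (+-cong-≐ (+-congˡ-≐ (-‿cong-≐ (*-cong-≐ (con-suc K) ≐-refl))) ≐-refl) (*-congˡ-≐ (*-cong-≐ (con-suc K) ≐-refl)) ⟩
    x - (1ˢ + con (+ K)) * p + con (+ K) * (x * p) + (1ˢ - x) ^ 2 * ((1ˢ + con (+ K)) * p)
      ≈⟨ solve 3 (λ x c p → x :- (:1 :+ c) :* p :+ c :* (x :* p) :+ (:1 :- x) :^ 2 :* ((:1 :+ c) :* p) :=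
           x :- (:1 :+ (:1 :+ c)) :* (x :* p) :+ (:1 :+ c) :* (x :* (x :* p))) ≐-refl x (con (+ K)) p ⟩
    x - (1ˢ + (1ˢ + con (+ K))) * (x * p) + (1ˢ + con (+ K)) * (x * (x * p))
      ≈⟨ +-cong-≐ (+-congˡ-≐ (-‿cong-≐ (*-cong-≐ (≐-trans (con-suc (suc K)) (+-congˡ-≐ (con-suc K))) ≐-refl))) (*-cong-≐ (con-suc K) ≐-refl) ⟨
    x - con (+ suc (suc K)) * (x * p) + con (+ suc K) * (x * (x * p)) ∎
    where
    open ≐-Reasoning
    s = ∑ K (λ j → con (+ suc j) * x ^ suc j)
    p = x ^ suc K

  power-small : ∀ n → N ≤ K → (q ^ suc n) ^ suc K ≈[ k , N ] 0ˢ
  power-small n N≤K = ≈-weaken (ℕ.m≤n⇒m≤1+n N≤K) (order-^ refl _)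

  -- A truncation of Σ_{n,j ≥ 1} j q^{nj} = Σ_{n ≥ 1} q^n / (1 - q^n)², whose coefficients are the divisor sums σ(m).
  lambert-term : ℕ → ℕ → Series
  lambert-term K n = ∑ K (λ j → con (+ suc j) * (q ^ suc n) ^ suc j)

  lambert : ℕ → Series
  lambert K = ∑ K (lambert-term K)

  lambert-factor : ∀ n → N ≤ K → (1ˢ - q ^ suc n) ^ 2 * lambert-term K n ≈[ k , N ] q ^ suc n
  lambert-factor {N} {K} {k} n N≤K = begin
    (1ˢ - x) ^ 2 * lambert-term K n ≈⟨ ≐⇒≈ (geometric′ K x) ⟩
    x - con (+ suc K) * x ^ suc K + con (+ K) * (x * x ^ suc K)
      ≈⟨ +-cong (≈-refl -cong *-congˡ (power-small n N≤K)) (*-congˡ (*-congˡ (power-small n N≤K))) ⟩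
    x - con (+ suc K) * 0ˢ + con (+ K) * (x * 0ˢ)
      ≈⟨ ≐⇒≈ (solve 3 (λ x c d → x :- c :* :0 :+ d :* (x :* :0) := x) ≐-refl x (con (+ suc K)) (con (+ K))) ⟩
    x ∎
    where
    open ≈-Reasoning
    x = q ^ suc n

  con*≈0 : ∀ c → k ∣ c → ∀ f → con c * f ≈[ k , N ] 0ˢ
  con*≈0 c k∣c f = ≈-trans (*-congʳ (con-ideal k∣c)) (≐⇒≈ (zeroˡ-≐ f))

  -- Products of two multiples of 3 die modulo 9, so a product turns into a sum; this is how an
  -- Euler product produces a Lambert series.
  ∏-1+3 : ∀ n F → ∏ n (λ i → 1ˢ + con (+ 3) * F i) ≈[ + 9 , N ] 1ˢ + con (+ 3) * ∑ n F
  ∏-1+3 zero    F = ≐⇒≈ (solve 0 (:1 := :1 :+ :con (+ 3) :* :0) ≐-refl)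
  ∏-1+3 (suc n) F = begin
    ∏ n (λ i → 1ˢ + con (+ 3) * F i) * (1ˢ + con (+ 3) * F n) ≈⟨ *-congʳ (∏-1+3 n F) ⟩
    (1ˢ + con (+ 3) * ∑ n F) * (1ˢ + con (+ 3) * F n)
      ≈⟨ ≐⇒≈ (solve 2 (λ x y → (:1 :+ :con (+ 3) :* x) :* (:1 :+ :con (+ 3) :* y) := :1 :+ :con (+ 3) :* (x :+ y) :+ :con (+ 9) :* (x :* y))
          ≐-refl (∑ n F) (F n)) ⟩
    1ˢ + con (+ 3) * (∑ n F + F n) + con (+ 9) * (∑ n F * F n) ≈⟨ +-congˡ (con*≈0 (+ 9) (divides 1ℤ refl) _) ⟩
    1ˢ + con (+ 3) * (∑ n F + F n) + 0ˢ ≈⟨ ≐⇒≈ (+-identityʳ-≐ _) ⟩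
    1ˢ + con (+ 3) * (∑ n F + F n) ∎
    where open ≈-Reasoning

  -- 1 - x³ = (1 - x)³ (1 + 3 x / (1 - x)²)
  euler⁻-mod-9 : N ≤ K → dilate 3 (euler⁻ K) ≈[ + 9 , N ] euler⁻ K ^ 3 * (1ˢ + con (+ 3) * lambert K)
  euler⁻-mod-9 {N} {K} N≤K = begin
    dilate 3 (euler⁻ K) ≈⟨ ≐⇒≈ (Dilate.∏-homo 2 K _) ⟩
    ∏ K (λ i → dilate 3 (1ˢ - q ^ suc i)) ≈⟨ ∏-cong K factor ⟩
    ∏ K (λ i → (1ˢ - q ^ suc i) ^ 3 * (1ˢ + con (+ 3) * lambert-term K i)) ≈⟨ ∏-distrib-* K _ _ ⟩
    ∏ K (λ i → (1ˢ - q ^ suc i) ^ 3) * ∏ K (λ i → 1ˢ + con (+ 3) * lambert-term K i)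
      ≈⟨ *-cong (≈-sym (∏-^ K _ 3)) (∏-1+3 K (lambert-term K)) ⟩
    euler⁻ K ^ 3 * (1ˢ + con (+ 3) * lambert K) ∎
    where
    open ≈-Reasoning
    factor : ∀ i → dilate 3 (1ˢ - q ^ suc i) ≈[ + 9 , N ] (1ˢ - q ^ suc i) ^ 3 * (1ˢ + con (+ 3) * lambert-term K i)
    factor i = begin
      dilate 3 (1ˢ - x) ≈⟨ ≐⇒≈ (dilate-1- 2 i) ⟩
      1ˢ - x ^ 3 ≈⟨ ≐⇒≈ (solve 1 (λ x → :1 :- x :^ 3 := (:1 :- x) :^ 3 :+ :con (+ 3) :* (:1 :- x) :* x) ≐-refl x) ⟩
      (1ˢ - x) ^ 3 + con (+ 3) * (1ˢ - x) * x ≈⟨ +-congˡ (*-congˡ (lambert-factor i N≤K)) ⟨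
      (1ˢ - x) ^ 3 + con (+ 3) * (1ˢ - x) * ((1ˢ - x) ^ 2 * e)
        ≈⟨ ≐⇒≈ (solve 2 (λ x e → (:1 :- x) :^ 3 :+ :con (+ 3) :* (:1 :- x) :* ((:1 :- x) :^ 2 :* e) :=
            (:1 :- x) :^ 3 :* (:1 :+ :con (+ 3) :* e))
            ≐-refl x e) ⟩
      (1ˢ - x) ^ 3 * (1ˢ + con (+ 3) * e) ∎
      where
      x = q ^ suc i
      e = lambert-term K i

  -- The logarithmic derivative of the Euler product weights q^(nj) by n, whereas x/(1 - x)² weights
  -- it by j. With the same cutoff for both indices the two finite sums agree exactly.
  lambert-dual : ∀ K → ∑ K (λ n → con (+ suc n) * ∑ K (λ j → (q ^ suc n) ^ suc j)) ≐ lambert K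
  lambert-dual K = ≈⇒≐ λ N → begin
    ∑ K (λ n → con (+ suc n) * ∑ K (λ j → (q ^ suc n) ^ suc j)) ≈⟨ ∑-cong K (λ n → ∑-*ˡ K _ _) ⟩
    ∑ K (λ n → ∑ K (λ j → con (+ suc n) * (q ^ suc n) ^ suc j)) ≈⟨ ≐⇒≈ (∑-swap K K _) ⟩
    ∑ K (λ j → ∑ K (λ n → con (+ suc n) * (q ^ suc n) ^ suc j)) ≈⟨ ∑-cong K (λ j → ∑-cong K λ n → *-congˡ (≐⇒≈ (exchange n j))) ⟩
    lambert K ∎
    where
    open ≈-Reasoning
    exchange : ∀ n j → (q ^ suc n) ^ suc j ≐ (q ^ suc j) ^ suc n
    exchange n j = ≐-trans (≐-sym (^-* q (suc j) (suc n)))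
      (subst (λ e → q ^ e ≐ (q ^ suc j) ^ suc n) (ℕ.*-comm (suc n) (suc j)) (^-* q (suc n) (suc j)))

  -- For x = q^(n+1), D(1 - x) = -(n + 1)x, and up to the truncation x is 1 - x times its geometric
  -- sum.
  D-euler⁻ : N ≤ K → D (euler⁻ K) ≈[ k , N ] - (euler⁻ K * lambert K)
  D-euler⁻ {N} {K} {k} N≤K = ≈-trans (go K) (-‿cong (*-congˡ (≐⇒≈ (lambert-dual K))))
    where
    open ≈-Reasoning
    γ : ℕ → Series
    γ n = con (+ suc n) * ∑ K (λ j → (q ^ suc n) ^ suc j)
    D-factor : ∀ n → D (1ˢ - q ^ suc n) ≈[ k , N ] - ((1ˢ - q ^ suc n) * γ n)
    D-factor n = begin
      D (1ˢ - x)        ≈⟨ ≐⇒≈ (≐-trans (D-+ _ _) (+-cong-≐ (D-con 1ℤ) (≐-trans (D-neg x) (-‿cong-≐ (D-q^ (suc n)))))) ⟩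
      0ˢ - con (+ suc n) * x ≈⟨ ≐⇒≈ (solve 2 (λ c x → :0 :- c :* x := :- (c :* (x :- :0))) ≐-refl (con (+ suc n)) x) ⟩
      - (con (+ suc n) * (x - 0ˢ)) ≈⟨ -‿cong (*-congˡ (≈-refl -cong power-small n N≤K)) ⟨
      - (con (+ suc n) * (x - x ^ suc K)) ≈⟨ -‿cong (*-congˡ (≐⇒≈ (geometric K x))) ⟨
      - (con (+ suc n) * ((1ˢ - x) * s)) ≈⟨ ≐⇒≈ (solve 3 (λ c y s → :- (c :* (y :* s)) := :- (y :* (c :* s)))
          ≐-refl (con (+ suc n)) (1ˢ - x) s) ⟩
      - ((1ˢ - x) * γ n) ∎
      where
      x = q ^ suc n
      s = ∑ K (λ j → x ^ suc j)
    go : ∀ n → D (euler⁻ n) ≈[ k , N ] - (euler⁻ n * ∑ n γ)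
    go zero    = ≐⇒≈ (≐-trans (D-con 1ℤ) (solve 0 (:0 := :- (:1 :* :0)) ≐-refl))
    go (suc n) = begin
      D (P * F) ≈⟨ ≐⇒≈ (D-* P F) ⟩
      D P * F + P * D F ≈⟨ +-cong (*-congʳ (go n)) (*-congˡ (D-factor n)) ⟩
      - (P * ∑ n γ) * F + P * - (F * γ n) ≈⟨ ≐⇒≈ (solve 4 (λ P F s g → (:- (P :* s)) :* F :+ P :* (:- (F :* g)) := :- (P :* F :* (s :+ g)))
          ≐-refl P F (∑ n γ) (γ n)) ⟩
      - (P * F * (∑ n γ + γ n)) ∎
      where
      P = euler⁻ n
      F = 1ˢ - q ^ suc n

  Y : ℕ → Series
  Y K = lambert K - dilate 2 (lambert K)

  -- From ψQ = Q_2² the logarithmic derivative of ψ is L - 4L_2, and 4 ≡ 1 modulo 3.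
  D-ψ : N ≤ K → D ψ ≈[ + 3 , N ] ψ * Y K
  D-ψ {N} {K} N≤K = *-cancelˡ (unit-euler⁻ K) (begin
    Q * D ψ ≈⟨ ≐⇒≈ (solve 3 (λ q d r → q :* d := (d :* q :+ r) :- r) ≐-refl Q (D ψ) (ψ * D Q)) ⟩
    (D ψ * Q + ψ * D Q) - ψ * D Q ≈⟨ ≐⇒≈ (≐-sym (D-* ψ Q)) -cong *-congˡ (D-euler⁻ N≤K) ⟩
    D (ψ * Q) - ψ * - (Q * L) ≈⟨ D-cong ψQ -cong ≈-refl ⟩
    D (Q₂ * Q₂) - ψ * - (Q * L) ≈⟨ ≐⇒≈ (≐-trans (D-* Q₂ Q₂) (solve 2 (λ x y → x :* y :+ y :* x := :con (+ 2) :* (y :* x))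
        ≐-refl (D Q₂) Q₂)) -cong ≈-refl ⟩
    con (+ 2) * (Q₂ * D Q₂) - ψ * - (Q * L) ≈⟨ *-congˡ (*-congˡ D-Q₂) -cong ≈-refl ⟩
    con (+ 2) * (Q₂ * (con (+ 2) * - (Q₂ * L₂))) - ψ * - (Q * L)
      ≈⟨ ≐⇒≈ (solve 5 (λ r l ψ q m → :con (+ 2) :* (r :* (:con (+ 2) :* (:- (r :* l)))) :- ψ :* (:- (q :* m)) :=
          ψ :* (q :* m) :- :con (+ 4) :* ((r :* r) :* l))
          ≐-refl Q₂ L₂ ψ Q L) ⟩
    ψ * (Q * L) - con (+ 4) * (Q₂ * Q₂ * L₂) ≈⟨ ≈-refl -cong *-congˡ (*-congʳ ψQ) ⟨
    ψ * (Q * L) - con (+ 4) * (ψ * Q * L₂)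
      ≈⟨ ≐⇒≈ (solve 4 (λ ψ q l m → ψ :* (q :* l) :- :con (+ 4) :* (ψ :* q :* m) :=
          q :* (ψ :* (l :- m)) :+ :con (ℤ.- (+ 3)) :* (ψ :* q :* m))
          ≐-refl ψ Q L L₂) ⟩
    Q * (ψ * (L - L₂)) + con (ℤ.- (+ 3)) * (ψ * Q * L₂) ≈⟨ +-congˡ (con*≈0 (ℤ.- (+ 3)) (divides -1ℤ refl) _) ⟩
    Q * (ψ * (L - L₂)) + 0ˢ ≈⟨ ≐⇒≈ (+-identityʳ-≐ _) ⟩
    Q * (ψ * (L - L₂)) ∎)
    where
    open ≈-Reasoning
    Q = euler⁻ K
    Q₂ = dilate 2 Q
    L = lambert K
    L₂ = dilate 2 L
    ψQ : ψ * Q ≈[ + 3 , N ] Q₂ * Q₂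
    ψQ = ≈-trans (*-congʳ (euler-ψ N≤K)) (≐⇒≈ (≐-trans (solve 2 (λ h q → h :^ 2 :* q :* q := (h :* q) :* (h :* q)) ≐-refl (euler⁺ K) Q)
      (*-cong-≐ (euler⁺*euler⁻ K) (euler⁺*euler⁻ K))))
    D-Q₂ : D Q₂ ≈[ + 3 , N ] con (+ 2) * - (Q₂ * L₂)
    D-Q₂ = ≈-trans (≐⇒≈ (D-dilate 1 Q)) (*-congˡ (≈-trans (Dilate.cong-≈ 1 (D-euler⁻ N≤K))
      (≐⇒≈ (≐-trans (Dilate.neg-homo 1 _) (-‿cong-≐ (Dilate.*-homo 1 Q L))))))

  cube-1+3 : ∀ y → (1ˢ + con (+ 3) * y) ^ 3 ≈[ + 27 , N ] 1ˢ + con (+ 9) * y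
  cube-1+3 y = begin
    (1ˢ + con (+ 3) * y) ^ 3
      ≈⟨ ≐⇒≈ (solve 1 (λ y → (:1 :+ :con (+ 3) :* y) :^ 3 := :1 :+ :con (+ 9) :* y :+ :con (+ 27) :* (y :^ 2 :+ y :^ 3)) ≐-refl y) ⟩
    1ˢ + con (+ 9) * y + con (+ 27) * (y ^ 2 + y ^ 3) ≈⟨ +-congˡ (con*≈0 (+ 27) (divides 1ℤ refl) _) ⟩
    1ˢ + con (+ 9) * y + 0ˢ ≈⟨ ≐⇒≈ (+-identityʳ-≐ _) ⟩
    1ˢ + con (+ 9) * y ∎
    where open ≈-Reasoning

  -- H is Q_2/Q, so `euler⁻-mod-9` is used at q and at q². The quotient (1 + 3L)/(1 + 3L_2) is 1 +
  -- 3(L - L_2) modulo 9.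
  euler⁺-mod-9 : N ≤ K → euler⁺ K ^ 3 ≈[ + 9 , N ] dilate 3 (euler⁺ K) * (1ˢ + con (+ 3) * Y K)
  euler⁺-mod-9 {N} {K} N≤K = *-cancelˡ (unit-dilate 2 (unit-euler⁻ K)) (begin
    Q₃ * H ^ 3 ≈⟨ *-congʳ (euler⁻-mod-9 N≤K) ⟩
    Q ^ 3 * (1ˢ + con (+ 3) * L) * H ^ 3
      ≈⟨ ≐⇒≈ (solve 3 (λ q e h → q :^ 3 :* e :* h :^ 3 := (h :* q) :^ 3 :* e) ≐-refl Q (1ˢ + con (+ 3) * L) H) ⟩
    (H * Q) ^ 3 * (1ˢ + con (+ 3) * L) ≈⟨ *-congʳ (≐⇒≈ (^-cong-≐ 3 (euler⁺*euler⁻ K))) ⟩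
    Q₂ ^ 3 * (1ˢ + con (+ 3) * L)
      ≈⟨ ≐⇒≈ (solve 1 (λ x → x := x :+ :0) ≐-refl _) ⟩
    Q₂ ^ 3 * (1ˢ + con (+ 3) * L) + 0ˢ
      -- The inserted multiple of 9 is the one that makes 1 + 3L factor as (1 + 3L_2)(1 + 3(L -
      -- L_2)).
      ≈⟨ +-congˡ (con*≈0 (+ 9) (divides 1ℤ refl) _) ⟨
    Q₂ ^ 3 * (1ˢ + con (+ 3) * L) + con (+ 9) * (Q₂ ^ 3 * (L₂ * (L - L₂)))
      ≈⟨ ≐⇒≈ (solve 3 (λ r l m → r :* (:1 :+ :con (+ 3) :* l) :+ :con (+ 9) :* (r :* (m :* (l :- m))) :=
          r :* (:1 :+ :con (+ 3) :* m) :* (:1 :+ :con (+ 3) :* (l :- m)))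
          ≐-refl (Q₂ ^ 3) L L₂) ⟩
    Q₂ ^ 3 * (1ˢ + con (+ 3) * L₂) * (1ˢ + con (+ 3) * (L - L₂)) ≈⟨ *-congʳ Q₆ ⟨
    dilate 3 (H * Q) * (1ˢ + con (+ 3) * (L - L₂)) ≈⟨ *-congʳ (≐⇒≈ (Dilate.*-homo 2 H Q)) ⟩
    dilate 3 H * Q₃ * (1ˢ + con (+ 3) * (L - L₂))
      ≈⟨ ≐⇒≈ (solve 3 (λ x y z → x :* y :* z := y :* (x :* z)) ≐-refl (dilate 3 H) Q₃ (1ˢ + con (+ 3) * (L - L₂))) ⟩
    Q₃ * (dilate 3 H * (1ˢ + con (+ 3) * (L - L₂))) ∎)
    where
    open ≈-Reasoning
    H = euler⁺ K
    Q = euler⁻ K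
    Q₂ = dilate 2 Q
    Q₃ = dilate 3 Q
    L = lambert K
    L₂ = dilate 2 L
    Q₆ : dilate 3 (H * Q) ≈[ + 9 , N ] Q₂ ^ 3 * (1ˢ + con (+ 3) * L₂)
    Q₆ = begin
      dilate 3 (H * Q)      ≈⟨ ≐⇒≈ (Dilate.cong-≐ 2 (euler⁺*euler⁻ K)) ⟩
      dilate 3 (dilate 2 Q) ≈⟨ ≐⇒≈ (≐-trans (dilate-∘ 2 1 Q) (≐-sym (dilate-∘ 1 2 Q))) ⟩
      dilate 2 (dilate 3 Q) ≈⟨ Dilate.cong-≈ 1 (euler⁻-mod-9 N≤K) ⟩
      dilate 2 (Q ^ 3 * (1ˢ + con (+ 3) * L))
        ≈⟨ ≐⇒≈ (≐-trans (Dilate.*-homo 1 _ _) (*-cong-≐ (Dilate.^-homo 1 3 Q) (≐-trans (Dilate.+-homo 1 _ _)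
             (+-cong-≐ (Dilate.con-homo 1 1ℤ) (≐-trans (Dilate.*-homo 1 _ _) (*-cong-≐ (Dilate.con-homo 1 (+ 3)) ≐-refl)))))) ⟩
      Q₂ ^ 3 * (1ˢ + con (+ 3) * L₂) ∎

  -- Cubing `euler⁺-mod-9` lifts the modulus to 27 and turns 1 + 3Y into 1 + 9Y; the cube of H_3
  -- left over combines with φ⁻_3 to ψ_3.
  euler⁺-mod-27 : N ≤ K → euler⁺ K ^ 9 * dilate 3 φ⁻ ≈[ + 27 , N ] dilate 3 ψ * (1ˢ + con (+ 9) * Y K)
  euler⁺-mod-27 {N} {K} N≤K = begin
    H ^ 9 * dilate 3 φ⁻ ≈⟨ *-congʳ (≐⇒≈ (^-* H 3 3)) ⟩
    (H ^ 3) ^ 3 * dilate 3 φ⁻ ≈⟨ *-congʳ (cube-lift (divides (+ 3) refl) (euler⁺-mod-9 N≤K)) ⟩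
    (dilate 3 H * (1ˢ + con (+ 3) * Y K)) ^ 3 * dilate 3 φ⁻
      ≈⟨ ≐⇒≈ (solve 3 (λ h y f → (h :* y) :^ 3 :* f := h :^ 3 :* f :* y :^ 3) ≐-refl (dilate 3 H) (1ˢ + con (+ 3) * Y K) (dilate 3 φ⁻)) ⟩
    dilate 3 H ^ 3 * dilate 3 φ⁻ * (1ˢ + con (+ 3) * Y K) ^ 3 ≈⟨ *-cong cubes (cube-1+3 (Y K)) ⟩
    dilate 3 ψ * (1ˢ + con (+ 9) * Y K) ∎
    where
    open ≈-Reasoning
    H = euler⁺ K
    cubes : dilate 3 H ^ 3 * dilate 3 φ⁻ ≈[ + 27 , N ] dilate 3 ψ
    cubes = begin
      dilate 3 H ^ 3 * dilate 3 φ⁻ ≈⟨ ≐⇒≈ (≐-trans (*-cong-≐ (≐-sym (Dilate.^-homo 2 3 H)) ≐-refl) (≐-sym (Dilate.*-homo 2 _ _))) ⟩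
      dilate 3 (H ^ 3 * φ⁻) ≈⟨ Dilate.cong-≈ 2 (≐⇒≈ (solve 2 (λ h f → h :^ 3 :* f := h :^ 2 :* (h :* f)) ≐-refl H φ⁻)) ⟩
      dilate 3 (H ^ 2 * (H * φ⁻)) ≈⟨ Dilate.cong-≈ 2 (*-congˡ (euler-φ⁻ N≤K)) ⟨
      dilate 3 (H ^ 2 * euler⁻ K) ≈⟨ Dilate.cong-≈ 2 (euler-ψ N≤K) ⟨
      dilate 3 ψ ∎

-- Coefficients of W at 3n and 9n + 1

module Modulo27 where
  open Lambert public
  open import Data.Nat.DivMod using (_%_; _/_; [m+kn]%n≡m%n; m*n%n≡0; m≡m%n+[m/n]*n)

  private variable
    e f g w : Series
    k : ℤ
    K M N : ℕ

  module _ {d : ℕ} .{{_ : NonZero d}} where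

    supported-∑ : ∀ {r} n {F : ℕ → Series} → (∀ i → Supported d r (F i)) → Supported d r (∑ n F)
    supported-∑ zero    s = supported λ m _ → con0-at m
    supported-∑ (suc n) s = supported-+ (supported-∑ n s) (s n)

    supported-power : ∀ {r} s n → n % d ≡ r % d → ∀ i → Supported d r (con s ^ i * q ^ n)
    supported-power s n eq i = supported-mod
      (trans (cong₂ (λ x y → (x ℕ.+ y) % d) (ℕ.*-zeroʳ i) (ℕ.*-identityʳ n)) eq)
      (supported-* (supported-^ i (supported-con s)) (supported-^ n supported-q))

  φ⁻-off : Series
  φ⁻-off = φ⁻ - dilate 9 φ⁻

  φ⁻-3-dissection : φ⁻ ≐ dilate 9 φ⁻ + φ⁻-off
  φ⁻-3-dissection = solve 2 (λ x y → x := y :+ (x :- y)) ≐-refl φ⁻ (dilate 9 φ⁻)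

  -- Indices divisible by 3 make up φ⁻_9, and n² ≡ 1 modulo 3 for all others. Each coefficient is
  -- read off from a truncation just past it.
  supported-φ⁻-off : Supported 3 1 φ⁻-off
  supported-φ⁻-off = supported λ m m≢1 → trans (≈⇒≡ (approx (suc m)) m ℕ.≤-refl)
    (vanish (supported-* (supported-con (+ 2)) (supported-∑ (suc m) λ j →
      supported-+ (supported-θ {j} 1 (one j)) (supported-θ {j} 2 (two j)))) m m≢1)
    where
    open ≈-Reasoning
    one : ∀ j → (j ℕ.* 3 ℕ.+ 1) ℕ.* (j ℕ.* 3 ℕ.+ 1) % 3 ≡ 1
    one j = trans (cong (_% 3) (eq j)) ([m+kn]%n≡m%n 1 (j ℕ.* j ℕ.* 3 ℕ.+ j ℕ.* 2) 3)
      where eq : ∀ j → (j ℕ.* 3 ℕ.+ 1) ℕ.* (j ℕ.* 3 ℕ.+ 1) ≡ 1 ℕ.+ (j ℕ.* j ℕ.* 3 ℕ.+ j ℕ.* 2) ℕ.* 3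
            eq = ℕ.solve-∀
    two : ∀ j → (j ℕ.* 3 ℕ.+ 2) ℕ.* (j ℕ.* 3 ℕ.+ 2) % 3 ≡ 1
    two j = trans (cong (_% 3) (eq j)) ([m+kn]%n≡m%n 1 (j ℕ.* j ℕ.* 3 ℕ.+ j ℕ.* 4 ℕ.+ 1) 3)
      where eq : ∀ j → (j ℕ.* 3 ℕ.+ 2) ℕ.* (j ℕ.* 3 ℕ.+ 2) ≡ 1 ℕ.+ (j ℕ.* j ℕ.* 3 ℕ.+ j ℕ.* 4 ℕ.+ 1) ℕ.* 3
            eq = ℕ.solve-∀
    supported-θ : ∀ {j} r → (j ℕ.* 3 ℕ.+ r) ℕ.* (j ℕ.* 3 ℕ.+ r) % 3 ≡ 1 → Supported 3 1 (θ-term -1ℤ (j ℕ.* 3 ℕ.+ r))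
    supported-θ {j} r eq = supported-power {r = 1} -1ℤ ((j ℕ.* 3 ℕ.+ r) ℕ.* (j ℕ.* 3 ℕ.+ r)) eq (j ℕ.* 3 ℕ.+ r)
    Θ : Series
    Θ = ∑∞ (θ-term -1ℤ)
    R₁ R₂ : ℕ → Series
    R₁ j = θ-term -1ℤ (j ℕ.* 3 ℕ.+ 1)
    R₂ j = θ-term -1ℤ (j ℕ.* 3 ℕ.+ 2)
    multiple : ∀ j → θ-term -1ℤ (j ℕ.* 3 ℕ.+ 0) ≐ dilate 9 (θ-term -1ℤ j)
    multiple j = ≐-trans (*-cong-≐ signs powers) (≐-sym (Dilate.*-homo 8 _ _))
      where
      signs : con -1ℤ ^ (j ℕ.* 3 ℕ.+ 0) ≐ dilate 9 (con -1ℤ ^ j)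
      signs = subst (λ e → con -1ℤ ^ e ≐ dilate 9 (con -1ℤ ^ j)) (sym (ℕ.+-identityʳ (j ℕ.* 3)))
        (≐-trans (^-* (con -1ℤ) j 3) (≐-trans (^-cong-≐ j (≐-trans (solve 0 (:con -1ℤ :^ 3 := :con -1ℤ) ≐-refl) (≐-sym (Dilate.con-homo 8 -1ℤ))))
          (≐-sym (Dilate.^-homo 8 j (con -1ℤ)))))
      powers : q ^ ((j ℕ.* 3 ℕ.+ 0) ℕ.* (j ℕ.* 3 ℕ.+ 0)) ≐ dilate 9 (q ^ (j ℕ.* j))
      powers = ≐-sym (subst (λ e → dilate 9 (q ^ (j ℕ.* j)) ≐ q ^ e) (eq j) (dilate-q^ 8 (j ℕ.* j)))
        where eq : ∀ j → j ℕ.* j ℕ.* 9 ≡ (j ℕ.* 3 ℕ.+ 0) ℕ.* (j ℕ.* 3 ℕ.+ 0)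
              eq = ℕ.solve-∀
    split : ∀ N → Θ ≈[ 0ℤ , N ] dilate 9 Θ + ∑ N (λ j → R₁ j + R₂ j)
    split N = begin
      Θ ≈⟨ ∑∞-≈∑ (θ-order -1ℤ) (ℕ.m≤m*n N 3) ⟩
      ∑ (N ℕ.* 3) (θ-term -1ℤ) ≈⟨ ≐⇒≈ (∑-block 3 N (θ-term -1ℤ)) ⟩
      ∑ N (λ j → 0ˢ + θ-term -1ℤ (j ℕ.* 3 ℕ.+ 0) + R₁ j + R₂ j)
        ≈⟨ ∑-cong N (λ j → ≐⇒≈ (≐-trans (solve 3 (λ x y z → :0 :+ x :+ y :+ z := x :+ (y :+ z))
            ≐-refl (θ-term -1ℤ (j ℕ.* 3 ℕ.+ 0)) (R₁ j) (R₂ j))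
             (+-cong-≐ (multiple j) ≐-refl))) ⟩
      ∑ N (λ j → dilate 9 (θ-term -1ℤ j) + (R₁ j + R₂ j)) ≈⟨ ∑-distrib-+ N _ _ ⟩
      ∑ N (λ j → dilate 9 (θ-term -1ℤ j)) + ∑ N (λ j → R₁ j + R₂ j) ≈⟨ +-congʳ (∑∞-dilate 8 (θ-order -1ℤ) ℕ.≤-refl) ⟨
      dilate 9 Θ + ∑ N (λ j → R₁ j + R₂ j) ∎
    approx : ∀ N → φ⁻-off ≈[ 0ℤ , N ] con (+ 2) * ∑ N (λ j → R₁ j + R₂ j)
    approx N = begin
      (con (+ 2) * Θ - 1ˢ) - dilate 9 (con (+ 2) * Θ - 1ˢ)
        ≈⟨ ≈-refl -cong ≐⇒≈ (≐-trans (Dilate.minus-homo 8 _ _) (+-cong-≐ (≐-trans (Dilate.*-homo 8 _ _) (*-cong-≐ (Dilate.con-homo 8 (+ 2)) ≐-refl)) (-‿cong-≐ (Dilate.con-homo 8 1ℤ)))) ⟩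
      (con (+ 2) * Θ - 1ˢ) - (con (+ 2) * dilate 9 Θ - 1ˢ)
        ≈⟨ ≐⇒≈ (solve 2 (λ x y → (:con (+ 2) :* x :- :1) :- (:con (+ 2) :* y :- :1) := :con (+ 2) :* (x :- y)) ≐-refl Θ (dilate 9 Θ)) ⟩
      con (+ 2) * (Θ - dilate 9 Θ) ≈⟨ *-congˡ (split N -cong ≈-refl) ⟩
      con (+ 2) * (dilate 9 Θ + ∑ N (λ j → R₁ j + R₂ j) - dilate 9 Θ)
        ≈⟨ ≐⇒≈ (solve 2 (λ x y → :con (+ 2) :* (x :+ y :- x) := :con (+ 2) :* y) ≐-refl (dilate 9 Θ) (∑ N (λ j → R₁ j + R₂ j))) ⟩
      con (+ 2) * ∑ N (λ j → R₁ j + R₂ j) ∎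

  supported-dilate₉ : ∀ f → Supported 3 0 (dilate 9 f)
  supported-dilate₉ f = supported-≐ (dilate-∘ 2 2 f) (supported-dilate 2 (dilate 3 f))

  n*3%3 : ∀ n {r} → 0 ≢ r → n ℕ.* 3 % 3 ≢ r
  n*3%3 n 0≢r eq = 0≢r (trans (sym (m*n%n≡0 n 3)) eq)

  -- After the factor q the two parts have exponents 1 and 2 modulo 3, never 0.
  at-multiple-of-3 : f ≐ dilate 9 f + e → Supported 3 1 e → ∀ n → at (q * (dilate 3 g * f)) (n ℕ.* 3) ≡ 0ℤ
  at-multiple-of-3 {f} {e} {g} split off n = trans
    (coeff= (≐-trans (*-congˡ-≐ {f′ = q} (*-congˡ-≐ {f′ = dilate 3 g} split))
      (solve 4 (λ q g f e → q :* (g :* (f :+ e)) := q :* (g :* f) :+ q :* (g :* e)) ≐-refl q (dilate 3 g) (dilate 9 f) e)) (n ℕ.* 3))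
    (cong₂ ℤ._+_
      (vanish (supported-* supported-q (supported-* (supported-dilate 2 g) (supported-dilate₉ f))) (n ℕ.* 3) (n*3%3 n λ ()))
      (vanish (supported-* supported-q (supported-* (supported-dilate 2 g) off)) (n ℕ.* 3) (n*3%3 n λ ())))

  -- Without the factor q the exponent is divisible by 3. There the part carried by `e` drops out,
  -- and what is left is a series in q³.
  at-9k+1 : f ≐ dilate 9 f + e → Supported 3 1 e → ∀ n → at (q * (dilate 3 g * f)) (suc (n ℕ.* 3 ℕ.* 3)) ≡ at (g * dilate 3 f) (n ℕ.* 3)
  at-9k+1 {f} {e} {g} split off n = begin
    at (q * (dilate 3 g * f)) (suc (n ℕ.* 3 ℕ.* 3)) ≡⟨ q*-suc (dilate 3 g * f) (n ℕ.* 3 ℕ.* 3) ⟩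
    at (dilate 3 g * f) (n ℕ.* 3 ℕ.* 3)
      ≡⟨ coeff= (≐-trans (*-congˡ-≐ {f′ = dilate 3 g} split) (≐-trans (solve 3 (λ g f e → g :* (f :+ e) := g :* f :+ g :* e)
          ≐-refl (dilate 3 g) (dilate 9 f) e)
           (+-cong-≐ (≐-trans (*-congˡ-≐ (≐-sym (dilate-∘ 2 2 f))) (≐-sym (Dilate.*-homo 2 g (dilate 3 f)))) ≐-refl))) (n ℕ.* 3 ℕ.* 3) ⟩
    at (dilate 3 (g * dilate 3 f)) (n ℕ.* 3 ℕ.* 3) ℤ.+ at (dilate 3 g * e) (n ℕ.* 3 ℕ.* 3)
      ≡⟨ cong₂ ℤ._+_ (dilate-at 3 (g * dilate 3 f) (n ℕ.* 3)) (vanish (supported-* (supported-dilate 2 g) off) (n ℕ.* 3 ℕ.* 3) (n*3%3 (n ℕ.* 3) λ ())) ⟩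
    at (g * dilate 3 f) (n ℕ.* 3) ℤ.+ 0ℤ ≡⟨ ℤ.+-identityʳ _ ⟩
    at (g * dilate 3 f) (n ℕ.* 3) ∎
    where open ≡-Reasoning

  W-multiple-of-3 : ∀ n → at W (n ℕ.* 3) ≡[ + 27 ] 0ℤ
  W-multiple-of-3 n = []-trans (coeff (W-mod-27 {K = suc (n ℕ.* 3)} ℕ.≤-refl) (n ℕ.* 3) ℕ.≤-refl)
    (≡⇒≡[] (at-multiple-of-3 {g = euler⁺ (suc (n ℕ.* 3)) ^ 9} φ⁻-3-dissection supported-φ⁻-off n))

  -- A weak form of avoiding exponents divisible by 3: their coefficients need only vanish modulo 3.
  -- It measures the error in σ(3n) ≡ σ(n).
  record Off (f : Series) : Set where
    constructor off
    field at-3n : ∀ n → at f (n ℕ.* 3) ≡[ + 3 ] 0ℤ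
  open Off

  off-+ : Off f → Off g → Off (f + g)
  off-+ (off p) (off r) = off λ n → []-+ (p n) (r n)

  off-neg : Off f → Off (- f)
  off-neg (off p) = off λ n → []-neg (p n)

  off-∑ : ∀ n {F : ℕ → Series} → (∀ i → Off (F i)) → Off (∑ n F)
  off-∑ zero    p = off λ n → ≡⇒≡[] (con0-at (n ℕ.* 3))
  off-∑ (suc n) p = off-+ (off-∑ n p) (p n)

  off-supported : ∀ {r} → 0 ≢ r % 3 → Supported 3 r f → Off f
  off-supported 0≢r s = off λ n → ≡⇒≡[] (vanish s (n ℕ.* 3) (n*3%3 n 0≢r))

  off-con* : ∀ c f → + 3 ∣ c → Off (con c * f)
  off-con* c f 3∣c = off λ n → []-trans (≡⇒≡[] (con-* c f (n ℕ.* 3))) (∣⇒≡[] (∣m⇒∣m*n (at f (n ℕ.* 3)) 3∣c))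

  off-*ˡ : ∀ c → Off f → Off (con c * f)
  off-*ˡ {f} c (off p) = off λ n → []-trans (≡⇒≡[] (con-* c f (n ℕ.* 3)))
    ([]-trans ([]-* (≡⇒≡[] {a = c} refl) (p n)) (≡⇒≡[] (ℤ.*-zeroʳ c)))

  Σ<-≡[]0 : ∀ n {F : ℕ → ℤ} → (∀ i → i < n → F i ≡[ k ] 0ℤ) → Σ< n F ≡[ k ] 0ℤ
  Σ<-≡[]0 n p = []-trans (Σ<-≡[] n p) (≡⇒≡[] (Σ<-zero n λ _ _ → refl))

  -- In a coefficient at 3n the dilated factor takes only indices divisible by 3, which leaves such
  -- an index for `f`.
  off-dilate-* : ∀ g → Off f → Off (dilate 3 g * f)
  off-dilate-* {f} g (off p) = off λ n → Σ<-≡[]0 (suc (n ℕ.* 3)) λ { i (s≤s i≤3n) → term n i i≤3n }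
    where
    term : ∀ n i → i ≤ n ℕ.* 3 → at (dilate 3 g) i ℤ.* at f (n ℕ.* 3 ∸ i) ≡[ + 3 ] 0ℤ
    term n i i≤3n with i % 3 ℕ.≟ 0
    ... | no  i≢0 = ≡⇒≡[] (trans (cong (ℤ._* at f (n ℕ.* 3 ∸ i)) (dilate-off 3 g i i≢0)) (ℤ.*-zeroˡ (at f (n ℕ.* 3 ∸ i))))
    ... | yes i≡0 = []-trans ([]-* (≡⇒≡[] {a = at (dilate 3 g) i} refl) (subst (λ e → at f e ≡[ + 3 ] 0ℤ) (sym index) (p (n ∸ i / 3))))
                      (≡⇒≡[] (ℤ.*-zeroʳ (at (dilate 3 g) i)))
      where
      index : n ℕ.* 3 ∸ i ≡ (n ∸ i / 3) ℕ.* 3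
      index = trans (cong (n ℕ.* 3 ∸_) (trans (m≡m%n+[m/n]*n i 3) (cong (ℕ._+ i / 3 ℕ.* 3) i≡0))) (sym (ℕ.*-distribʳ-∸ 3 n (i / 3)))

  -- For odd n the exponent 3n is odd and does not occur; for n = 2t the coefficient is that of `f`
  -- at 3t.
  off-dilate₂ : Off f → Off (dilate 2 f)
  off-dilate₂ {f} (off p) = off λ n → term n (n % 2) (n / 2) (m≡m%n+[m/n]*n n 2) refl
    where
    even : ∀ t → t ℕ.* 2 ℕ.* 3 ≡ t ℕ.* 3 ℕ.* 2
    even = ℕ.solve-∀
    term : ∀ n r t → n ≡ r ℕ.+ t ℕ.* 2 → n % 2 ≡ r → at (dilate 2 f) (n ℕ.* 3) ≡[ + 3 ] 0ℤ
    term n zero t refl _ = []-trans (≡⇒≡[] (trans (cong (at (dilate 2 f)) (even t)) (dilate-at 2 f (t ℕ.* 3)))) (p t)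
    term n (suc r) t n≡ n%2 = ≡⇒≡[] (dilate-off 2 f (n ℕ.* 3) λ eq → parity r n%2 eq)
      where
      double : ∀ n → n ℕ.* 3 ≡ n ℕ.+ n ℕ.* 2
      double = ℕ.solve-∀
      parity : ∀ r → n % 2 ≡ suc r → n ℕ.* 3 % 2 ≢ 0
      parity r n%2 eq = ℕ.1+n≢0 (trans (sym n%2) (trans (sym ([m+kn]%n≡m%n n n 2)) (trans (cong (_% 2) (sym (double n))) eq)))

  -- In the summand (j + 1) q^((n+1)(j+1)) either 3 divides j + 1, killing the coefficient modulo 3,
  -- or the exponent is prime to 3.
  lambert-off : ∀ K n → ¬ 3 ℕ∣.∣ suc n → Off (lambert-term K n)
  lambert-off K n 3∤n = off-∑ K term
    where
    term : ∀ j → Off (con (+ suc j) * (q ^ suc n) ^ suc j)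
    term j with 3 ℕ∣.∣? suc j
    ... | yes 3∣j = off-con* (+ suc j) _ (∣ᵤ⇒∣ 3∣j)
    ... | no  3∤j = off-*ˡ (+ suc j) (off-supported nonzero (supported-≐ (^-* q (suc j) (suc n)) (supported-^ (suc j ℕ.* suc n) supported-q)))
      where
      nonzero : 0 ≢ (suc j ℕ.* suc n ℕ.* 1) % 3
      nonzero eq with euclidsLemma (suc j) (suc n) (from-yes (prime? 3)) (ℕ∣.m%n≡0⇒n∣m _ 3 (trans (cong (_% 3) (sym (ℕ.*-identityʳ (suc j ℕ.* suc n)))) (sym eq)))
      ... | inj₁ 3∣j = 3∤j 3∣j
      ... | inj₂ 3∣n = 3∤n 3∣n

  lambert-term-order : ∀ K n → lambert-term K n ≈[ k , n ] 0ˢ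
  lambert-term-order {k} K n = go K
    where
    term : ∀ j → con (+ suc j) * (q ^ suc n) ^ suc j ≈[ k , n ] 0ˢ
    term j = ≈-trans (≐⇒≈ (solve 3 (λ c x y → c :* (x :* y) := x :* (c :* y)) ≐-refl (con (+ suc j)) (q ^ suc n) ((q ^ suc n) ^ j)))
      (order-weaken _ (≈-weaken (ℕ.n≤1+n n) (order-q^ (suc n))))
    go : ∀ K → ∑ K (λ j → con (+ suc j) * (q ^ suc n) ^ suc j) ≈[ k , n ] 0ˢ
    go zero    = ≈-refl
    go (suc K) = ≈-trans (+-cong (go K) (term K)) (≐⇒≈ (solve 0 (:0 :+ :0 := :0) ≐-refl))

  module _ (N : ℕ) where
    private
      -- The inner cutoff stays at 3N although the outer one is N. In this way the terms of
      -- `lambert (N * 3)` with outer index divisible by 3 are exactly the dilated terms of `L′`,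
      -- while `L′` still agrees with the whole sum modulo q^N.
      L′ rest : Series
      L′ = ∑ N (lambert-term (N ℕ.* 3))
      rest = ∑ N (λ j → lambert-term (N ℕ.* 3) (j ℕ.* 3 ℕ.+ 0) + lambert-term (N ℕ.* 3) (j ℕ.* 3 ℕ.+ 1))

      L′≈ : lambert (N ℕ.* 3) ≈[ k , N ] L′
      L′≈ = ≈-trans (≈-sym (∑∞-≈∑ (lambert-term-order (N ℕ.* 3)) (ℕ.m≤m*n N 3))) (∑∞-≈∑ (lambert-term-order (N ℕ.* 3)) ℕ.≤-refl)

      off-rest : Off rest
      off-rest = off-∑ N λ j → off-+ (lambert-off (N ℕ.* 3) (j ℕ.* 3 ℕ.+ 0) (not j 0 λ ())) (lambert-off (N ℕ.* 3) (j ℕ.* 3 ℕ.+ 1) (not j 1 λ ()))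
        where
        not : ∀ j r → suc r % 3 ≢ 0 → ¬ 3 ℕ∣.∣ suc (j ℕ.* 3 ℕ.+ r)
        not j r r≢0 3∣ = r≢0 (trans (sym ([m+kn]%n≡m%n (suc r) j 3))
          (trans (cong (_% 3) (cong suc (ℕ.+-comm r (j ℕ.* 3)))) (ℕ∣.n∣m⇒m%n≡0 _ 3 3∣)))

      multiple : ∀ j → lambert-term (N ℕ.* 3) (j ℕ.* 3 ℕ.+ 2) ≐ dilate 3 (lambert-term (N ℕ.* 3) j)
      multiple j = ≈⇒≐ λ M → ≈-trans (∑-cong (N ℕ.* 3) λ i → ≐⇒≈ (≐-trans (*-cong-≐ (≐-sym (Dilate.con-homo 2 _)) (≐-trans
          (^-cong-≐ (suc i) (≐-sym (subst (λ e → dilate 3 (q ^ suc j) ≐ q ^ e) (eq j) (dilate-q^ 2 (suc j)))))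
          (≐-sym (Dilate.^-homo 2 (suc i) (q ^ suc j))))) (≐-sym (Dilate.*-homo 2 _ _))))
        (≐⇒≈ (≐-sym (Dilate.∑-homo 2 (N ℕ.* 3) _)))
        where
        eq : ∀ j → suc j ℕ.* 3 ≡ suc (j ℕ.* 3 ℕ.+ 2)
        eq = ℕ.solve-∀

      L-split : lambert (N ℕ.* 3) ≐ dilate 3 L′ + rest
      L-split = ≈⇒≐ λ M → begin
        lambert (N ℕ.* 3) ≈⟨ ≐⇒≈ (∑-block 3 N _) ⟩
        ∑ N (λ j → 0ˢ + l (j ℕ.* 3 ℕ.+ 0) + l (j ℕ.* 3 ℕ.+ 1) + l (j ℕ.* 3 ℕ.+ 2))
          ≈⟨ ∑-cong N (λ j → ≐⇒≈ (≐-trans (solve 3 (λ x y z → :0 :+ x :+ y :+ z := z :+ (x :+ y))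
              ≐-refl (l (j ℕ.* 3 ℕ.+ 0)) (l (j ℕ.* 3 ℕ.+ 1)) (l (j ℕ.* 3 ℕ.+ 2)))
               (+-cong-≐ (multiple j) ≐-refl))) ⟩
        ∑ N (λ j → dilate 3 (l j) + (l (j ℕ.* 3 ℕ.+ 0) + l (j ℕ.* 3 ℕ.+ 1))) ≈⟨ ∑-distrib-+ N _ _ ⟩
        ∑ N (λ j → dilate 3 (l j)) + rest ≈⟨ +-congʳ (≐⇒≈ (Dilate.∑-homo 2 N _)) ⟨
        dilate 3 L′ + rest ∎
        where
        open ≈-Reasoning
        l = lambert-term (N ℕ.* 3)

      Y-split : dilate 3 ψ * Y (N ℕ.* 3) ≐ dilate 3 (ψ * (L′ - dilate 2 L′)) + dilate 3 ψ * (rest - dilate 2 rest)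
      Y-split = begin
        dilate 3 ψ * (lambert (N ℕ.* 3) - dilate 2 (lambert (N ℕ.* 3)))
          ≈⟨ *-congˡ-≐ (+-cong-≐ L-split (-‿cong-≐ (≐-trans (Dilate.cong-≐ 1 L-split) (≐-trans (Dilate.+-homo 1 _ _)
               (+-cong-≐ (≐-trans (dilate-∘ 1 2 L′) (≐-sym (dilate-∘ 2 1 L′))) ≐-refl))))) ⟩
        dilate 3 ψ * ((dilate 3 L′ + rest) - (dilate 3 (dilate 2 L′) + dilate 2 rest))
          ≈⟨ solve 5 (λ p x y z w → p :* ((x :+ y) :- (z :+ w)) := p :* (x :- z) :+ p :* (y :- w))
              ≐-refl (dilate 3 ψ) (dilate 3 L′) rest (dilate 3 (dilate 2 L′)) (dilate 2 rest) ⟩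
        dilate 3 ψ * (dilate 3 L′ - dilate 3 (dilate 2 L′)) + dilate 3 ψ * (rest - dilate 2 rest)
          ≈⟨ +-cong-≐ (≐-trans (*-congˡ-≐ (≐-sym (Dilate.minus-homo 2 _ _))) (≐-sym (Dilate.*-homo 2 _ _))) ≐-refl ⟩
        dilate 3 (ψ * (L′ - dilate 2 L′)) + dilate 3 ψ * (rest - dilate 2 rest) ∎
        where open ≐-Reasoning

      D-ψ′ : D ψ ≈[ + 3 , N ] ψ * (L′ - dilate 2 L′)
      D-ψ′ = ≈-trans (D-ψ (ℕ.m≤m*n N 3)) (*-congˡ (L′≈ -cong Dilate.cong-≈ 1 L′≈))

      split-at : ∀ {x y z} → x ≐ dilate 3 y + z → Off z → ∀ n → at x (n ℕ.* 3) ≡[ + 3 ] at y n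
      split-at {x} {y} p (off r) n = []-trans (≡⇒≡[] (coeff= p (n ℕ.* 3)))
        ([]-trans ([]-+ (≡⇒≡[] (dilate-at 3 y n)) (r n)) (≡⇒≡[] (ℤ.+-identityʳ (at y n))))

    -- Taking every third coefficient contracts ψ_3 to ψ and, by σ(3n) ≡ σ(n), reproduces Y modulo
    -- 3. The resulting ψY is Dψ, with coefficients nψ(n).
    ψY-at : ∀ n → n < N → at (dilate 3 ψ * Y (N ℕ.* 3)) (n ℕ.* 3) ≡[ + 3 ] + n ℤ.* at ψ n
    ψY-at n n<N = []-trans
      (split-at {dilate 3 ψ * Y (N ℕ.* 3)} {ψ * (L′ - dilate 2 L′)} {dilate 3 ψ * (rest - dilate 2 rest)} Y-split
        (off-dilate-* ψ (off-+ off-rest (off-neg (off-dilate₂ off-rest)))) n)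
      ([]-sym (coeff D-ψ′ n n<N))

  1+9-at : ∀ f y n → at (dilate 3 f * (1ˢ + con (+ 9) * y)) (n ℕ.* 3) ≡ at f n ℤ.+ + 9 ℤ.* at (dilate 3 f * y) (n ℕ.* 3)
  1+9-at f y n = trans
    (coeff= (solve 2 (λ f y → f :* (:1 :+ :con (+ 9) :* y) := f :+ :con (+ 9) :* (f :* y)) ≐-refl (dilate 3 f) y) (n ℕ.* 3))
    (cong₂ ℤ._+_ (dilate-at 3 f n) (con-* (+ 9) (dilate 3 f * y) (n ℕ.* 3)))

  W-9n+1 : ∀ n → at ψ n ≡ 0ℤ → at W (suc (n ℕ.* 3 ℕ.* 3)) ≡[ + 27 ] 0ℤ
  W-9n+1 n ψn≡0 = []-trans (coeff (W-mod-27 {b} {b ℕ.* 3} (ℕ.m≤m*n b 3)) (suc (n ℕ.* 3 ℕ.* 3)) ℕ.≤-refl)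
    ([]-trans (≡⇒≡[] (at-9k+1 {g = euler⁺ (b ℕ.* 3) ^ 9} φ⁻-3-dissection supported-φ⁻-off n))
    ([]-trans (coeff (euler⁺-mod-27 {b} {b ℕ.* 3} (ℕ.m≤m*n b 3)) (n ℕ.* 3) 3n<b)
    ([]-trans (≡⇒≡[] (1+9-at ψ (Y (b ℕ.* 3)) n))
    -- The correction carries a factor 9, so its coefficient has to be known only modulo 3.
    ([]-trans ([]-+ (≡⇒≡[] ψn≡0) (∣⇒≡[] (*-monoʳ-∣ (+ 9) (≡[]⇒∣ ([]-trans (ψY-at b n n<b) (≡⇒≡[] (trans (cong (+ n ℤ.*_) ψn≡0) (ℤ.*-zeroʳ (+ n)))))))))
      (≡⇒≡[] refl)))))
    where
    -- The precision must exceed the exponent 9n + 1, and the products are cut at 3b because `ψY-at`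
    -- works with a cutoff divisible by 3.
    b : ℕ
    b = suc (suc (n ℕ.* 3 ℕ.* 3))
    3n<b : n ℕ.* 3 < b
    3n<b = s≤s (ℕ.m≤n⇒m≤1+n (ℕ.m≤m*n (n ℕ.* 3) 3))
    n<b : n < b
    n<b = ℕ.≤-<-trans (ℕ.m≤m*n n 3) 3n<b

  q^-off : ∀ t n → t ≢ n → at (q ^ t) n ≡ 0ℤ
  q^-off zero    zero    t≢n = contradiction refl t≢n
  q^-off zero    (suc n) t≢n = refl
  q^-off (suc t) zero    t≢n = q*-zero (q ^ t)
  q^-off (suc t) (suc n) t≢n = trans (q*-suc (q ^ t) n) (q^-off t n λ t≡n → t≢n (cong suc t≡n))

-- Nonsquares and the three families of indices

open Modulo27 hiding (_+_; _*_; _^_; _-_; -_)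
open import Data.Nat.Base using (_+_; _*_; _^_)
open import Data.Nat.DivMod using (_%_; m≡m%n+[m/n]*n; m%n<n; [m+kn]%n≡m%n; m*n/n≡m) renaming (_/_ to _/ℕ_)
open import Data.Integer.DivMod using (_/_)

NonSquare : ℕ → Set
NonSquare x = ∀ s → x ≢ s * s

-- An exponent of ψ is a triangular number T_t, and 8T_t + 1 = (2t + 1)².
ψ-nonsquare : ∀ n → NonSquare (suc (n * 8)) → at ψ n ≡ 0ℤ
ψ-nonsquare n nonsquare = trans (∑-at (suc n) ψ-term n) (Defs.Σ<-zero (suc n) λ t _ → q^-off (triangle t) n λ eq →
  nonsquare (suc (t * 2)) (trans (cong (λ e → suc (e * 8)) (sym eq)) (trans (eq₁ (triangle t))
    (trans (cong (λ e → suc (e * 4)) (triangle-double t)) (eq₂ t)))))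
  where
  eq₁ : ∀ t → suc (t * 8) ≡ suc (t * 2 * 4)
  eq₁ = ℕ.solve-∀
  eq₂ : ∀ t → suc (t * suc t * 4) ≡ suc (t * 2) * suc (t * 2)
  eq₂ = ℕ.solve-∀

prime∣square : ∀ {p} s → Prime p → p ℕ∣.∣ s * s → p ℕ∣.∣ s
prime∣square s prime-p p∣s² = [ id , id ]′ (euclidsLemma s s prime-p p∣s²)

p²-nonsquare : ∀ {p x} → Prime p → NonSquare x → NonSquare (p * p * x)
p²-nonsquare {p} {x} prime-p nonsquare s eq = case square⇒∣ of λ { (ℕ∣.divides-refl t) → nonsquare t
  (ℕ.*-cancelˡ-≡ x (t * t) (p * p) {{ℕ.m*n≢0 p p}} (trans eq (rearrange t p))) }
  where
  instance _ = prime⇒nonZero prime-p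
  rearrange : ∀ t p → t * p * (t * p) ≡ p * p * (t * t)
  rearrange = ℕ.solve-∀
  assoc : ∀ p x → p * p * x ≡ p * x * p
  assoc = ℕ.solve-∀
  square⇒∣ : p ℕ∣.∣ s
  square⇒∣ = prime∣square s prime-p (ℕ∣.divides (p * x) (trans (sym eq) (assoc p x)))

27∣v₀ : ∀ n → at ψ n ≡ 0ℤ → at W n ≡[ + 27 ] 0ℤ → + 27 ∣ v₀ (suc (n * 8) * 2 * 2)
27∣v₀ n ψ≡0 W≡0 = ≡[]⇒∣ ([]-trans (≡⇒≡[] (v₀-8n+1 n))
  ([]-trans ([]-+ (≡⇒≡[] (cong (+ 3 ℤ.*_) ψ≡0)) ([]-* (≡⇒≡[] {a = + 512} refl) W≡0)) (≡⇒≡[] refl)))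

-- 24n + 1 = 8(3n) + 1 places the index of `W` at a multiple of 3.
27∣v₀-24n+1 : ∀ x n → x ≡ suc (n * 24) → NonSquare x → + 27 ∣ v₀ (x * 2 * 2)
27∣v₀-24n+1 x n x≡ nonsquare = subst (λ e → + 27 ∣ v₀ (e * 2 * 2)) (sym x≡′)
  (27∣v₀ (n * 3) (ψ-nonsquare (n * 3) (subst NonSquare x≡′ nonsquare)) (W-multiple-of-3 n))
  where
  eq : ∀ n → suc (n * 24) ≡ suc (n * 3 * 8)
  eq = ℕ.solve-∀
  x≡′ = trans x≡ (eq n)

-- 9(8n + 1) = 8(9n + 1) + 1 places the index of `W` at 9n + 1. Vanishing of ψ is used twice: at 9n
-- + 1 for the term 3ψ, and at n for the residue of `W`.
27∣v₀-9[8n+1] : ∀ x n → x ≡ suc (n * 8) → NonSquare x → + 27 ∣ v₀ (3 * 3 * x * 2 * 2)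
27∣v₀-9[8n+1] x n x≡ nonsquare = subst (λ e → + 27 ∣ v₀ (e * 2 * 2)) (sym 9x≡)
  (27∣v₀ (suc (n * 3 * 3))
    (ψ-nonsquare (suc (n * 3 * 3)) (subst NonSquare 9x≡ (p²-nonsquare (from-yes (prime? 3)) nonsquare)))
    (W-9n+1 n (ψ-nonsquare n (subst NonSquare x≡ nonsquare))))
  where
  eq : ∀ n → 3 * 3 * suc (n * 8) ≡ suc (suc (n * 3 * 3) * 8)
  eq = ℕ.solve-∀
  9x≡ = trans (cong (3 * 3 *_) x≡) (eq n)

p^2α : ∀ p α x → p ^ (2 * suc α) * x ≡ p * p * (p ^ (2 * α) * x)
p^2α p α x = trans (cong (λ e → p ^ e * x) (ℕ.*-suc 2 α)) (assoc p (p ^ (2 * α)) x)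
  where
  assoc : ∀ p y x → p * (p * y) * x ≡ p * p * (y * x)
  assoc = ℕ.solve-∀

p^2α-nonsquare : ∀ {p x} → Prime p → ∀ α → NonSquare x → NonSquare (p ^ (2 * α) * x)
p^2α-nonsquare {p} {x} prime-p zero    nonsquare = subst NonSquare (sym (ℕ.*-identityˡ x)) nonsquare
p^2α-nonsquare {p} {x} prime-p (suc α) nonsquare =
  subst NonSquare (sym (p^2α p α x)) (p²-nonsquare prime-p (p^2α-nonsquare prime-p α nonsquare))

-- The modulus is left open: 24 serves p ≥ 5 and 8 serves p = 3.
≡1mod-p² : ∀ d p α n → (∃[ u ] p * p ≡ suc (u * d)) → ∃[ m ] p ^ (2 * α) * suc (n * d) ≡ suc (m * d)
≡1mod-p² d p zero    n _ = n , ℕ.*-identityˡ (suc (n * d))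
≡1mod-p² d p (suc α) n (u , p²≡) with ≡1mod-p² d p α n (u , p²≡)
... | m , eq = u + m + u * m * d , trans (p^2α p α (suc (n * d))) (trans (cong₂ _*_ p²≡ eq) (expand u m d))
  where
  expand : ∀ u m d → suc (u * d) * suc (m * d) ≡ suc ((u + m + u * m * d) * d)
  expand = ℕ.solve-∀

prime∤ : ∀ {p d} → Prime p → 2 ≤ d → d < p → ¬ d ℕ∣.∣ p
prime∤ prime-p 2≤d d<p d∣p with prime⇒irreducible prime-p d∣p
... | inj₁ refl = contradiction 2≤d (ℕ.<⇒≱ (s≤s (s≤s z≤n)))
... | inj₂ refl = ℕ.<-irrefl refl d<p

-- By a finite check each residue modulo 24 is even, divisible by 3, or has square 1. The first two
-- properties pass from the residue to p because 2 and 3 divide 24.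
p²≡1mod24 : ∀ p → Prime p → 5 ≤ p → ∃[ u ] p * p ≡ suc (u * 24)
p²≡1mod24 p prime-p 5≤p with residues (m%n<n p 24)
  where
  residues : ∀ {r} → r < 24 → r % 2 ≡ 0 ⊎ r % 3 ≡ 0 ⊎ r * r % 24 ≡ 1
  residues = from-yes (ℕ.allUpTo? (λ r → (r % 2 ℕ.≟ 0) ⊎-dec (r % 3 ℕ.≟ 0) ⊎-dec (r * r % 24 ℕ.≟ 1)) 24)
... | inj₁ 2∣r = contradiction (subst (2 ℕ∣.∣_) (sym (m≡m%n+[m/n]*n p 24)) (ℕ∣.∣m∣n⇒∣m+n (ℕ∣.m%n≡0⇒n∣m (p % 24) 2 2∣r) (ℕ∣.∣n⇒∣m*n (p /ℕ 24) (ℕ∣.divides 12 refl))))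
                   (prime∤ prime-p (s≤s (s≤s z≤n)) (ℕ.<-≤-trans (s≤s (s≤s (s≤s z≤n))) 5≤p))
... | inj₂ (inj₁ 3∣r) = contradiction (subst (3 ℕ∣.∣_) (sym (m≡m%n+[m/n]*n p 24)) (ℕ∣.∣m∣n⇒∣m+n (ℕ∣.m%n≡0⇒n∣m (p % 24) 3 3∣r) (ℕ∣.∣n⇒∣m*n (p /ℕ 24) (ℕ∣.divides 8 refl))))
                   (prime∤ prime-p (s≤s (s≤s z≤n)) (ℕ.<-≤-trans (s≤s (s≤s (s≤s (s≤s z≤n)))) 5≤p))
... | inj₂ (inj₂ r²≡1) = r * r /ℕ 24 + (r + r + t * 24) * t , (begin
  p * p                                    ≡⟨ cong₂ _*_ (m≡m%n+[m/n]*n p 24) (m≡m%n+[m/n]*n p 24) ⟩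
  (r + t * 24) * (r + t * 24)              ≡⟨ expand r t ⟩
  r * r + (r + r + t * 24) * t * 24        ≡⟨ cong (_+ (r + r + t * 24) * t * 24) (trans (m≡m%n+[m/n]*n (r * r) 24) (cong (_+ r * r /ℕ 24 * 24) r²≡1)) ⟩
  suc (r * r /ℕ 24 * 24 + (r + r + t * 24) * t * 24) ≡⟨ cong suc (ℕ.*-distribʳ-+ 24 (r * r /ℕ 24) _) ⟨
  suc ((r * r /ℕ 24 + (r + r + t * 24) * t) * 24) ∎)
  where
  open ≡-Reasoning
  r t : ℕ
  r = p % 24
  t = p /ℕ 24
  expand : ∀ r t → (r + t * 24) * (r + t * 24) ≡ r * r + (r + r + t * 24) * t * 24
  expand = ℕ.solve-∀

3≤prime : ∀ p → Prime p → 3 ≤ p → p ≡ 3 ⊎ 5 ≤ p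
3≤prime p prime-p 3≤p with p ℕ.≟ 3 | p ℕ.≟ 4
... | yes p≡3 | _ = inj₁ p≡3
... | no _    | yes refl = contradiction (ℕ∣.divides 2 refl) (prime∤ prime-p (s≤s (s≤s z≤n)) (s≤s (s≤s (s≤s z≤n))))
... | no p≢3  | no p≢4 = inj₂ (ℕ.≤∧≢⇒< (ℕ.≤∧≢⇒< 3≤p (λ e → p≢3 (sym e))) (λ e → p≢4 (sym e)))

-- For p ≥ 5 the factor p^(2α) preserves the class 1 modulo 24. For p = 3 and α > 0 one factor 9 is
-- set aside, and the remaining number is 1 modulo 8 because 9 = 1 + 8. The predicate is abstract,
-- so the case analysis never meets `v₀`.
nonsquare-cases : (D : ℕ → Set) →
  (∀ x n → x ≡ suc (n * 24) → NonSquare x → D x) →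
  (∀ x n → x ≡ suc (n * 8) → NonSquare x → D (3 * 3 * x)) →
  ∀ p → Prime p → 3 ≤ p → ∀ α n → NonSquare (suc (n * 24)) → D (p ^ (2 * α) * suc (n * 24))
nonsquare-cases D D₂₄ D₉ p prime-p 3≤p α n nonsquare with 3≤prime p prime-p 3≤p
... | inj₂ 5≤p with ≡1mod-p² 24 p α n (p²≡1mod24 p prime-p 5≤p)
...   | m , eq = D₂₄ _ m eq (p^2α-nonsquare prime-p α nonsquare)
nonsquare-cases D D₂₄ D₉ _ prime-p 3≤p zero n nonsquare | inj₁ refl =
  D₂₄ _ n (ℕ.*-identityˡ (suc (n * 24))) (p^2α-nonsquare prime-p 0 nonsquare)
nonsquare-cases D D₂₄ D₉ _ prime-p 3≤p (suc α) n nonsquare | inj₁ refl with ≡1mod-p² 8 3 α (n * 3) (1 , refl)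
... | m , eq = subst D (sym (p^2α 3 α (suc (n * 24))))
  (D₉ (3 ^ (2 * α) * suc (n * 24)) m (trans (cong (λ e → 3 ^ (2 * α) * suc e) (triple n)) eq) (p^2α-nonsquare prime-p α nonsquare))
  where
  triple : ∀ n → n * 24 ≡ n * 3 * 8
  triple = ℕ.solve-∀

27∣v₀-nonsquare : ∀ p → Prime p → 3 ≤ p → ∀ α n → NonSquare (suc (n * 24)) → + 27 ∣ v₀ (p ^ (2 * α) * suc (n * 24) * 2 * 2)
27∣v₀-nonsquare = nonsquare-cases (λ x → + 27 ∣ v₀ (x * 2 * 2)) 27∣v₀-24n+1 27∣v₀-9[8n+1]

halve : ∀ (z : ℤ) n → z ≡ + (n * 2) → + n ≡ z / + 2
halve z n refl = sym (trans (ℤ.*-identityˡ _) (cong +_ (m*n/n≡m n 2)))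

-- A root s of 24n + 1 is prime to 6, hence s = ±(6k + 1), and then n = k(3k + 1)/2. For s = 6t + 1
-- this gives k = t, for s = 6t + 5 it gives k = -(t + 1).
nonpentagonal⇒nonsquare : ∀ n → (∀ (k : ℤ) → + n ≢ (k ℤ.* (+ 3 ℤ.* k ℤ.+ + 1)) / (+ 2)) → NonSquare (suc (n * 24))
nonpentagonal⇒nonsquare n nonpentagonal s eq = [ (λ r≡1 → nonpentagonal (+ t) (halve _ n (case₁ r≡1))) , (λ r≡5 → nonpentagonal (ℤ.- (+ suc t)) (halve _ n (case₅ r≡5))) ]′
  (residues (m%n<n s 6) r²≡1)
  where
  open ≡-Reasoning
  r t : ℕ
  r = s % 6
  t = s /ℕ 6
  residues : ∀ {r} → r < 6 → r * r % 6 ≡ 1 → r ≡ 1 ⊎ r ≡ 5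
  residues = from-yes (ℕ.allUpTo? (λ r → (r * r % 6 ℕ.≟ 1) →-dec ((r ℕ.≟ 1) ⊎-dec (r ℕ.≟ 5))) 6)
  expand : ∀ r t → (r + t * 6) * (r + t * 6) ≡ r * r + (r + r + t * 6) * t * 6
  expand = ℕ.solve-∀
  four : ∀ n → suc (n * 24) ≡ 1 + n * 4 * 6
  four = ℕ.solve-∀
  twelve : ∀ n → suc (n * 24) ≡ suc (n * 2 * 12)
  twelve = ℕ.solve-∀
  s²≡ : (r + t * 6) * (r + t * 6) ≡ suc (n * 24)
  s²≡ = trans (cong (λ e → e * e) (sym (m≡m%n+[m/n]*n s 6))) (sym eq)
  r²≡1 : r * r % 6 ≡ 1
  r²≡1 = begin
    r * r % 6                          ≡⟨ [m+kn]%n≡m%n (r * r) ((r + r + t * 6) * t) 6 ⟨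
    (r * r + (r + r + t * 6) * t * 6) % 6 ≡⟨ cong (_% 6) (expand r t) ⟨
    (r + t * 6) * (r + t * 6) % 6      ≡⟨ cong (_% 6) (trans s²≡ (four n)) ⟩
    (1 + n * 4 * 6) % 6                ≡⟨ [m+kn]%n≡m%n 1 (n * 4) 6 ⟩
    1 ∎
  twelfth : ∀ x r′ → r ≡ r′ → suc (x * 12) ≡ (r′ + t * 6) * (r′ + t * 6) → x ≡ n * 2
  twelfth x r′ r≡ x≡ = ℕ.*-cancelʳ-≡ x (n * 2) 12 (ℕ.suc-injective
    (trans x≡ (trans (cong (λ e → (e + t * 6) * (e + t * 6)) (sym r≡)) (trans s²≡ (twelve n)))))
  square₁ : ∀ t → suc (t * (3 * t + 1) * 12) ≡ (1 + t * 6) * (1 + t * 6)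
  square₁ = ℕ.solve-∀
  square₅ : ∀ t → suc (suc t * (3 * t + 2) * 12) ≡ (5 + t * 6) * (5 + t * 6)
  square₅ = ℕ.solve-∀
  signs : ∀ t → ℤ.- (+ 1 ℤ.+ t) ℤ.* (+ 3 ℤ.* ℤ.- (+ 1 ℤ.+ t) ℤ.+ + 1) ≡ (+ 1 ℤ.+ t) ℤ.* (+ 3 ℤ.* t ℤ.+ + 2)
  signs = solve-∀
  case₁ : r ≡ 1 → + t ℤ.* (+ 3 ℤ.* + t ℤ.+ + 1) ≡ + (n * 2)
  case₁ r≡1 = begin
    + t ℤ.* (+ 3 ℤ.* + t ℤ.+ + 1)    ≡⟨ cong (+ t ℤ.*_) (trans (cong (ℤ._+ + 1) (sym (ℤ.pos-* 3 t))) (sym (ℤ.pos-+ (3 * t) 1))) ⟩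
    + t ℤ.* + (3 * t + 1)            ≡⟨ ℤ.pos-* t (3 * t + 1) ⟨
    + (t * (3 * t + 1))              ≡⟨ cong +_ (twelfth (t * (3 * t + 1)) 1 r≡1 (square₁ t)) ⟩
    + (n * 2) ∎
  case₅ : r ≡ 5 → ℤ.- (+ suc t) ℤ.* (+ 3 ℤ.* ℤ.- (+ suc t) ℤ.+ + 1) ≡ + (n * 2)
  case₅ r≡5 = begin
    ℤ.- (+ suc t) ℤ.* (+ 3 ℤ.* ℤ.- (+ suc t) ℤ.+ + 1) ≡⟨ cong (λ e → ℤ.- e ℤ.* (+ 3 ℤ.* ℤ.- e ℤ.+ + 1)) (ℤ.pos-+ 1 t) ⟩
    ℤ.- (+ 1 ℤ.+ + t) ℤ.* (+ 3 ℤ.* ℤ.- (+ 1 ℤ.+ + t) ℤ.+ + 1) ≡⟨ signs (+ t) ⟩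
    (+ 1 ℤ.+ + t) ℤ.* (+ 3 ℤ.* + t ℤ.+ + 2) ≡⟨ cong ((+ 1 ℤ.+ + t) ℤ.*_) (trans (cong (ℤ._+ + 2) (sym (ℤ.pos-* 3 t))) (sym (ℤ.pos-+ (3 * t) 2))) ⟩
    + suc t ℤ.* + (3 * t + 2)       ≡⟨ ℤ.pos-* (suc t) (3 * t + 2) ⟨
    + (suc t * (3 * t + 2))         ≡⟨ cong +_ (twelfth (suc t * (3 * t + 2)) 5 r≡5 (square₅ t)) ⟩
    + (n * 2) ∎

-- The number is p((24n + 1)p + 24i). Were it a square, p would divide the second factor and hence
-- 24i, which p ≥ 5 and 0 < i < p exclude.
exactly-one-p-nonsquare : ∀ {p} → Prime p → 5 ≤ p → ∀ n i → 1 ≤ i → i < p → NonSquare (24 * p * (p * n + i) + p * p)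
exactly-one-p-nonsquare {p} prime-p 5≤p n i@(suc _) 1≤i i<p s eq = contradiction (ℕ∣.∣⇒≤ p∣i) (ℕ.<⇒≱ i<p)
  where
  open ≡-Reasoning
  instance _ = prime⇒nonZero prime-p
  p∤ : ∀ d .{{_ : NonZero d}} → d < p → ¬ p ℕ∣.∣ d
  p∤ d d<p p∣d = ℕ.<⇒≱ d<p (ℕ∣.∣⇒≤ p∣d)
  factor : ∀ p n i → 24 * p * (p * n + i) + p * p ≡ (24 * (p * n + i) + p) * p
  factor = ℕ.solve-∀
  p∣s : p ℕ∣.∣ s
  p∣s = prime∣square s prime-p (ℕ∣.divides (24 * (p * n + i) + p) (trans (sym eq) (factor p n i)))
  p∣24i : p ℕ∣.∣ 24 * i
  p∣24i = case p∣s of λ { (ℕ∣.divides-refl t) → ℕ∣.∣m+n∣m⇒∣n {m = (24 * n + 1) * p} {n = 24 * i}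
    (ℕ∣.divides (t * t) (ℕ.*-cancelʳ-≡ ((24 * n + 1) * p + 24 * i) (t * t * p) p (trans (regroup p n i) (trans eq (cube t p))))) (ℕ∣.n∣m*n (24 * n + 1)) }
    where
    regroup : ∀ p n i → ((24 * n + 1) * p + 24 * i) * p ≡ 24 * p * (p * n + i) + p * p
    regroup = ℕ.solve-∀
    cube : ∀ t p → t * p * (t * p) ≡ t * t * p * p
    cube = ℕ.solve-∀
  p∣i : p ℕ∣.∣ i
  p∣i = [ (λ p∣24 → contradiction p∣24 p∤24) , id ]′ (euclidsLemma 24 i prime-p p∣24i)
    where
    p∤24 : ¬ p ℕ∣.∣ 24
    p∤24 p∣24 = [ (λ p∣8 → [ p∤ 2 (ℕ.<-≤-trans (s≤s (s≤s (s≤s z≤n))) 5≤p) , p∤ 4 5≤p ]′ (euclidsLemma 2 4 prime-p p∣8))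
                , p∤ 3 (ℕ.<-≤-trans (s≤s (s≤s (s≤s (s≤s z≤n)))) 5≤p) ]′ (euclidsLemma 8 3 prime-p p∣24)

-- A root s would satisfy s² - (24j + 1) = 24n · p.
nonresidue⇒nonsquare : ∀ p n j → QuadraticNonresidue (+ (24 * j + 1)) p → NonSquare (suc ((p * n + j) * 24))
nonresidue⇒nonsquare p n j nonresidue s eq = nonresidue (+ s , divides (+ (24 * n)) (begin
  + s ℤ.* + s ℤ.- + (24 * j + 1)                 ≡⟨ cong (ℤ._- + (24 * j + 1)) (trans (sym (ℤ.pos-* s s)) (cong +_ (trans (sym eq) (regroup p n j)))) ⟩
  + (24 * n * p + (24 * j + 1)) ℤ.- + (24 * j + 1) ≡⟨ cong (ℤ._- + (24 * j + 1)) (ℤ.pos-+ (24 * n * p) (24 * j + 1)) ⟩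
  + (24 * n * p) ℤ.+ + (24 * j + 1) ℤ.- + (24 * j + 1) ≡⟨ cancel (+ (24 * n * p)) (+ (24 * j + 1)) ⟩
  + (24 * n * p)                                 ≡⟨ ℤ.pos-* (24 * n) p ⟩
  + (24 * n) ℤ.* + p ∎))
  where
  open ≡-Reasoning
  regroup : ∀ p n j → suc ((p * n + j) * 24) ≡ 24 * n * p + (24 * j + 1)
  regroup = ℕ.solve-∀
  cancel : ∀ a b → a ℤ.+ b ℤ.- b ≡ a
  cancel = solve-∀

theorem5p6 : ∀ (p p₁ : ℕ) → Prime p → 3 ≤ p → Prime p₁ → 5 ≤ p₁ →
    ∀ (n α : ℕ) →
    ((∀ (k : ℤ) → + n ≢ (k ℤ.* (+ 3 ℤ.* k ℤ.+ + 1)) / (+ 2)) →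
    + 27 ∣ v₀ (p ^ (2 * α) * (96 * n + 4)))
    × (∀ (i : ℕ) → 1 ≤ i → i < p₁ →
    + 27 ∣ v₀ (p ^ (2 * α) * p₁ * (96 * p₁ * n + 96 * i + 4 * p₁)))
    × (∀ (j : ℕ) → QuadraticNonresidue (+ (24 * j + 1)) p₁ →
    + 27 ∣ v₀ (p ^ (2 * α) * (96 * p₁ * n + 96 * j + 4)))
theorem5p6 p p₁ prime-p 3≤p prime-p₁ 5≤p₁ n α = part₁ , part₂ , part₃
  where
  P = p ^ (2 * α)
  index₁ : ∀ P n → P * suc (n * 24) * 2 * 2 ≡ P * (96 * n + 4)
  index₁ = ℕ.solve-∀
  part₁ : _
  part₁ nonpentagonal = subst (λ e → + 27 ∣ v₀ e) (index₁ P n)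
    (27∣v₀-nonsquare p prime-p 3≤p α n (nonpentagonal⇒nonsquare n nonpentagonal))
  -- Absorbing p₁ into the bracket gives 4(24p₁(p₁n + i) + p₁²), and p₁² ≡ 1 modulo 24 brings the
  -- inner number to the form 24n' + 1.
  index₂ : ∀ P p n i → P * (24 * p * (p * n + i) + p * p) * 2 * 2 ≡ P * p * (96 * p * n + 96 * i + 4 * p)
  index₂ = ℕ.solve-∀
  shift₂ : ∀ p n i u → 24 * p * (p * n + i) + suc (u * 24) ≡ suc ((p * (p * n + i) + u) * 24)
  shift₂ = ℕ.solve-∀
  part₂ : ∀ i → 1 ≤ i → i < p₁ → _
  part₂ i 1≤i i<p₁ with p²≡1mod24 p₁ prime-p₁ 5≤p₁
  ... | u , p₁²≡ = subst (λ e → + 27 ∣ v₀ e) (trans (cong (λ e → P * e * 2 * 2) (sym x≡)) (index₂ P p₁ n i))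
    (27∣v₀-nonsquare p prime-p 3≤p α (p₁ * (p₁ * n + i) + u) (subst NonSquare x≡ (exactly-one-p-nonsquare prime-p₁ 5≤p₁ n i 1≤i i<p₁)))
    where
    x≡ : 24 * p₁ * (p₁ * n + i) + p₁ * p₁ ≡ suc ((p₁ * (p₁ * n + i) + u) * 24)
    x≡ = trans (cong (λ e → 24 * p₁ * (p₁ * n + i) + e) p₁²≡) (shift₂ p₁ n i u)
  index₃ : ∀ P p n j → P * suc ((p * n + j) * 24) * 2 * 2 ≡ P * (96 * p * n + 96 * j + 4)
  index₃ = ℕ.solve-∀
  part₃ : ∀ j → QuadraticNonresidue (+ (24 * j + 1)) p₁ → _
  part₃ j nonresidue = subst (λ e → + 27 ∣ v₀ e) (index₃ P p₁ n j)
    (27∣v₀-nonsquare p prime-p 3≤p α (p₁ * n + j) (nonresidue⇒nonsquare p₁ n j nonresidue))
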